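{- Let $n=ks$ with $s\geq2$, and let $\mathcal{F}$ be a flag on $\mathbb{F}_q^n$ of type $(1,\dots,k,n-k,\dots,n-1)$ such that its $k$-dimensional subspace $\mathcal{F}_k$ belongs to $\mathcal{S}$ and its $(n-k)$-dimensional subspace $\mathcal{F}_{n-k}$ belongs to $\mathcal{H}$. For a positive integer $t$ dividing $q^n-1$, let $\mathbf{T}$ be the unique subgroup of order $t$ of the cyclic group $\langle\psi(M_s)\rangle$. Then: (i) $|\mathrm{Orb}_{\mathbf{T}}(\mathcal{F})|=\frac{t}{\gcd(t,q-1)}$; (ii) $\mathrm{Orb}_{\mathbf{T}}(\mathcal{F})$ is an optimum distance flag code if and only if $\gcd(t,q^k-1)=\gcd(t,q-1)\neq t$.
   Context: Let $\omega$ be a primitive element of $\mathbb{F}_{q^k}$, with minimal polynomial $p(x)$ over $\mathbb{F}_q$ of degree $k$ and companion matrix $M_k\in\mathrm{GL}(k,q)$; then $\phi:\mathbb{F}_{q^k}=\mathbb{F}_q[\omega]\to\mathbb{F}_q[M_k]$, $\sum_i a_i\omega^i\mapsto\sum_i a_iM_k^i$ ($a_i\in\mathbb{F}_q$) is a field isomorphism onto a set of $k\times k$ matrices. For a matrix $A=(a_{ij})$ over $\mathbb{F}_{q^k}$, let $\psi(A)$ (resp. for a subspace $\mathrm{rowsp}(A)$ of $\mathbb{F}_{q^k}^s$, $\varphi(\mathrm{rowsp}(A))$) be the block matrix $(\phi(a_{ij}))$ over $\mathbb{F}_q$ (resp. its row space in $\mathbb{F}_q^{ks}$); $\psi:\mathrm{GL}(s,q^k)\to\mathrm{GL}(ks,q)$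 is a group monomorphism and $\varphi$ maps $m$-dimensional $\mathbb{F}_{q^k}$-subspaces of $\mathbb{F}_{q^k}^s$ injectively to $km$-dimensional subspaces of $\mathbb{F}_q^{ks}$. Let $\alpha$ be a primitive element of $\mathbb{F}_{q^n}$ and $M_s\in\mathrm{GL}(s,q^k)$ the companion matrix of the minimal polynomial of $\alpha$ over $\mathbb{F}_{q^k}$; $\langle\psi(M_s)\rangle$ is a cyclic subgroup of $\mathrm{GL}(n,q)$ of order $q^n-1$. Define $\mathcal{S}=\{\varphi(l)\mid l\text{ a 1-dim subspace of }\mathbb{F}_{q^k}^s\}$ (a $k$-spread of $\mathbb{F}_q^n$) and $\mathcal{H}=\{\varphi(h)\mid h\text{ an }(s-1)\text{ -dim subspace of }\mathbb{F}_{q^k}^s\}$. A flag of type $(1,\dots,k,n-k,\dots,n-1)$ is a chain of subspaces of $\mathbb{F}_q^n$ with these dimensions (listed increasingly, with the dimension $k=n-k$ appearing once if $s=2$). $\mathrm{GL}(n,q)$ acts on subspaces by $\mathcal{V}\cdot A=\mathrm{rowsp}(VA)$ and on flags componentwise; $\mathrm{Orb}_{\mathbf{T}}$ is the orbit. With $d_S(\mathcal{U},\mathcal{V})=\dim(\mathcal{U}+\mathcal{V})-\dim(\mathcal{U}\cap\mathcal{V})$ and $d_f(\mathcal{F},\mathcal{F}')=\sum_i d_S(\mathcal{F}_i,\mathcal{F}'_i)$, a flag code $\mathcal{C}$ of type $(t_1,\dots,t_r)$ is an optimum distance flag code if its minimum flag distance (defined as $0$ if $|\mathcal{C}|=1$)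 equals $2\left(\sum_{2t_i\leq n}t_i+\sum_{2t_i>n}(n-t_i)\right)$. -}

module Defs where

open import Level using (Level) renaming (suc to lsuc; zero to lzero)
open import Data.Nat as ℕ using (ℕ; zero; suc; _∸_; _≤_; NonZero)
open import Data.Nat.DivMod using (_/_)
open import Data.Nat.GCD using (gcd; gcd[m,n]≢0)
open import Data.Fin as Fin using (Fin; toℕ; remQuot)
open import Data.Vec as Vec using (Vec; lookup; tabulate; replicate; zipWith)
open import Data.Nat.ListAction using (sum)
open import Data.List as List using (List; _++_; applyUpTo; upTo; filter; length)
open import Data.Product using (Σ; ∃; ∃-syntax; _×_; _,_; proj₁; proj₂)
open import Data.Sum using (_⊎_; inj₁)
open import Data.Bool using (if_then_else_)
open import Relation.Nullary using (¬_; does)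
open import Relation.Binary.PropositionalEquality using (_≡_; _≢_)
open import Algebra.Structures using (IsCommutativeRing)
open import Function using (_∘_)
open import Function.Bundles using (_↔_; _⇔_)

record FiniteField : Set₁ where
  infixl 6 _+_
  infixl 7 _*_
  field
    Carrier           : Set
    _+_ _*_           : Carrier → Carrier → Carrier
    -_                : Carrier → Carrier
    0# 1#             : Carrier
    isCommutativeRing : IsCommutativeRing _≡_ _+_ _*_ -_ 0# 1#
    0≢1               : 0# ≢ 1#
    inverse           : ∀ x → x ≢ 0# → ∃[ y ] (x * y ≡ 1#)
    size              : ℕ
    enumeration       : Fin size ↔ Carrier

Car : FiniteField → Set
Car = FiniteField.Carrier

size : FiniteField → ℕ
size = FiniteField.size

record IsFieldHom (F K : FiniteField) (f : Car F → Car K) : Set where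
  private
    module F = FiniteField F
    module K = FiniteField K
  field
    +-hom : ∀ x y → f (x F.+ y) ≡ f x K.+ f y
    *-hom : ∀ x y → f (x F.* y) ≡ f x K.* f y
    1-hom : f F.1# ≡ K.1#

module LinAlg (F : FiniteField) where
  open FiniteField F

  Σ[_] : ∀ {d} → (Fin d → Carrier) → Carrier
  Σ[_] {zero}  f = 0#
  Σ[_] {suc d} f = f Fin.zero + Σ[ f ∘ Fin.suc ]

  infixr 8 _^_
  _^_ : Carrier → ℕ → Carrier
  x ^ zero  = 1#
  x ^ suc n = x * (x ^ n)

  Primitive : Carrier → Set
  Primitive ω = ∀ x → x ≢ 0# → ∃[ i ] (x ≡ ω ^ i)

  evalMonic : ∀ {d} → Vec Carrier d → Carrier → Carrier
  evalMonic {d} c x = x ^ d + Σ[ (λ i → lookup c i * x ^ toℕ i) ]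

  Vector : ℕ → Set
  Vector N = Vec Carrier N

  Matrix : ℕ → ℕ → Set
  Matrix m N = Vec (Vector N) m

  zeroV : ∀ {N} → Vector N
  zeroV = replicate _ 0#

  _+ᵥ_ : ∀ {N} → Vector N → Vector N → Vector N
  _+ᵥ_ = zipWith _+_

  _•_ : ∀ {N} → Carrier → Vector N → Vector N
  a • v = Vec.map (a *_) v

  ΣV : ∀ {d N} → (Fin d → Vector N) → Vector N
  ΣV {zero}  f = zeroV
  ΣV {suc d} f = f Fin.zero +ᵥ ΣV (f ∘ Fin.suc)

  lincomb : ∀ {d N} → (Fin d → Carrier) → (Fin d → Vector N) → Vector N
  lincomb c v = ΣV (λ i → c i • v i)

  Sub : ℕ → Set₁
  Sub N = Vector N → Set

  Span : ∀ {d N} → (Fin d → Vector N) → Sub N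
  Span v x = ∃[ c ] (x ≡ lincomb c v)

  LinIndep : ∀ {d N} → (Fin d → Vector N) → Set
  LinIndep v = ∀ c → lincomb c v ≡ zeroV → ∀ i → c i ≡ 0#

  IsSubspace : ∀ {N} → Sub N → Set
  IsSubspace W = W zeroV × (∀ x y → W x → W y → W (x +ᵥ y))
                         × (∀ a x → W x → W (a • x))

  Dim : ∀ {N} → Sub N → ℕ → Set
  Dim {N} W d = Σ (Fin d → Vector N) λ b → ((∀ (i : Fin d) → W (b i)) × LinIndep b × (∀ x → W x → Span b x))

  _⊆_ : ∀ {N} → Sub N → Sub N → Set
  U ⊆ V = ∀ x → U x → V x

  _≐_ : ∀ {N} → Sub N → Sub N → Set
  U ≐ V = U ⊆ V × V ⊆ U

  _∩_ : ∀ {N} → Sub N → Sub N → Sub N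
  (U ∩ V) x = U x × V x

  _⊞_ : ∀ {N} → Sub N → Sub N → Sub N
  (U ⊞ V) x = ∃[ u ] ∃[ v ] (U u × V v × x ≡ u +ᵥ v)

  DistS : ∀ {N} → Sub N → Sub N → ℕ → Set
  DistS U V d = ∃[ a ] ∃[ b ] (Dim (U ⊞ V) a × Dim (U ∩ V) b × d ≡ a ∸ b)

  _*ᵥ_ : ∀ {m N} → Vector m → Matrix m N → Vector N
  v *ᵥ A = lincomb (lookup v) (lookup A)

  _*ₘ_ : ∀ {m l N} → Matrix m l → Matrix l N → Matrix m N
  A *ₘ B = Vec.map (_*ᵥ B) A

  identity : ∀ {N} → Matrix N N
  identity = tabulate (λ i → tabulate (λ j → if does (i Fin.≟ j) then 1# else 0#))

  _^ₘ_ : ∀ {N} → Matrix N N → ℕ → Matrix N N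
  A ^ₘ zero  = identity
  A ^ₘ suc n = A *ₘ (A ^ₘ n)

  _+ₘ_ : ∀ {m N} → Matrix m N → Matrix m N → Matrix m N
  _+ₘ_ = zipWith _+ᵥ_

  _•ₘ_ : ∀ {m N} → Carrier → Matrix m N → Matrix m N
  a •ₘ A = Vec.map (a •_) A

  ΣM : ∀ {d m N} → (Fin d → Matrix m N) → Matrix m N
  ΣM {zero}  f = replicate _ zeroV
  ΣM {suc d} f = f Fin.zero +ₘ ΣM (f ∘ Fin.suc)

  -- companion matrix of the monic polynomial x^d + c_{d-1}x^{d-1} + ... + c_0:
  -- ones on the superdiagonal, last row (-c_0, ..., -c_{d-1})
  companion : ∀ {d} → Vec Carrier d → Matrix d d
  companion {d} c = tabulate (λ i → tabulate (λ j →
    if does (suc (toℕ i) ℕ.≟ d) then - lookup c j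
    else (if does (toℕ j ℕ.≟ suc (toℕ i)) then 1# else 0#)))

  _·_ : ∀ {N} → Sub N → Matrix N N → Sub N
  (W · A) v = ∃[ w ] (W w × v ≡ w *ᵥ A)

  record IsSubgroupOfOrderIn {N} (g : Matrix N N) (T : Matrix N N → Set) (t : ℕ) : Set where
    field
      ⊆⟨g⟩     : ∀ A → T A → ∃[ i ] (A ≡ g ^ₘ i)
      has-id   : T identity
      closed   : ∀ A B → T A → T B → T (A *ₘ B)
      inverses : ∀ A → T A → ∃[ B ] (T B × A *ₘ B ≡ identity)
      order    : Σ (Fin t → Matrix N N) λ els → ((∀ (i : Fin t) → T (els i))
                         × (∀ i j → els i ≡ els j → i ≡ j)
                         × (∀ A → T A → ∃[ i ] (A ≡ els i)))

  record Flag (N : ℕ) (ty : List ℕ) : Set₁ where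
    constructor mkFlag
    infix 30 _⟨_⟩
    field
      _⟨_⟩ : Fin (length ty) → Sub N
  open Flag public

  IsFlag : ∀ {N ty} → Flag N ty → Set
  IsFlag {N} {ty} 𝓕 = (∀ i → IsSubspace (𝓕 ⟨ i ⟩) × Dim (𝓕 ⟨ i ⟩) (List.lookup ty i))
                    × (∀ i j → toℕ i ≤ toℕ j → 𝓕 ⟨ i ⟩ ⊆ 𝓕 ⟨ j ⟩)

  _≈F_ : ∀ {N ty} → Flag N ty → Flag N ty → Set
  𝓕 ≈F 𝓖 = ∀ i → 𝓕 ⟨ i ⟩ ≐ 𝓖 ⟨ i ⟩

  _·F_ : ∀ {N ty} → Flag N ty → Matrix N N → Flag N ty
  𝓕 ·F A = mkFlag (λ i → 𝓕 ⟨ i ⟩ · A)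

  Orb : ∀ {N ty} → (Matrix N N → Set) → Flag N ty → Flag N ty → Set
  Orb {N} T 𝓕 𝓖 = Σ (Matrix N N) λ A → (T A × 𝓖 ≈F (𝓕 ·F A))

  Card : ∀ {N ty} → (Flag N ty → Set) → ℕ → Set₁
  Card {N} {ty} C m = Σ (Fin m → Flag N ty) λ els → ((∀ (i : Fin m) → C (els i))
                    × (∀ i j → els i ≈F els j → i ≡ j)
                    × (∀ 𝓖 → C 𝓖 → ∃[ i ] (𝓖 ≈F els i)))

  DistF : ∀ {N ty} → Flag N ty → Flag N ty → ℕ → Set
  DistF {N} {ty} 𝓕 𝓖 d = Σ (Fin (length ty) → ℕ) λ ds → ((∀ i → DistS (𝓕 ⟨ i ⟩) (𝓖 ⟨ i ⟩) (ds i)) × d ≡ sumF ds)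
    where
    sumF : ∀ {r} → (Fin r → ℕ) → ℕ
    sumF {zero}  f = 0
    sumF {suc r} f = f Fin.zero ℕ.+ sumF (f ∘ Fin.suc)

  MinDist : ∀ {N ty} → (Flag N ty → Set) → ℕ → Set₁
  MinDist C d =
      (Card C 1 × d ≡ 0)
    ⊎ ((Σ (Flag _ _) λ 𝓕 → Σ (Flag _ _) λ 𝓖 → (C 𝓕 × C 𝓖 × ¬ (𝓕 ≈F 𝓖) × DistF 𝓕 𝓖 d))
       × (∀ 𝓕 𝓖 e → C 𝓕 → C 𝓖 → ¬ (𝓕 ≈F 𝓖) → DistF 𝓕 𝓖 e → d ≤ e))

maxFlagDist : ℕ → List ℕ → ℕ
maxFlagDist N ty = 2 ℕ.* sum (List.map (λ t → if does (2 ℕ.* t ℕ.≤? N) then t else N ∸ t) ty)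

module _ (F : FiniteField) where
  open LinAlg F
  OptimumDistance : ∀ {N ty} → (Flag N ty → Set) → Set₁
  OptimumDistance {N} {ty} C = MinDist C (maxFlagDist N ty)

-- the type (1, ..., k, n-k, ..., n-1) with n = s k (k = n - k listed once if s = 2)
flagType : ℕ → ℕ → List ℕ
flagType k s = applyUpTo suc k
            ++ filter (λ d → k ℕ.<? d) (List.map (λ j → (s ℕ.* k ∸ k) ℕ.+ j) (upTo k))

module _ {F K : FiniteField} where
  private
    module F = FiniteField F
    module K = FiniteField K
    module LK = LinAlg K

  IsMinPoly : (ι : Car F → Car K) → Car K → ∀ {d} → Vec (Car F) d → Set
  IsMinPoly ι x {d} p = (LK.evalMonic (Vec.map ι p) x ≡ K.0#)
                  × (∀ (a : Vec (Car F) d) →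
                       LK.Σ[ (λ i → ι (lookup a i) K.* (x LK.^ toℕ i)) ] ≡ K.0#
                       → a ≡ replicate _ F.0#)

record Setting (q k s : ℕ) : Set₁ where
  field
    F K L    : FiniteField
    F-size   : size F ≡ q
    K-size   : size K ≡ q ℕ.^ k
    L-size   : size L ≡ q ℕ.^ (s ℕ.* k)
    ι        : Car F → Car K
    ι-hom    : IsFieldHom F K ι
    j        : Car K → Car L
    j-hom    : IsFieldHom K L j
    ω        : Car K
    ω-prim   : LinAlg.Primitive K ω
    p        : Vec (Car F) k
    p-min    : IsMinPoly {F} {K} ι ω p
    -- coordinates w.r.t. the F_q-basis 1, ω, ..., ω^{k-1} (unique since deg p = k)
    coords   : Car K → Vec (Car F) k
    coords-ok : ∀ x → LinAlg.Σ[_] K (λ i → FiniteField._*_ K (ι (lookup (coords x) i))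
                                                          (LinAlg._^_ K ω (toℕ i))) ≡ x
    α        : Car L
    α-prim   : LinAlg.Primitive L α
    mα       : Vec (Car K) s
    mα-min   : IsMinPoly {K} {L} j α mα

module Constructions {q k s : ℕ} (σ : Setting q k s) where
  open Setting σ
  module LF = LinAlg F
  module LK = LinAlg K

  n : ℕ
  n = s ℕ.* k

  M-k : LF.Matrix k k
  M-k = LF.companion p

  φ : Car K → LF.Matrix k k
  φ x = LF.ΣM (λ i → lookup (coords x) i LF.•ₘ (M-k LF.^ₘ toℕ i))

  ψ : LK.Matrix s s → LF.Matrix n n
  ψ A = tabulate (λ a → tabulate (λ c →
          let (b₁ , r₁) = remQuot k a
              (b₂ , r₂) = remQuot k c
          in lookup (lookup (φ (lookup (lookup A b₁) b₂)) r₁) r₂))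

  ψrows : ∀ {m} → LK.Matrix m s → Fin (m ℕ.* k) → LF.Vector n
  ψrows A a = let (a₁ , r₁) = remQuot k a in
              tabulate (λ c → let (b , r₂) = remQuot k c in
                 lookup (lookup (φ (lookup (lookup A a₁) b)) r₁) r₂)

  -- φ(rowsp A) = rowsp(ψ(A))
  φSub : ∀ {m} → LK.Matrix m s → LF.Sub n
  φSub A = LF.Span (ψrows A)

  M-s : LK.Matrix s s
  M-s = LK.companion mα

  ψM-s : LF.Matrix n n
  ψM-s = ψ M-s

  InS : LF.Sub n → Set
  InS W = ∃[ A ] (LK.Dim (LK.Span (lookup {n = 1} A)) 1 × W LF.≐ φSub A)

  InH : LF.Sub n → Set
  InH W = ∃[ A ] (LK.Dim (LK.Span (lookup {n = s ∸ 1} A)) (s ∸ 1) × W LF.≐ φSub A)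

divByGcd : (t u : ℕ) → .{{NonZero t}} → ℕ
divByGcd (suc t) u = _/_ (suc t) (gcd (suc t) u) {{ℕ.≢-nonZero (gcd[m,n]≢0 (suc t) u (inj₁ λ ()))}}

-- Sending the a-th unit vector to ω^r α^b, where a = (b , r), gives an F_q-linear bijection θ : F_q^n → F_{q^n}
-- that turns ψ(M_s) into multiplication by α. Hence T acts as the group of t-th roots of unity of F_{q^n}, the
-- members of 𝓢 are the lines over F_{q^k}, and those of 𝓗 the hyperplanes over F_{q^k}.
-- A root of unity x fixes the line 𝓕₁ iff x ∈ F_q, and then it fixes 𝓕; this gives (i). Lines over F_{q^k} are equal
-- or meet trivially. A hyperplane h over F_{q^k} with x h ⊆ h has x ∈ F_{q^k}, so for x ∉ F_{q^k} the hyperplanes h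
-- and x h span F_{q^n}. So 𝓕 and x 𝓕 are at maximal distance iff x ∉ F_{q^k}, and (ii) says that the t-th roots of
-- unity in F_{q^k} all lie in F_q, but that not all t-th roots of unity do.
-- Dimensions are compared by counting vectors.
module Submission where

open import Defs
open import Level using (0ℓ)
open import Algebra.Bundles using (AbelianGroup; CommutativeRing)
import Algebra.Properties.CommutativeMonoid.Sum as CommutativeMonoidSum
open import Data.Bool using (if_then_else_)
open import Data.Fin as Fin using (Fin; toℕ; fromℕ<; combine; remQuot; punchIn; punchOut; _↑ˡ_; _↑ʳ_)
open import Data.Fin.Permutation using (Permutation; permutation)
open import Data.Fin.Properties as Fin using (any?; pigeonhole; injective⇒≤; *↔×; toℕ<n; toℕ-fromℕ<; toℕ-injective; punchIn-injective; punchInᵢ≢i; punchIn-punchOut; punchOut-injective; remQuot-combine; combine-remQuot)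
open import Data.List as List using (List; []; _∷_; length; applyUpTo; upTo; filter)
open import Data.List.Membership.Propositional using (_∈_)
open import Data.List.Membership.Propositional.Properties using (∈-lookup; ∈-++⁺ˡ; ∈-++⁺ʳ; ∈-filter⁺; ∈-map⁺; ∈-upTo⁺; ∈-applyUpTo⁺)
open import Data.List.Relation.Unary.All as All using (All)
import Data.List.Relation.Unary.All.Properties as All
open import Data.List.Relation.Unary.AllPairs as AllPairs using (AllPairs; _∷_)
import Data.List.Relation.Unary.AllPairs.Properties as AllPairs
import Data.List.Relation.Unary.Any as Any
open import Data.List.Relation.Unary.Any.Properties using (lookup-index)
open import Data.Nat as ℕ using (ℕ; zero; suc; _≤_; _<_; _∸_; s≤s; z≤n; NonZero)
open import Data.Nat.Divisibility as ∣ using (_∣_; divides)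
open import Data.Nat.DivMod using (_%_; _/_; m≡m%n+[m/n]*n; m%n<n; m/n*n≡m)
open import Data.Nat.GCD using (gcd; gcd[m,n]∣m; gcd[m,n]∣n; gcd[m,n]≢0; gcd-greatest; c*gcd[m,n]≡gcd[cm,cn])
open import Data.Nat.Induction using (<-rec)
import Data.Nat.Properties as ℕ
open import Data.Product using (Σ; ∃; ∃-syntax; _×_; _,_; proj₁; proj₂)
open import Data.Product.Function.NonDependent.Propositional using (_×-↔_)
open import Data.Sum using (_⊎_; inj₁; inj₂; [_,_]′)
open import Data.Vec as Vec using (Vec; []; _∷_; tabulate; replicate)
import Data.Vec.Functional as VecF
open import Data.Vec.Properties as Vec using (lookup∘tabulate; tabulate∘lookup; tabulate-cong; lookup-zipWith; lookup-map; lookup-replicate)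
open import Function using (_∘_; _|>_)
open import Function.Bundles using (_↔_; _⇔_; Inverse; mk↔ₛ′; mk⇔)
open import Function.Construct.Composition using (_↔-∘_)
open import Function.Construct.Identity using (↔-id)
open import Relation.Binary.PropositionalEquality
open import Relation.Nullary using (¬_; Dec; does; yes; no; contradiction)
open import Relation.Nullary.Decidable using (map′; _×-dec_; ¬?; decidable-stable; dec-true; dec-false)
open import Relation.Unary using (Decidable)

-- Finite sets

-- `T` is given only as some subgroup of order `t`, so it has to be found out which multiplications
-- it contains. Its scalars are `t` units of F_{q^n}, closed under products. By Lagrange each solves
-- x^t = 1, and the cyclic group F_{q^n}^× has just `t` solutions, so the scalars are all of them.
-- The same argument for the images of F_q^× and F_{q^k}^× shows that a unit lies in F_q or F_{q^k}
-- iff its order divides q-1 or q^k-1. Membership thus becomes divisibility of exponents, the source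
-- of the gcds: x^t = 1 and x^(q^k-1) = 1 together mean x^gcd(t, q^k-1) = 1. The type of the flag
-- enters through nesting: components of dimension at most k lie inside the F_{q^k}-line and inherit
-- trivial intersections; those of dimension at least n-k contain the F_{q^k}-hyperplane and inherit
-- full sums. Subspaces are bare predicates, and a distance is a relation that needs bases of a sum
-- and an intersection. A known basis makes membership decidable, since coefficient vectors can be
-- enumerated; searching then produces those bases, so that distances exist.

Inj : {A B : Set} → (A → B) → Set
Inj f = ∀ x y → f x ≡ f y → x ≡ y

module _ {m : ℕ} {A : Set} (e : Fin m ↔ A) where
  open Inverse e

  from-inj : Inj from
  from-inj x y eq = trans (sym (strictlyInverseˡ x)) (trans (cong to eq) (strictlyInverseˡ y))

  to-inj : Inj to
  to-inj x y eq = trans (sym (strictlyInverseʳ x)) (trans (cong from eq) (strictlyInverseʳ y))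

  abstract
    finite-≟ : (x y : A) → Dec (x ≡ y)
    finite-≟ x y = map′ (from-inj x y) (cong from) (from x Fin.≟ from y)

    finite-∃? : {P : A → Set} → (∀ x → Dec (P x)) → Dec (∃ P)
    finite-∃? {P} P? = map′ (λ (i , p) → to i , p)
      (λ (x , p) → from x , subst P (sym (strictlyInverseˡ x)) p) (any? (P? ∘ to))

inj⇒size≤ : ∀ {m n} {A B : Set} → Fin m ↔ A → Fin n ↔ B → (f : A → B) → Inj f → m ≤ n
inj⇒size≤ e e′ f f-inj = injective⇒≤ {f = Inverse.from e′ ∘ f ∘ Inverse.to e}
  (to-inj e _ _ ∘ f-inj _ _ ∘ from-inj e′ _ _)

abstract
  -- If `y` were missed, `punchOut` would squeeze the image into n - 1 elements, too few for m ≥ n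
  -- distinct values.
  inj⇒surj-Fin : ∀ {m n} → n ≤ m → (f : Fin m → Fin n) → Inj f → ∀ y → ∃[ x ] f x ≡ y
  inj⇒surj-Fin {m} {suc n} n≤m f f-inj y with any? (λ x → f x Fin.≟ y)
  ... | yes p = p
  ... | no  h = contradiction (ℕ.≤-trans n≤m (injective⇒≤ {f = λ x → punchOut (y≢f x)}
                  (λ {x} {x′} eq → f-inj x x′ (punchOut-injective (y≢f x) (y≢f x′) eq)))) ℕ.1+n≰n
    where
    y≢f : ∀ x → y ≢ f x
    y≢f x eq = h (x , sym eq)

  -- The source of surjectivity for `θ` and for decompositions of F_{q^n}: sizes are compared, no
  -- inverse is constructed.
  inj⇒surj : ∀ {m n} {A B : Set} → Fin m ↔ A → Fin n ↔ B → n ≤ m →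
             (f : A → B) → Inj f → ∀ y → ∃[ x ] f x ≡ y
  inj⇒surj e e′ n≤m f f-inj y =
    let i , eq = inj⇒surj-Fin n≤m (Inverse.from e′ ∘ f ∘ Inverse.to e)
                   (λ _ _ → to-inj e _ _ ∘ f-inj _ _ ∘ from-inj e′ _ _) (Inverse.from e′ y)
    in Inverse.to e i , from-inj e′ _ _ eq

Vec↔ : ∀ {m} {A : Set} → Fin m ↔ A → ∀ d → Fin (m ℕ.^ d) ↔ Vec A d
Vec↔ {A = A} e zero = mk↔ₛ′ (λ _ → Vec.[]) (λ _ → Fin.zero) to-from from-to
  where
  to-from : (v : Vec A 0) → Vec.[] ≡ v
  to-from Vec.[] = refl
  from-to : (i : Fin 1) → Fin.zero ≡ i
  from-to Fin.zero = refl
Vec↔ {A = A} e (suc d) = ∷↔ ↔-∘ ((e ×-↔ Vec↔ e d) ↔-∘ *↔×)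
  where
  ∷↔ : (A × Vec A d) ↔ Vec A (suc d)
  ∷↔ = mk↔ₛ′ (λ (x , v) → x Vec.∷ v) (λ v → Vec.head v , Vec.tail v) (λ { (_ Vec.∷ _) → refl }) (λ _ → refl)

×↔ : ∀ {m n} {A B : Set} → Fin m ↔ A → Fin n ↔ B → Fin (m ℕ.* n) ↔ (A × B)
×↔ e e′ = (e ×-↔ e′) ↔-∘ *↔×

-- Finite fields

module FieldTheory (F : FiniteField) where
  open FiniteField F public hiding (size)
  open LinAlg F using (Σ[_]; _^_) public

  commutativeRing : CommutativeRing 0ℓ 0ℓ
  commutativeRing = record { isCommutativeRing = isCommutativeRing }

  open CommutativeRing commutativeRing public
    using (+-assoc; +-comm; +-identityˡ; +-identityʳ; -‿inverseˡ; -‿inverseʳ; *-assoc; *-comm;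
           *-identityˡ; *-identityʳ; distribˡ; distribʳ; zeroˡ; zeroʳ; ring;
           *-commutativeSemigroup; *-commutativeMonoid)
  open import Algebra.Properties.Ring ring public
    using (x≈y⇒x∙y⁻¹≈ε; x∙y⁻¹≈ε⇒x≈y; -1*x≈-x; +-inverseˡ-unique; +-cancelˡ; +-cancelʳ)
  open import Algebra.Properties.CommutativeSemigroup *-commutativeSemigroup public
    using (x∙yz≈y∙xz; interchange; xy∙z≈xz∙y)
  open import Algebra.Properties.CommutativeSemigroup
    (CommutativeRing.+-commutativeSemigroup commutativeRing) public
    using () renaming (interchange to +-interchange)

  infix 4 _≟_
  _≟_ : (x y : Carrier) → Dec (x ≡ y)
  _≟_ = finite-≟ enumeration

  1≢0 : 1# ≢ 0#
  1≢0 = 0≢1 ∘ sym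

  -- Makes d ↦ |F|^d strictly increasing, so that dimensions can be compared through numbers of
  -- vectors.
  2≤size : 2 ≤ size F
  2≤size = inj⇒size≤ (↔-id (Fin 2)) enumeration bit bit-inj
    where
    bit : Fin 2 → Carrier
    bit Fin.zero    = 0#
    bit (Fin.suc _) = 1#
    bit-inj : Inj bit
    bit-inj Fin.zero           Fin.zero           _  = refl
    bit-inj Fin.zero           (Fin.suc Fin.zero) eq = contradiction eq 0≢1
    bit-inj (Fin.suc Fin.zero) Fin.zero           eq = contradiction (sym eq) 0≢1
    bit-inj (Fin.suc Fin.zero) (Fin.suc Fin.zero) _  = refl

  open ≡-Reasoning

  *-cancelˡ : ∀ x {y z} → x ≢ 0# → x * y ≡ x * z → y ≡ z
  *-cancelˡ x {y} {z} x≢0 eq = let x⁻¹ , xx⁻¹ = inverse x x≢0 in begin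
    y             ≡⟨ *-identityˡ y ⟨
    1# * y        ≡⟨ cong (_* y) (trans (sym xx⁻¹) (*-comm x x⁻¹)) ⟩
    x⁻¹ * x * y   ≡⟨ *-assoc x⁻¹ x y ⟩
    x⁻¹ * (x * y) ≡⟨ cong (x⁻¹ *_) eq ⟩
    x⁻¹ * (x * z) ≡⟨ *-assoc x⁻¹ x z ⟨
    x⁻¹ * x * z   ≡⟨ cong (_* z) (trans (sym xx⁻¹) (*-comm x x⁻¹)) ⟨
    1# * z        ≡⟨ *-identityˡ z ⟩
    z             ∎

  *-cancelʳ : ∀ x {y z} → x ≢ 0# → y * x ≡ z * x → y ≡ z
  *-cancelʳ x x≢0 eq = *-cancelˡ x x≢0 (trans (*-comm _ _) (trans eq (*-comm _ _)))

  x*y≡0⇒y≡0 : ∀ {x y} → x ≢ 0# → x * y ≡ 0# → y ≡ 0#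
  x*y≡0⇒y≡0 {x} x≢0 eq = *-cancelˡ x x≢0 (trans eq (sym (zeroʳ x)))

  *-nonzero : ∀ {x y} → x ≢ 0# → y ≢ 0# → x * y ≢ 0#
  *-nonzero x≢0 y≢0 = y≢0 ∘ x*y≡0⇒y≡0 x≢0

  Σ-cong : ∀ {d} {f g : Fin d → Carrier} → (∀ i → f i ≡ g i) → Σ[ f ] ≡ Σ[ g ]
  Σ-cong {zero}  eq = refl
  Σ-cong {suc d} eq = cong₂ _+_ (eq Fin.zero) (Σ-cong (eq ∘ Fin.suc))

  Σ-+ : ∀ {d} (f g : Fin d → Carrier) → Σ[ (λ i → f i + g i) ] ≡ Σ[ f ] + Σ[ g ]
  Σ-+ {zero}  f g = sym (+-identityˡ _)
  Σ-+ {suc d} f g = trans (cong₂ _+_ refl (Σ-+ (f ∘ Fin.suc) (g ∘ Fin.suc))) (+-interchange _ _ _ _)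

  *-Σ : ∀ {d} c (f : Fin d → Carrier) → c * Σ[ f ] ≡ Σ[ (λ i → c * f i) ]
  *-Σ {zero}  c f = zeroʳ c
  *-Σ {suc d} c f = trans (distribˡ c _ _) (cong₂ _+_ refl (*-Σ c (f ∘ Fin.suc)))

  Σ-* : ∀ {d} c (f : Fin d → Carrier) → Σ[ f ] * c ≡ Σ[ (λ i → f i * c) ]
  Σ-* {zero}  c f = zeroˡ c
  Σ-* {suc d} c f = trans (distribʳ c _ _) (cong₂ _+_ refl (Σ-* c (f ∘ Fin.suc)))

  Σ-0 : ∀ d → Σ[ (λ (i : Fin d) → 0#) ] ≡ 0#
  Σ-0 zero    = refl
  Σ-0 (suc d) = trans (+-identityˡ _) (Σ-0 d)

  Σ-swap : ∀ {m d} (f : Fin m → Fin d → Carrier) →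
           Σ[ (λ i → Σ[ f i ]) ] ≡ Σ[ (λ j → Σ[ (λ i → f i j) ]) ]
  Σ-swap {zero}  {d} f = sym (Σ-0 d)
  Σ-swap {suc m} {d} f = trans (cong₂ _+_ refl (Σ-swap (f ∘ Fin.suc))) (sym (Σ-+ (f Fin.zero) _))

  Σ-split : ∀ m {d} (f : Fin (m ℕ.+ d) → Carrier) →
            Σ[ f ] ≡ Σ[ (λ i → f (i ↑ˡ d)) ] + Σ[ (λ i → f (m ↑ʳ i)) ]
  Σ-split zero    f = sym (+-identityˡ _)
  Σ-split (suc m) f = trans (cong (f Fin.zero +_) (Σ-split m (f ∘ Fin.suc))) (sym (+-assoc _ _ _))

  -- Sums block by block, the way `ψ` lays out its n = s k coordinates.
  Σ-combine : ∀ m {d} (f : Fin (m ℕ.* d) → Carrier) →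
              Σ[ f ] ≡ Σ[ (λ i → Σ[ (λ r → f (combine {m} {d} i r)) ]) ]
  Σ-combine zero        f = refl
  Σ-combine (suc m) {d} f = trans (Σ-split d f) (cong (Σ[ (λ r → f (r ↑ˡ (m ℕ.* d))) ] +_) (Σ-combine m (λ i → f (d ↑ʳ i))))

  Σ-δ : ∀ {d} (f : Fin d → Carrier) a → (∀ i → i ≢ a → f i ≡ 0#) → Σ[ f ] ≡ f a
  Σ-δ {suc d} f Fin.zero h =
    trans (cong (f Fin.zero +_) (trans (Σ-cong (λ i → h (Fin.suc i) λ ())) (Σ-0 d))) (+-identityʳ _)
  Σ-δ {suc d} f (Fin.suc a) h =
    trans (cong₂ _+_ (h Fin.zero λ ()) (Σ-δ (f ∘ Fin.suc) a (λ i i≢a → h (Fin.suc i) (λ { refl → i≢a refl }))))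
          (+-identityˡ _)

  ^-+ : ∀ x m n → x ^ (m ℕ.+ n) ≡ x ^ m * x ^ n
  ^-+ x zero    n = sym (*-identityˡ _)
  ^-+ x (suc m) n = trans (cong (x *_) (^-+ x m n)) (sym (*-assoc _ _ _))

  1^ : ∀ n → 1# ^ n ≡ 1#
  1^ zero    = refl
  1^ (suc n) = trans (*-identityˡ _) (1^ n)

  *-^ : ∀ x y n → (x * y) ^ n ≡ x ^ n * y ^ n
  *-^ x y zero    = sym (*-identityˡ _)
  *-^ x y (suc n) = trans (cong (x * y *_) (*-^ x y n)) (interchange _ _ _ _)

  ^-* : ∀ x m n → x ^ (m ℕ.* n) ≡ (x ^ m) ^ n
  ^-* x zero    n = sym (1^ n)
  ^-* x (suc m) n = begin
    x ^ (n ℕ.+ m ℕ.* n)     ≡⟨ ^-+ x n _ ⟩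
    x ^ n * x ^ (m ℕ.* n)   ≡⟨ cong (x ^ n *_) (^-* x m n) ⟩
    x ^ n * (x ^ m) ^ n     ≡⟨ *-^ x (x ^ m) n ⟨
    (x * x ^ m) ^ n         ∎

  ^-nonzero : ∀ {x} n → x ≢ 0# → x ^ n ≢ 0#
  ^-nonzero zero    x≢0 = 1≢0
  ^-nonzero (suc n) x≢0 = *-nonzero x≢0 (^-nonzero n x≢0)

  ^≡1⇒nonzero : ∀ {x} n .{{_ : ℕ.NonZero n}} → x ^ n ≡ 1# → x ≢ 0#
  ^≡1⇒nonzero (suc n) eq refl = 0≢1 (trans (sym (zeroˡ _)) eq)

-- Homomorphisms of finite fields

module HomTheory {F K : FiniteField} {f : Car F → Car K} (hom : IsFieldHom F K f) where
  private
    module F = FieldTheory F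
    module K = FieldTheory K
  open IsFieldHom hom public
  open ≡-Reasoning

  0-hom : f F.0# ≡ K.0#
  0-hom = K.+-cancelˡ (f F.0#) _ _
    (trans (sym (+-hom _ _)) (trans (cong f (F.+-identityʳ _)) (sym (K.+-identityʳ _))))

  neg-hom : ∀ x → f (F.- x) ≡ K.- f x
  neg-hom x = K.+-inverseˡ-unique _ _ (trans (sym (+-hom _ _)) (trans (cong f (F.-‿inverseˡ x)) 0-hom))

  ^-hom : ∀ x n → f (x F.^ n) ≡ f x K.^ n
  ^-hom x zero    = 1-hom
  ^-hom x (suc n) = trans (*-hom _ _) (cong (f x K.*_) (^-hom x n))

  Σ-hom : ∀ {d} (g : Fin d → F.Carrier) → f F.Σ[ g ] ≡ K.Σ[ f ∘ g ]
  Σ-hom {zero}  g = 0-hom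
  Σ-hom {suc d} g = trans (+-hom _ _) (cong (f (g Fin.zero) K.+_) (Σ-hom (g ∘ Fin.suc)))

  nonzero-hom : ∀ {x} → x ≢ F.0# → f x ≢ K.0#
  nonzero-hom {x} x≢0 fx≡0 = let y , xy≡1 = F.inverse x x≢0 in K.0≢1 (begin
    K.0#          ≡⟨ K.zeroˡ (f y) ⟨
    K.0# K.* f y  ≡⟨ cong (K._* f y) fx≡0 ⟨
    f x K.* f y   ≡⟨ *-hom x y ⟨
    f (x F.* y)   ≡⟨ cong f xy≡1 ⟩
    f F.1#        ≡⟨ 1-hom ⟩
    K.1#          ∎)

  hom-inj : Inj f
  hom-inj x y fx≡fy with (x F.+ F.- y) F.≟ F.0#
  ... | yes eq = F.x∙y⁻¹≈ε⇒x≈y x y eq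
  ... | no  ne = contradiction (begin
    f (x F.+ F.- y)       ≡⟨ +-hom x _ ⟩
    f x K.+ f (F.- y)     ≡⟨ cong (f x K.+_) (neg-hom y) ⟩
    f x K.+ K.- f y       ≡⟨ K.x≈y⇒x∙y⁻¹≈ε fx≡fy ⟩
    K.0#                  ∎) (nonzero-hom ne)

∘-hom : ∀ {F K L : FiniteField} {f : Car F → Car K} {g : Car K → Car L} →
        IsFieldHom F K f → IsFieldHom K L g → IsFieldHom F L (g ∘ f)
∘-hom {f = f} {g} hf hg = record
  { +-hom = λ x y → trans (cong g (f.+-hom x y)) (g.+-hom _ _)
  ; *-hom = λ x y → trans (cong g (f.*-hom x y)) (g.*-hom _ _)
  ; 1-hom = trans (cong g f.1-hom) g.1-hom }
  where
  module f = IsFieldHom hf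
  module g = IsFieldHom hg

-- Subspaces

lookup-ext : ∀ {A : Set} {n} {v w : Vec A n} → (∀ i → Vec.lookup v i ≡ Vec.lookup w i) → v ≡ w
lookup-ext {v = v} {w} eq = trans (sym (tabulate∘lookup v)) (trans (tabulate-cong eq) (tabulate∘lookup w))

module SubspaceTheory (F : FiniteField) where
  open import Data.Vec using (lookup)
  open FieldTheory F
  open LinAlg F hiding (Σ[_]; _^_)
  open ≡-Reasoning

  Vector↔ : ∀ N → Fin (size F ℕ.^ N) ↔ Vector N
  Vector↔ = Vec↔ enumeration

  lookup-+ᵥ : ∀ {N} (v w : Vector N) i → lookup (v +ᵥ w) i ≡ lookup v i + lookup w i
  lookup-+ᵥ v w i = lookup-zipWith _+_ i v w

  lookup-• : ∀ {N} a (v : Vector N) i → lookup (a • v) i ≡ a * lookup v i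
  lookup-• a v i = lookup-map i (a *_) v

  lookup-zeroV : ∀ {N} (i : Fin N) → lookup zeroV i ≡ 0#
  lookup-zeroV i = lookup-replicate i 0#

  lookup-lincomb : ∀ {d N} (c : Fin d → Carrier) (v : Fin d → Vector N) i →
                   lookup (lincomb c v) i ≡ Σ[ (λ k → c k * lookup (v k) i) ]
  lookup-lincomb {zero}  c v i = lookup-zeroV i
  lookup-lincomb {suc d} c v i = trans (lookup-+ᵥ (c Fin.zero • v Fin.zero) _ i)
    (cong₂ _+_ (lookup-• (c Fin.zero) (v Fin.zero) i) (lookup-lincomb (c ∘ Fin.suc) (v ∘ Fin.suc) i))

  +ᵥ-abelianGroup : ℕ → AbelianGroup 0ℓ 0ℓ
  +ᵥ-abelianGroup N = record
    { Carrier = Vector N ; _≈_ = _≡_ ; _∙_ = _+ᵥ_ ; ε = zeroV ; _⁻¹ = Vec.map -_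
    ; isAbelianGroup = record
      { isGroup = record
        { isMonoid = record
          { isSemigroup = record
            { isMagma = record { isEquivalence = isEquivalence ; ∙-cong = cong₂ _+ᵥ_ }
            ; assoc = Vec.zipWith-assoc +-assoc }
          ; identity = Vec.zipWith-identityˡ +-identityˡ , Vec.zipWith-identityʳ +-identityʳ }
        ; inverse = Vec.zipWith-inverseˡ -‿inverseˡ , Vec.zipWith-inverseʳ -‿inverseʳ
        ; ⁻¹-cong = cong (Vec.map -_) }
      ; comm = Vec.zipWith-comm +-comm } }

  module Vector {N : ℕ} where
    open AbelianGroup (+ᵥ-abelianGroup N) public using (commutativeSemigroup) renaming
      (assoc to +ᵥ-assoc; comm to +ᵥ-comm; identityˡ to +ᵥ-identityˡ; identityʳ to +ᵥ-identityʳ;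
       inverseˡ to -ᵥ-inverseˡ; inverseʳ to -ᵥ-inverseʳ; _⁻¹ to -ᵥ_)
    open import Algebra.Properties.AbelianGroup (+ᵥ-abelianGroup N) public
      using () renaming (∙-cancelˡ to +ᵥ-cancelˡ; ∙-cancelʳ to +ᵥ-cancelʳ; x∙y⁻¹≈ε⇒x≈y to x-ᵥy≡0⇒x≡y; x≈y⇒x∙y⁻¹≈ε to x≡y⇒x-ᵥy≡0)
    open import Algebra.Properties.CommutativeSemigroup commutativeSemigroup public
      using () renaming (interchange to +ᵥ-interchange)
  open Vector

  -1• : ∀ {N} (v : Vector N) → (- 1#) • v ≡ -ᵥ v
  -1• v = Vec.map-cong -1*x≈-x v

  0• : ∀ {N} (v : Vector N) → 0# • v ≡ zeroV
  0• v = lookup-ext (λ i → trans (lookup-• 0# v i) (trans (zeroˡ _) (sym (lookup-zeroV i))))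

  lincomb-cong : ∀ {d N} {c c′ : Fin d → Carrier} (v : Fin d → Vector N) →
                 (∀ i → c i ≡ c′ i) → lincomb c v ≡ lincomb c′ v
  lincomb-cong {c = c} {c′} v eq = lookup-ext (λ j → trans (lookup-lincomb c v j)
    (trans (Σ-cong (λ i → cong (_* lookup (v i) j) (eq i))) (sym (lookup-lincomb c′ v j))))

  lincomb-+ : ∀ {d N} (c c′ : Fin d → Carrier) (v : Fin d → Vector N) →
              lincomb (λ i → c i + c′ i) v ≡ lincomb c v +ᵥ lincomb c′ v
  lincomb-+ c c′ v = lookup-ext λ j → begin
    lookup (lincomb (λ i → c i + c′ i) v) j                ≡⟨ lookup-lincomb _ v j ⟩
    Σ[ (λ i → (c i + c′ i) * lookup (v i) j) ]             ≡⟨ Σ-cong (λ i → distribʳ (lookup (v i) j) (c i) (c′ i)) ⟩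
    Σ[ (λ i → c i * lookup (v i) j + c′ i * lookup (v i) j) ] ≡⟨ Σ-+ (λ i → c i * lookup (v i) j) (λ i → c′ i * lookup (v i) j) ⟩
    Σ[ (λ i → c i * lookup (v i) j) ] + Σ[ (λ i → c′ i * lookup (v i) j) ]
      ≡⟨ cong₂ _+_ (lookup-lincomb c v j) (lookup-lincomb c′ v j) ⟨
    lookup (lincomb c v) j + lookup (lincomb c′ v) j       ≡⟨ lookup-+ᵥ (lincomb c v) (lincomb c′ v) j ⟨
    lookup (lincomb c v +ᵥ lincomb c′ v) j                 ∎

  lincomb-• : ∀ {d N} a (c : Fin d → Carrier) (v : Fin d → Vector N) →
              lincomb (λ i → a * c i) v ≡ a • lincomb c v
  lincomb-• a c v = lookup-ext λ j → begin
    lookup (lincomb (λ i → a * c i) v) j      ≡⟨ lookup-lincomb _ v j ⟩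
    Σ[ (λ i → a * c i * lookup (v i) j) ]     ≡⟨ Σ-cong (λ i → *-assoc a (c i) _) ⟩
    Σ[ (λ i → a * (c i * lookup (v i) j)) ]   ≡⟨ *-Σ a (λ i → c i * lookup (v i) j) ⟨
    a * Σ[ (λ i → c i * lookup (v i) j) ]     ≡⟨ cong (a *_) (lookup-lincomb c v j) ⟨
    a * lookup (lincomb c v) j                ≡⟨ lookup-• a (lincomb c v) j ⟨
    lookup (a • lincomb c v) j                ∎

  lincomb-0 : ∀ {d N} (v : Fin d → Vector N) → lincomb (λ _ → 0#) v ≡ zeroV
  lincomb-0 v = trans (lincomb-cong v (λ _ → sym (zeroˡ 0#))) (trans (lincomb-• 0# (λ _ → 0#) v) (0• _))

  lincomb-∈ : ∀ {d N} {W : Sub N} → IsSubspace W → (c : Fin d → Carrier) (v : Fin d → Vector N) →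
              (∀ i → W (v i)) → W (lincomb c v)
  lincomb-∈ {zero}  (W0 , _)           c v Wv = W0
  lincomb-∈ {suc d} sW@(_ , W+ , W•) c v Wv =
    W+ _ _ (W• _ _ (Wv Fin.zero)) (lincomb-∈ sW (c ∘ Fin.suc) (v ∘ Fin.suc) (Wv ∘ Fin.suc))

  -ᵥ-∈ : ∀ {N} {W : Sub N} → IsSubspace W → ∀ {x} → W x → W (-ᵥ x)
  -ᵥ-∈ {W = W} (_ , _ , W•) Wx = subst W (-1• _) (W• (- 1#) _ Wx)

  Span-isSubspace : ∀ {d N} (v : Fin d → Vector N) → IsSubspace (Span v)
  Span-isSubspace v = ((λ _ → 0#) , sym (lincomb-0 v))
    , (λ { _ _ (c , refl) (c′ , refl) → (λ i → c i + c′ i) , sym (lincomb-+ c c′ v) })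
    , (λ { a _ (c , refl) → (λ i → a * c i) , sym (lincomb-• a c v) })

  ⊞-isSubspace : ∀ {N} {U V : Sub N} → IsSubspace U → IsSubspace V → IsSubspace (U ⊞ V)
  ⊞-isSubspace (U0 , U+ , U•) (V0 , V+ , V•) =
      (zeroV , zeroV , U0 , V0 , sym (+ᵥ-identityˡ _))
    , (λ { _ _ (u , v , Uu , Vv , refl) (u′ , v′ , Uu′ , Vv′ , refl) →
           _ , _ , U+ _ _ Uu Uu′ , V+ _ _ Vv Vv′ , +ᵥ-interchange u v u′ v′ })
    , (λ { a _ (u , v , Uu , Vv , refl) → _ , _ , U• a _ Uu , V• a _ Vv ,
           lookup-ext (λ i → begin
             lookup (a • (u +ᵥ v)) i               ≡⟨ lookup-• a (u +ᵥ v) i ⟩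
             a * lookup (u +ᵥ v) i                 ≡⟨ cong (a *_) (lookup-+ᵥ u v i) ⟩
             a * (lookup u i + lookup v i)         ≡⟨ distribˡ a _ _ ⟩
             a * lookup u i + a * lookup v i       ≡⟨ cong₂ _+_ (lookup-• a u i) (lookup-• a v i) ⟨
             lookup (a • u) i + lookup (a • v) i   ≡⟨ lookup-+ᵥ (a • u) (a • v) i ⟨
             lookup ((a • u) +ᵥ (a • v)) i         ∎) })

  ∩-isSubspace : ∀ {N} {U V : Sub N} → IsSubspace U → IsSubspace V → IsSubspace (U ∩ V)
  ∩-isSubspace (U0 , U+ , U•) (V0 , V+ , V•) = (U0 , V0)
    , (λ { _ _ (Ux , Vx) (Uy , Vy) → U+ _ _ Ux Uy , V+ _ _ Vx Vy })
    , (λ { a _ (Ux , Vx) → U• a _ Ux , V• a _ Vx })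

  -- Coefficients form a vector here instead of a function: vectors over a finite field can be
  -- enumerated and compared, which searching and counting require.
  _↓_ : ∀ {d N} → Vector d → (Fin d → Vector N) → Vector N
  c ↓ b = lincomb (lookup c) b

  ↓-tabulate : ∀ {d N} (c : Fin d → Carrier) (b : Fin d → Vector N) → tabulate c ↓ b ≡ lincomb c b
  ↓-tabulate c b = lincomb-cong b (lookup∘tabulate c)

  LinIndep⇒inj : ∀ {d N} {b : Fin d → Vector N} → LinIndep b → Inj (_↓ b)
  LinIndep⇒inj {b = b} ind c c′ eq = lookup-ext λ i → x∙y⁻¹≈ε⇒x≈y _ _
    (trans (cong (_ +_) (sym (-1*x≈-x _))) (ind (λ i → lookup c i + - 1# * lookup c′ i) (begin
      lincomb (λ i → lookup c i + - 1# * lookup c′ i) b ≡⟨ lincomb-+ _ _ b ⟩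
      (c ↓ b) +ᵥ lincomb (λ i → - 1# * lookup c′ i) b   ≡⟨ cong ((c ↓ b) +ᵥ_) (trans (lincomb-• (- 1#) _ b) (-1• _)) ⟩
      (c ↓ b) +ᵥ (-ᵥ (c′ ↓ b))                          ≡⟨ x≡y⇒x-ᵥy≡0 eq ⟩
      zeroV                                             ∎) i))

  -- Pure counting: |F|^a ≤ |F|^b forces a ≤ b. The map is arbitrary, so it may be built from chosen
  -- coordinates or splittings.
  inj⇒dim≤ : ∀ {a b} (f : Vector a → Vector b) → Inj f → a ≤ b
  inj⇒dim≤ {a} {b} f f-inj with a ℕ.≤? b
  ... | yes a≤b = a≤b
  ... | no  a≰b = contradiction (inj⇒size≤ (Vector↔ a) (Vector↔ b) f f-inj)
                    (ℕ.<⇒≱ (ℕ.^-monoʳ-< (size F) 2≤size (ℕ.≰⇒> a≰b)))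

  inj⇒dim-sum≤ : ∀ {a b c d} (f : Vector a × Vector b → Vector c × Vector d) → Inj f → a ℕ.+ b ≤ c ℕ.+ d
  inj⇒dim-sum≤ {a} {b} {c} {d} f f-inj with (a ℕ.+ b) ℕ.≤? (c ℕ.+ d)
  ... | yes p = p
  ... | no ¬p = contradiction
    (subst₂ _≤_ (sym (ℕ.^-distribˡ-+-* (size F) a b)) (sym (ℕ.^-distribˡ-+-* (size F) c d))
      (inj⇒size≤ (×↔ (Vector↔ a) (Vector↔ b)) (×↔ (Vector↔ c) (Vector↔ d)) f f-inj))
    (ℕ.<⇒≱ (ℕ.^-monoʳ-< (size F) 2≤size (ℕ.≰⇒> ¬p)))

  LinIndep⇒≤ : ∀ {d N} {b : Fin d → Vector N} → LinIndep b → d ≤ N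
  LinIndep⇒≤ {b = b} ind = inj⇒dim≤ (_↓ b) (LinIndep⇒inj ind)

  module Basis {N : ℕ} {W : Sub N} {d : ℕ} (sW : IsSubspace W) (dW : Dim W d) where
    basis : Fin d → Vector N
    basis = proj₁ dW

    basis-indep : LinIndep basis
    basis-indep = proj₁ (proj₂ (proj₂ dW))

    vec : Vector d → Vector N
    vec c = c ↓ basis

    vec-∈ : ∀ c → W (vec c)
    vec-∈ c = lincomb-∈ sW (lookup c) basis (proj₁ (proj₂ dW))

    vec-inj : Inj vec
    vec-inj = LinIndep⇒inj basis-indep

    coord : ∀ x → W x → Vector d
    coord x Wx = tabulate (proj₁ (proj₂ (proj₂ (proj₂ dW)) x Wx))

    vec-coord : ∀ x Wx → vec (coord x Wx) ≡ x
    vec-coord x Wx = trans (↓-tabulate _ basis) (sym (proj₂ (proj₂ (proj₂ (proj₂ dW)) x Wx)))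

    coord-inj : ∀ x Wx y Wy → coord x Wx ≡ coord y Wy → x ≡ y
    coord-inj x Wx y Wy eq = trans (sym (vec-coord x Wx)) (trans (cong vec eq) (vec-coord y Wy))

    -- The subspace is the image of finitely many coefficient vectors, so a search settles
    -- membership.
    ∈? : ∀ x → Dec (W x)
    ∈? x = map′ (λ { (c , refl) → vec-∈ c }) (λ Wx → coord x Wx , sym (vec-coord x Wx))
             (finite-∃? (Vector↔ d) (λ c → finite-≟ (Vector↔ N) x (vec c)))

    full⇒≡ : (∀ x → W x) → d ≡ N
    full⇒≡ full = ℕ.≤-antisym (LinIndep⇒≤ basis-indep)
      (inj⇒dim≤ (λ x → coord x (full x)) (λ x y → coord-inj x (full x) y (full y)))

    -- The search for a vector outside either succeeds or shows that `W` is everything, against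
    -- `full⇒≡`.
    proper : d < N → ∃[ x ] ¬ W x
    proper d<N with finite-∃? (Vector↔ N) (λ x → ¬? (∈? x))
    ... | yes p = p
    ... | no ¬p = contradiction (full⇒≡ (λ x → decidable-stable (∈? x) (λ ¬Wx → ¬p (x , ¬Wx)))) (ℕ.<⇒≢ d<N)

    -- All combinations of the basis coincide, so the map from coefficients to the one-element
    -- `Vector 0` is injective.
    trivial⇒≡0 : (∀ x → W x → x ≡ zeroV) → d ≡ 0
    trivial⇒≡0 triv = ℕ.n≤0⇒n≡0 (inj⇒dim≤ {b = 0} (λ _ → Vec.[])
      (λ c c′ _ → vec-inj c c′ (trans (triv _ (vec-∈ c)) (sym (triv _ (vec-∈ c′))))))

  Dim-resp-≐ : ∀ {N d} {U V : Sub N} → U ≐ V → Dim U d → Dim V d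
  Dim-resp-≐ (U⊆V , V⊆U) (b , Ub , ind , span) = b , (λ i → U⊆V _ (Ub i)) , ind , (λ x → span x ∘ V⊆U x)

  IsSubspace-resp-≐ : ∀ {N} {U V : Sub N} → U ≐ V → IsSubspace U → IsSubspace V
  IsSubspace-resp-≐ (U⊆V , V⊆U) (U0 , U+ , U•) = U⊆V _ U0
    , (λ x y Vx Vy → U⊆V _ (U+ x y (V⊆U x Vx) (V⊆U y Vy)))
    , (λ a x Vx → U⊆V _ (U• a x (V⊆U x Vx)))

  Dim-mono : ∀ {N a b} {U V : Sub N} → IsSubspace U → Dim U a → IsSubspace V → Dim V b → U ⊆ V → a ≤ b
  Dim-mono sU dU sV dV U⊆V = inj⇒dim≤ (λ c → V.coord (U.vec c) (U⊆V _ (U.vec-∈ c)))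
    (λ c c′ eq → U.vec-inj c c′ (V.coord-inj _ (U⊆V _ (U.vec-∈ c)) _ (U⊆V _ (U.vec-∈ c′)) eq))
    where
    module U = Basis sU dU
    module V = Basis sV dV

  Span? : ∀ {d N} (b : Fin d → Vector N) x → Dec (Span b x)
  Span? {d} {N} b x = map′ (λ { (c , eq) → lookup c , eq }) (λ { (c , eq) → tabulate c , trans eq (sym (↓-tabulate c b)) })
    (finite-∃? (Vector↔ d) (λ c → finite-≟ (Vector↔ N) x (c ↓ b)))

  -- A nonzero coefficient of `x` could be inverted and would put `x` into the span. So it vanishes,
  -- and the independence of `b` handles the others.
  LinIndep-∷ : ∀ {d N} {b : Fin d → Vector N} {x} → LinIndep b → ¬ Span b x → LinIndep (x VecF.∷ b)
  LinIndep-∷ {b = b} {x} ind x∉ c eq = λ { Fin.zero → c₀≡0 ; (Fin.suc i) → ind (c ∘ Fin.suc) tail≡0 i }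
    where
    rest = lincomb (c ∘ Fin.suc) b
    c₀≡0 : c Fin.zero ≡ 0#
    c₀≡0 with c Fin.zero ≟ 0#
    ... | yes p = p
    ... | no c₀≢0 with c₀⁻¹ , cc⁻¹ ← inverse (c Fin.zero) c₀≢0 = contradiction x∈ x∉
      where
      c₀x≡ : c Fin.zero • x ≡ -ᵥ rest
      c₀x≡ = +ᵥ-cancelʳ rest _ _ (trans eq (sym (-ᵥ-inverseˡ rest)))
      x∈ : Span b x
      x∈ = subst (Span b) (lookup-ext λ i → begin
             lookup (c₀⁻¹ • (-ᵥ rest)) i                ≡⟨ cong (λ v → lookup (c₀⁻¹ • v) i) c₀x≡ ⟨
             lookup (c₀⁻¹ • (c Fin.zero • x)) i         ≡⟨ trans (lookup-• c₀⁻¹ (c Fin.zero • x) i) (cong (c₀⁻¹ *_) (lookup-• (c Fin.zero) x i)) ⟩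
             c₀⁻¹ * (c Fin.zero * lookup x i)           ≡⟨ *-assoc _ _ _ ⟨
             c₀⁻¹ * c Fin.zero * lookup x i             ≡⟨ cong (_* lookup x i) (trans (*-comm _ _) cc⁻¹) ⟩
             1# * lookup x i                            ≡⟨ *-identityˡ _ ⟩
             lookup x i                                 ∎)
             (proj₂ (proj₂ (Span-isSubspace b)) c₀⁻¹ _ (-ᵥ-∈ (Span-isSubspace b) (c ∘ Fin.suc , refl)))
    tail≡0 : rest ≡ zeroV
    tail≡0 = begin
      rest                      ≡⟨ +ᵥ-identityˡ rest ⟨
      zeroV +ᵥ rest             ≡⟨ cong (_+ᵥ rest) (trans (cong (_• x) c₀≡0) (0• x)) ⟨
      (c Fin.zero • x) +ᵥ rest  ≡⟨ eq ⟩
      zeroV                     ∎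

  -- Greedy basis: while some vector of `W` lies outside the span, adjoin it. An independent family
  -- has at most `N` members, so N + 1 units of fuel cannot run out.
  decidable⇒Dim : ∀ {N} {W : Sub N} → (∀ x → Dec (W x)) → ∃[ d ] Dim W d
  decidable⇒Dim {N} {W} W? = extend (suc N) 0 (ℕ.m≤m+n (suc N) 0) (λ ()) (λ ()) (λ _ _ ())
    where
    extend : ∀ fuel d → N < fuel ℕ.+ d → (b : Fin d → Vector N) → (∀ i → W (b i)) → LinIndep b → ∃[ d ] Dim W d
    extend zero       d N<d b Wb ind = contradiction (LinIndep⇒≤ ind) (ℕ.<⇒≱ N<d)
    extend (suc fuel) d N<  b Wb ind with finite-∃? (Vector↔ N) (λ x → W? x ×-dec ¬? (Span? b x))
    ... | no ¬p = d , b , Wb , ind , λ x Wx → decidable-stable (Span? b x) (λ x∉ → ¬p (x , Wx , x∉))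
    ... | yes (x , Wx , x∉) = extend fuel (suc d) (subst (N <_) (sym (ℕ.+-suc fuel d)) N<) (x VecF.∷ b)
            (λ { Fin.zero → Wx ; (Fin.suc i) → Wb i }) (LinIndep-∷ ind x∉)

  module _ {N : ℕ} {U V : Sub N} {d₁ d₂ : ℕ}
           (sU : IsSubspace U) (dU : Dim U d₁) (sV : IsSubspace V) (dV : Dim V d₂) where
    private
      module U = Basis sU dU
      module V = Basis sV dV

    ⊞? : ∀ x → Dec ((U ⊞ V) x)
    ⊞? x = finite-∃? (Vector↔ N) λ u → finite-∃? (Vector↔ N) λ v →
             U.∈? u ×-dec V.∈? v ×-dec finite-≟ (Vector↔ N) x (u +ᵥ v)

    ∩? : ∀ x → Dec ((U ∩ V) x)
    ∩? x = U.∈? x ×-dec V.∈? x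

    -- Decidable sum and intersection acquire bases from the greedy construction.
    DistS-exists : ∃[ d ] DistS U V d
    DistS-exists = let a , dS = decidable⇒Dim ⊞? ; b , dI = decidable⇒Dim ∩?
                   in a ℕ.∸ b , a , b , dS , dI , refl

    module _ {a b : ℕ} (dS : Dim (U ⊞ V) a) (dI : Dim (U ∩ V) b) where
      private
        module S = Basis (⊞-isSubspace sU sV) dS
        module I = Basis (∩-isSubspace sU sV) dI

        split₁ split₂ : Vector a → Vector N
        split₁ c = proj₁ (S.vec-∈ c)
        split₂ c = proj₁ (proj₂ (S.vec-∈ c))

        ∈U : ∀ c → U (split₁ c)
        ∈U c = proj₁ (proj₂ (proj₂ (S.vec-∈ c)))
        ∈V : ∀ c → V (split₂ c)
        ∈V c = proj₁ (proj₂ (proj₂ (proj₂ (S.vec-∈ c))))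
        split-sum : ∀ c → S.vec c ≡ split₁ c +ᵥ split₂ c
        split-sum c = proj₂ (proj₂ (proj₂ (proj₂ (S.vec-∈ c))))

      -- Both inequalities count vectors: (u + v, m) ↦ (u + m, v - m) is a bijection
      -- (U ⊞ V) × (U ∩ V) → U × V once a splitting w = u + v is fixed for each w ∈ U ⊞ V.
      dim-⊞+dim-∩ : a ℕ.+ b ≡ d₁ ℕ.+ d₂
      dim-⊞+dim-∩ = ℕ.≤-antisym (inj⇒dim-sum≤ f f-inj) (inj⇒dim-sum≤ g g-inj)
        where
        fU : ∀ c e → U (split₁ c +ᵥ I.vec e)
        fU c e = proj₁ (proj₂ sU) _ _ (∈U c) (proj₁ (I.vec-∈ e))
        fV : ∀ c e → V (split₂ c +ᵥ (-ᵥ I.vec e))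
        fV c e = proj₁ (proj₂ sV) _ _ (∈V c) (-ᵥ-∈ sV (proj₂ (I.vec-∈ e)))
        f : Vector a × Vector b → Vector d₁ × Vector d₂
        f (c , e) = U.coord _ (fU c e) , V.coord _ (fV c e)
        f-sum : ∀ c e → (split₁ c +ᵥ I.vec e) +ᵥ (split₂ c +ᵥ (-ᵥ I.vec e)) ≡ S.vec c
        f-sum c e = begin
          (split₁ c +ᵥ I.vec e) +ᵥ (split₂ c +ᵥ (-ᵥ I.vec e)) ≡⟨ +ᵥ-interchange (split₁ c) (I.vec e) (split₂ c) _ ⟩
          (split₁ c +ᵥ split₂ c) +ᵥ (I.vec e +ᵥ (-ᵥ I.vec e)) ≡⟨ cong₂ _+ᵥ_ (sym (split-sum c)) (-ᵥ-inverseʳ (I.vec e)) ⟩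
          S.vec c +ᵥ zeroV                                    ≡⟨ +ᵥ-identityʳ _ ⟩
          S.vec c                                             ∎
        f-inj : Inj f
        f-inj (c , e) (c′ , e′) eq = cong₂ _,_ c≡c′ e≡e′
          where
          eqU = U.coord-inj _ (fU c e) _ (fU c′ e′) (cong proj₁ eq)
          eqV = V.coord-inj _ (fV c e) _ (fV c′ e′) (cong proj₂ eq)
          c≡c′ : c ≡ c′
          c≡c′ = S.vec-inj c c′ (trans (sym (f-sum c e)) (trans (cong₂ _+ᵥ_ eqU eqV) (f-sum c′ e′)))
          e≡e′ : e ≡ e′
          e≡e′ = I.vec-inj e e′ (+ᵥ-cancelˡ (split₁ c) _ _
                   (trans eqU (cong (λ c → split₁ c +ᵥ I.vec e′) (sym c≡c′))))

        sum∈ : ∀ c e → (U ⊞ V) (U.vec c +ᵥ V.vec e)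
        sum∈ c e = _ , _ , U.vec-∈ c , V.vec-∈ e , refl
        sumc : Vector d₁ → Vector d₂ → Vector a
        sumc c e = S.coord _ (sum∈ c e)
        sum-split : ∀ c e → U.vec c +ᵥ V.vec e ≡ split₁ (sumc c e) +ᵥ split₂ (sumc c e)
        sum-split c e = trans (sym (S.vec-coord _ (sum∈ c e))) (split-sum (sumc c e))
        -- For u + v with chosen splitting u₀ + v₀ this is u - u₀ = v₀ - v, hence a member of both
        -- subspaces.
        diff : Vector d₁ → Vector d₂ → Vector N
        diff c e = U.vec c +ᵥ (-ᵥ split₁ (sumc c e))
        diff≡ : ∀ c e → diff c e ≡ split₂ (sumc c e) +ᵥ (-ᵥ V.vec e)
        diff≡ c e = +ᵥ-cancelʳ (u₀ +ᵥ V.vec e) _ _ (begin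
          (U.vec c +ᵥ (-ᵥ u₀)) +ᵥ (u₀ +ᵥ V.vec e)   ≡⟨ +ᵥ-assoc _ _ _ ⟩
          U.vec c +ᵥ ((-ᵥ u₀) +ᵥ (u₀ +ᵥ V.vec e))   ≡⟨ cong (U.vec c +ᵥ_) (trans (sym (+ᵥ-assoc _ _ _))
                                                        (trans (cong (_+ᵥ V.vec e) (-ᵥ-inverseˡ u₀)) (+ᵥ-identityˡ _))) ⟩
          U.vec c +ᵥ V.vec e                        ≡⟨ sum-split c e ⟩
          u₀ +ᵥ v₀                                  ≡⟨ +ᵥ-comm u₀ v₀ ⟩
          v₀ +ᵥ u₀                                  ≡⟨ +ᵥ-identityʳ _ ⟨
          (v₀ +ᵥ u₀) +ᵥ zeroV                       ≡⟨ cong ((v₀ +ᵥ u₀) +ᵥ_) (-ᵥ-inverseˡ (V.vec e)) ⟨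
          (v₀ +ᵥ u₀) +ᵥ ((-ᵥ V.vec e) +ᵥ V.vec e)   ≡⟨ +ᵥ-interchange v₀ u₀ _ _ ⟩
          (v₀ +ᵥ (-ᵥ V.vec e)) +ᵥ (u₀ +ᵥ V.vec e)   ∎)
          where
          u₀ = split₁ (sumc c e)
          v₀ = split₂ (sumc c e)
        diff∈ : ∀ c e → (U ∩ V) (diff c e)
        diff∈ c e = proj₁ (proj₂ sU) _ _ (U.vec-∈ c) (-ᵥ-∈ sU (∈U (sumc c e)))
                  , subst V (sym (diff≡ c e)) (proj₁ (proj₂ sV) _ _ (∈V (sumc c e)) (-ᵥ-∈ sV (V.vec-∈ e)))
        g : Vector d₁ × Vector d₂ → Vector a × Vector b
        g (c , e) = sumc c e , I.coord _ (diff∈ c e)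
        g-inj : Inj g
        g-inj (c , e) (c′ , e′) eq = cong₂ _,_ (U.vec-inj c c′ c≡) (V.vec-inj e e′ (+ᵥ-cancelˡ (U.vec c) _ _
            (trans (S.coord-inj _ (sum∈ c e) _ (sum∈ c′ e′) (cong proj₁ eq)) (cong (_+ᵥ V.vec e′) (sym c≡)))))
          where
          c≡ : U.vec c ≡ U.vec c′
          c≡ = +ᵥ-cancelʳ (-ᵥ split₁ (sumc c e)) _ _
                 (trans (I.coord-inj _ (diff∈ c e) _ (diff∈ c′ e′) (cong proj₂ eq))
                        (cong (λ s → U.vec c′ +ᵥ (-ᵥ split₁ s)) (sym (cong proj₁ eq))))

-- Matrices as multiplications

module Evaluation {F K : FiniteField} {ι : Car F → Car K} (hom : IsFieldHom F K ι) where
  open import Data.Vec using (lookup)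
  private
    module F = FieldTheory F
    module K = FieldTheory K
    module LK = LinAlg K
  open LinAlg F hiding (Σ[_]; _^_)
  open SubspaceTheory F using (module Vector; lookup-+ᵥ; lookup-•; lookup-zeroV; lookup-lincomb; -1•; Vector↔)
  open Vector
  open HomTheory hom
  open K using (Σ[_])
  open ≡-Reasoning

  -- Serves all three extensions: F in K with powers of ω, K in L with powers of α, and F in L with
  -- the products of both.
  ev : ∀ {d} → (Fin d → Car K) → Vector d → Car K
  ev β v = Σ[ (λ i → ι (lookup v i) K.* β i) ]

  module _ {d : ℕ} (β : Fin d → Car K) where

    ev-+ : ∀ v w → ev β (v +ᵥ w) ≡ ev β v K.+ ev β w
    ev-+ v w = trans (K.Σ-cong (λ i → trans (cong (λ x → ι x K.* β i) (lookup-+ᵥ v w i))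
      (trans (cong (K._* β i) (+-hom _ _)) (K.distribʳ _ _ _)))) (K.Σ-+ (λ i → ι (lookup v i) K.* β i) (λ i → ι (lookup w i) K.* β i))

    ev-• : ∀ a v → ev β (a • v) ≡ ι a K.* ev β v
    ev-• a v = trans (K.Σ-cong (λ i → trans (cong (λ x → ι x K.* β i) (lookup-• a v i))
      (trans (cong (K._* β i) (*-hom _ _)) (K.*-assoc _ _ _)))) (sym (K.*-Σ (ι a) (λ i → ι (lookup v i) K.* β i)))

    ev-zeroV : ev β zeroV ≡ K.0#
    ev-zeroV = trans (K.Σ-cong (λ i → trans (cong (λ x → ι x K.* β i) (lookup-zeroV i))
      (trans (cong (K._* β i) 0-hom) (K.zeroˡ _)))) (K.Σ-0 d)

    ev-lincomb : ∀ {m} (c : Fin m → Car F) (v : Fin m → Vector d) →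
                 ev β (lincomb c v) ≡ Σ[ (λ i → ι (c i) K.* ev β (v i)) ]
    ev-lincomb {zero}  c v = ev-zeroV
    ev-lincomb {suc m} c v = trans (ev-+ (c Fin.zero • v Fin.zero) _)
      (cong₂ K._+_ (ev-• (c Fin.zero) (v Fin.zero)) (ev-lincomb (c ∘ Fin.suc) (v ∘ Fin.suc)))

    ev-injective : (∀ v → ev β v ≡ K.0# → v ≡ zeroV) → Inj (ev β)
    ev-injective ker v w eq = x-ᵥy≡0⇒x≡y v w (ker _ (begin
      ev β (v +ᵥ (-ᵥ w))                    ≡⟨ ev-+ v (-ᵥ w) ⟩
      ev β v K.+ ev β (-ᵥ w)                ≡⟨ cong (λ u → ev β v K.+ ev β u) (-1• w) ⟨
      ev β v K.+ ev β ((F.- F.1#) • w)      ≡⟨ cong (ev β v K.+_) (ev-• _ w) ⟩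
      ev β v K.+ ι (F.- F.1#) K.* ev β w    ≡⟨ cong₂ (λ x y → x K.+ y K.* ev β w) eq (trans (neg-hom _) (cong K.-_ 1-hom)) ⟩
      ev β w K.+ (K.- K.1#) K.* ev β w      ≡⟨ cong (ev β w K.+_) (K.-1*x≈-x _) ⟩
      ev β w K.+ K.- ev β w                 ≡⟨ K.-‿inverseʳ _ ⟩
      K.0#                                  ∎))

    -- In the basis β, the row action of A on F^d is multiplication by y on K.
    Acts : Matrix d d → Car K → Set
    Acts A y = ∀ a → ev β (lookup A a) ≡ y K.* β a

    Acts-*ᵥ : ∀ {A y} → Acts A y → ∀ v → ev β (v *ᵥ A) ≡ y K.* ev β v
    Acts-*ᵥ {A} {y} act v = begin
      ev β (v *ᵥ A)                                        ≡⟨ ev-lincomb (lookup v) (lookup A) ⟩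
      Σ[ (λ i → ι (lookup v i) K.* ev β (lookup A i)) ]    ≡⟨ K.Σ-cong (λ i → trans (cong (ι (lookup v i) K.*_) (act i)) (K.x∙yz≈y∙xz _ y _)) ⟩
      Σ[ (λ i → y K.* (ι (lookup v i) K.* β i)) ]          ≡⟨ K.*-Σ y (λ i → ι (lookup v i) K.* β i) ⟨
      y K.* ev β v                                         ∎

    Acts-identity : Acts identity K.1#
    Acts-identity a = begin
      ev β (lookup identity a)  ≡⟨ K.Σ-δ _ a off-diagonal ⟩
      ι (lookup (lookup identity a) a) K.* β a  ≡⟨ cong (λ x → ι x K.* β a) (trans (entry a) (diagonal a)) ⟩
      ι F.1# K.* β a   ≡⟨ cong (K._* β a) 1-hom ⟩
      K.1# K.* β a     ∎
      where
      δ : Fin d → Fin d → Car F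
      δ i j = if does (i Fin.≟ j) then F.1# else F.0#
      entry : ∀ j → lookup (lookup identity a) j ≡ δ a j
      entry j = trans (cong (λ r → lookup r j) (lookup∘tabulate (λ i → tabulate (δ i)) a)) (lookup∘tabulate (δ a) j)
      diagonal : ∀ i → δ i i ≡ F.1#
      diagonal i = cong (if_then F.1# else F.0#) (dec-true (i Fin.≟ i) refl)
      δ≡0 : ∀ i → i ≢ a → δ a i ≡ F.0#
      δ≡0 i i≢a = cong (if_then F.1# else F.0#) (dec-false (a Fin.≟ i) (i≢a ∘ sym))
      off-diagonal : ∀ i → i ≢ a → ι (lookup (lookup identity a) i) K.* β i ≡ K.0#
      off-diagonal i i≢a = trans (cong (λ x → ι x K.* β i) (trans (entry i) (δ≡0 i i≢a)))
                                 (trans (cong (K._* β i) 0-hom) (K.zeroˡ _))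

    -- Row vectors meet `A` before `B`, so the scalars arrive in the other order; commutativity
    -- repairs this.
    Acts-*ₘ : ∀ {A B y z} → Acts A y → Acts B z → Acts (A *ₘ B) (y K.* z)
    Acts-*ₘ {A} {B} {y} {z} actA actB a = begin
      ev β (lookup (A *ₘ B) a)      ≡⟨ cong (ev β) (lookup-map a (_*ᵥ B) A) ⟩
      ev β (lookup A a *ᵥ B)        ≡⟨ Acts-*ᵥ {B} actB (lookup A a) ⟩
      z K.* ev β (lookup A a)       ≡⟨ cong (z K.*_) (actA a) ⟩
      z K.* (y K.* β a)             ≡⟨ K.*-assoc _ _ _ ⟨
      z K.* y K.* β a               ≡⟨ cong (K._* β a) (K.*-comm z y) ⟩
      y K.* z K.* β a               ∎

    Acts-^ₘ : ∀ {A y} → Acts A y → ∀ n → Acts (A ^ₘ n) (y K.^ n)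
    Acts-^ₘ act zero    = Acts-identity
    Acts-^ₘ {A} act (suc n) = Acts-*ₘ {A} {A ^ₘ n} act (Acts-^ₘ {A} act n)

    Acts-•ₘ : ∀ c {A y} → Acts A y → Acts (c •ₘ A) (ι c K.* y)
    Acts-•ₘ c {A} {y} act a = begin
      ev β (lookup (c •ₘ A) a)      ≡⟨ cong (ev β) (lookup-map a (c •_) A) ⟩
      ev β (c • lookup A a)         ≡⟨ ev-• c (lookup A a) ⟩
      ι c K.* ev β (lookup A a)     ≡⟨ cong (ι c K.*_) (act a) ⟩
      ι c K.* (y K.* β a)           ≡⟨ K.*-assoc _ _ _ ⟨
      ι c K.* y K.* β a             ∎

    Acts-ΣM : ∀ {m} (A : Fin m → Matrix d d) (y : Fin m → Car K) → (∀ i → Acts (A i) (y i)) → Acts (ΣM A) Σ[ y ]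
    Acts-ΣM {zero}  A y act a = trans (cong (ev β) (lookup-replicate a zeroV)) (trans ev-zeroV (sym (K.zeroˡ _)))
    Acts-ΣM {suc m} A y act a = begin
      ev β (lookup (A Fin.zero +ₘ ΣM (A ∘ Fin.suc)) a)              ≡⟨ cong (ev β) (lookup-zipWith _+ᵥ_ a (A Fin.zero) _) ⟩
      ev β (lookup (A Fin.zero) a +ᵥ lookup (ΣM (A ∘ Fin.suc)) a)   ≡⟨ ev-+ (lookup (A Fin.zero) a) _ ⟩
      ev β (lookup (A Fin.zero) a) K.+ ev β (lookup (ΣM (A ∘ Fin.suc)) a)
        ≡⟨ cong₂ K._+_ (act Fin.zero a) (Acts-ΣM (A ∘ Fin.suc) (y ∘ Fin.suc) (act ∘ Fin.suc) a) ⟩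
      y Fin.zero K.* β a K.+ Σ[ y ∘ Fin.suc ] K.* β a               ≡⟨ K.distribʳ _ _ _ ⟨
      Σ[ y ] K.* β a                                                ∎

    -- Together with `Acts-scalar-unique` this makes matrices and their scalars interchangeable.
    Acts-unique : Inj (ev β) → ∀ {A B y} → Acts A y → Acts B y → A ≡ B
    Acts-unique inj actA actB = lookup-ext (λ a → inj _ _ (trans (actA a) (sym (actB a))))

  powers : ∀ {d} → Car K → Fin d → Car K
  powers x i = x K.^ toℕ i

  -- Every row but the last shifts x^a to x^(a+1). The last row holds the negated coefficients,
  -- which the equation of `x` evaluates to x^d.
  Acts-companion : ∀ {d} (c : Vec (Car F) d) (x : Car K) → LK.evalMonic (Vec.map ι c) x ≡ K.0# →
                   Acts (powers x) (companion c) x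
  Acts-companion {d} c x root a with suc (toℕ a) ℕ.≟ d
  ... | yes a+1≡d = begin
    ev β (lookup (companion c) a)             ≡⟨ K.Σ-cong (λ i → trans (cong (λ y → ι y K.* β i) (last-row i)) (trans (cong (K._* β i) (neg-hom _)) (neg* i))) ⟩
    Σ[ (λ i → K.- K.1# K.* (ι (lookup c i) K.* β i)) ]   ≡⟨ K.*-Σ (K.- K.1#) (λ i → ι (lookup c i) K.* β i) ⟨
    K.- K.1# K.* ev β c                       ≡⟨ K.-1*x≈-x _ ⟩
    K.- ev β c                                ≡⟨ K.+-inverseˡ-unique _ _ (trans (cong (x K.^ d K.+_) map-ι) root) ⟨
    x K.^ d                                   ≡⟨ cong (x K.^_) a+1≡d ⟨
    x K.* β a                                 ∎
    where
    β : Fin d → Car K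
    β = powers x
    entry : ∀ j → lookup (lookup (companion c) a) j ≡
            (if does (suc (toℕ a) ℕ.≟ d) then F.- lookup c j else (if does (toℕ j ℕ.≟ suc (toℕ a)) then F.1# else F.0#))
    entry j = trans (cong (λ r → lookup r j) (lookup∘tabulate _ a)) (lookup∘tabulate _ j)
    δ : Fin d → Car F
    δ j = if does (toℕ j ℕ.≟ suc (toℕ a)) then F.1# else F.0#
    map-ι : ev β c ≡ Σ[ (λ i → lookup (Vec.map ι c) i K.* β i) ]
    map-ι = K.Σ-cong (λ i → cong (K._* β i) (sym (lookup-map i ι c)))
    last-row : ∀ i → lookup (lookup (companion c) a) i ≡ F.- lookup c i
    last-row i = trans (entry i) (cong (if_then F.- lookup c i else δ i) (dec-true (suc (toℕ a) ℕ.≟ d) a+1≡d))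
    neg* : ∀ i → K.- ι (lookup c i) K.* β i ≡ K.- K.1# K.* (ι (lookup c i) K.* β i)
    neg* i = trans (cong (K._* β i) (sym (K.-1*x≈-x _))) (K.*-assoc _ _ _)
  ... | no a+1≢d = begin
    ev β (lookup (companion c) a)                   ≡⟨ K.Σ-δ _ a+1 vanish ⟩
    ι (lookup (lookup (companion c) a) a+1) K.* β a+1  ≡⟨ cong (λ y → ι y K.* β a+1) (trans (entry a+1) on) ⟩
    ι F.1# K.* β a+1                                ≡⟨ trans (cong (K._* β a+1) 1-hom) (K.*-identityˡ _) ⟩
    β a+1                                           ≡⟨ cong (x K.^_) (toℕ-fromℕ< (ℕ.≤∧≢⇒< (toℕ<n a) a+1≢d)) ⟩
    x K.* β a                                       ∎
    where
    β : Fin d → Car K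
    β = powers x
    a+1 : Fin d
    a+1 = fromℕ< (ℕ.≤∧≢⇒< (toℕ<n a) a+1≢d)
    δ : Fin d → Car F
    δ j = if does (toℕ j ℕ.≟ suc (toℕ a)) then F.1# else F.0#
    entry : ∀ j → lookup (lookup (companion c) a) j ≡ δ j
    entry j = trans (cong (λ r → lookup r j) (lookup∘tabulate _ a)) (trans (lookup∘tabulate _ j)
                (cong (if_then F.- lookup c j else δ j) (dec-false (suc (toℕ a) ℕ.≟ d) a+1≢d)))
    on : δ a+1 ≡ F.1#
    on = cong (if_then F.1# else F.0#) (dec-true (toℕ a+1 ℕ.≟ suc (toℕ a)) (toℕ-fromℕ< _))
    off : ∀ i → i ≢ a+1 → δ i ≡ F.0#
    off i i≢ = cong (if_then F.1# else F.0#) (dec-false (toℕ i ℕ.≟ suc (toℕ a))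
                 (λ p → i≢ (toℕ-injective (trans p (sym (toℕ-fromℕ< _))))))
    vanish : ∀ i → i ≢ a+1 → ι (lookup (lookup (companion c) a) i) K.* β i ≡ K.0#
    vanish i i≢ = trans (cong (λ y → ι y K.* β i) (trans (entry i) (off i i≢)))
                        (trans (cong (K._* β i) 0-hom) (K.zeroˡ _))

-- Field reduction: F_q^n as F_{q^n} by means of `θ`

module FieldReduction {q k s : ℕ} (σ : Setting q k s) where
  open import Data.Vec using (lookup)
  open Setting σ
  open Constructions σ public
  private
    module LA = LinAlg F
    module F = FieldTheory F
    module K = FieldTheory K
    module L = FieldTheory L
    module ιH = HomTheory ι-hom
    module jH = HomTheory j-hom
    module EFK = Evaluation ι-hom
    module EKL = Evaluation j-hom
  open L using (Σ[_])
  open ≡-Reasoning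

  κ : Car F → Car L
  κ = j ∘ ι

  κ-hom : IsFieldHom F L κ
  κ-hom = ∘-hom ι-hom j-hom

  open Evaluation κ-hom public

  -- The F_q-basis ω^r α^b of F_{q^n}, ordered like the rows of ψ.
  β : Fin n → Car L
  β c = let b , r = remQuot {s} k c in j (ω K.^ toℕ r) L.* α L.^ toℕ b

  θ : LA.Vector n → Car L
  θ = ev β

  -- By `coords-ok`, `x` is a polynomial in ω; `φ x` is the same polynomial in the companion matrix,
  -- which acts as ω.
  φ-acts : ∀ x → EFK.Acts (EFK.powers ω) (φ x) x
  φ-acts x = subst (EFK.Acts (EFK.powers ω) (φ x)) (coords-ok x)
    (EFK.Acts-ΣM (EFK.powers ω) (λ i → lookup (coords x) i LA.•ₘ (M-k LA.^ₘ toℕ i)) (λ i → ι (lookup (coords x) i) K.* ω K.^ toℕ i)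
      (λ i → EFK.Acts-•ₘ (EFK.powers ω) (lookup (coords x) i) {M-k LA.^ₘ toℕ i}
      (EFK.Acts-^ₘ (EFK.powers ω) {M-k} (EFK.Acts-companion p ω (proj₁ p-min)) (toℕ i))))

  M-s-acts : EKL.Acts (EKL.powers α) M-s α
  M-s-acts = EKL.Acts-companion mα α (proj₁ mα-min)

  -- Summing over the positions within a block merges k coefficients from F_q into one from F_{q^k}:
  -- an F_q-combination of the ω^r y_b is an F_{q^k}-combination of the y_b.
  Σ-blocks : ∀ m (c : Fin (m ℕ.* k) → Car F) (y : Fin m → Car L) →
      Σ[ (λ a → κ (c a) L.* (let b , r = remQuot {m} k a in j (ω K.^ toℕ r) L.* y b)) ]
    ≡ Σ[ (λ b → j K.Σ[ (λ r → ι (c (combine b r)) K.* ω K.^ toℕ r) ] L.* y b) ]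
  Σ-blocks m c y = trans (L.Σ-combine m (λ a → κ (c a) L.* (let b , r = remQuot {m} k a in j (ω K.^ toℕ r) L.* y b))) (L.Σ-cong block)
    where
    block : ∀ b → Σ[ (λ r → κ (c (combine b r)) L.* (let b , r = remQuot {m} k (combine b r) in j (ω K.^ toℕ r) L.* y b)) ]
                ≡ j K.Σ[ (λ r → ι (c (combine b r)) K.* ω K.^ toℕ r) ] L.* y b
    block b = begin
      Σ[ (λ r → κ (c (combine b r)) L.* (let b , r = remQuot {m} k (combine b r) in j (ω K.^ toℕ r) L.* y b)) ]
        ≡⟨ L.Σ-cong (λ r → cong (λ (b′ , r′) → κ (c (combine b r)) L.* (j (ω K.^ toℕ r′) L.* y b′)) (remQuot-combine b r)) ⟩
      Σ[ (λ r → κ (c (combine b r)) L.* (j (ω K.^ toℕ r) L.* y b)) ]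
        ≡⟨ L.Σ-cong (λ r → trans (sym (L.*-assoc (κ (c (combine b r))) _ _)) (cong (L._* y b) (sym (jH.*-hom (ι (c (combine b r))) (ω K.^ toℕ r))))) ⟩
      Σ[ (λ r → j (ι (c (combine b r)) K.* ω K.^ toℕ r) L.* y b) ]
        ≡⟨ L.Σ-* (y b) (λ r → j (ι (c (combine b r)) K.* ω K.^ toℕ r)) ⟨
      Σ[ (λ r → j (ι (c (combine b r)) K.* ω K.^ toℕ r)) ] L.* y b
        ≡⟨ cong (L._* y b) (sym (jH.Σ-hom (λ r → ι (c (combine b r)) K.* ω K.^ toℕ r))) ⟩
      j K.Σ[ (λ r → ι (c (combine b r)) K.* ω K.^ toℕ r) ] L.* y b ∎

  row : ∀ {m} → LK.Matrix m s → Fin m → Car L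
  row A a = EKL.ev (EKL.powers α) (lookup A a)

  -- Row r of the block `φ x` holds the coordinates of x ω^r, so a row of `A` unfolds into its
  -- multiples by 1, ω, ..., ω^(k-1).
  θ-ψrows : ∀ {m} (A : LK.Matrix m s) a′ →
            θ (ψrows A a′) ≡ (let a , r = remQuot {m} k a′ in j (ω K.^ toℕ r) L.* row A a)
  θ-ψrows {m} A a′ = begin
    θ (ψrows A a′)
      ≡⟨ L.Σ-cong (λ c → cong (λ x → κ x L.* β c) (lookup∘tabulate entry c)) ⟩
    Σ[ (λ c → κ (entry c) L.* β c) ]
      ≡⟨ Σ-blocks s entry (EKL.powers α) ⟩
    Σ[ (λ b → j K.Σ[ (λ r₂ → ι (entry (combine {s} {k} b r₂)) K.* ω K.^ toℕ r₂) ] L.* EKL.powers α b) ]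
      ≡⟨ L.Σ-cong (λ b → cong (λ x → j x L.* EKL.powers α b) (trans (K.Σ-cong (λ r₂ → cong (λ x → ι x K.* ω K.^ toℕ r₂) (entry-combine b r₂)))
                                                                   (φ-acts (lookup (lookup A a) b) r))) ⟩
    Σ[ (λ b → j (lookup (lookup A a) b K.* ω K.^ toℕ r) L.* EKL.powers α b) ]
      ≡⟨ L.Σ-cong (λ b → trans (cong (L._* EKL.powers α b) (trans (jH.*-hom (lookup (lookup A a) b) (ω K.^ toℕ r)) (L.*-comm _ _))) (L.*-assoc _ _ _)) ⟩
    Σ[ (λ b → j (ω K.^ toℕ r) L.* (j (lookup (lookup A a) b) L.* EKL.powers α b)) ]
      ≡⟨ L.*-Σ _ (λ b → j (lookup (lookup A a) b) L.* EKL.powers α b) ⟨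
    j (ω K.^ toℕ r) L.* row A a ∎
    where
    a = proj₁ (remQuot {m} k a′)
    r = proj₂ (remQuot {m} k a′)
    entry : Fin n → Car F
    entry c = let b , r₂ = remQuot {s} k c in lookup (lookup (φ (lookup (lookup A a) b)) r) r₂
    entry-combine : ∀ b r₂ → entry (combine b r₂) ≡ lookup (lookup (φ (lookup (lookup A a) b)) r) r₂
    entry-combine b r₂ = cong (λ (b , r₂) → lookup (lookup (φ (lookup (lookup A a) b)) r) r₂) (remQuot-combine b r₂)

  ψM-s-acts : Acts β ψM-s α
  ψM-s-acts a′ = begin
    θ (lookup ψM-s a′)                             ≡⟨ cong θ (lookup∘tabulate (ψrows M-s) a′) ⟩
    θ (ψrows M-s a′)                               ≡⟨ θ-ψrows M-s a′ ⟩
    j (ω K.^ toℕ r) L.* row M-s a                  ≡⟨ cong (j (ω K.^ toℕ r) L.*_) (M-s-acts a) ⟩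
    j (ω K.^ toℕ r) L.* (α L.* α L.^ toℕ a)        ≡⟨ L.x∙yz≈y∙xz _ _ _ ⟩
    α L.* β a′                                     ∎
    where
    a = proj₁ (remQuot {s} k a′)
    r = proj₂ (remQuot {s} k a′)

  θ-lincomb-ψrows : ∀ {m} (A : LK.Matrix m s) (c : Fin (m ℕ.* k) → Car F) →
    θ (LA.lincomb c (ψrows A)) ≡ Σ[ (λ a → j K.Σ[ (λ r → ι (c (combine a r)) K.* ω K.^ toℕ r) ] L.* row A a) ]
  θ-lincomb-ψrows {m} A c = trans (ev-lincomb β c (ψrows A))
    (trans (L.Σ-cong (λ a → cong (κ (c a) L.*_) (θ-ψrows {m} A a))) (Σ-blocks m c (row A)))

  -- With the converse below: `θ` carries the F_q-space of the blocks onto the F_{q^k}-span of the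
  -- rows.
  φSub⇒row-combination : ∀ {m} (A : LK.Matrix m s) v → φSub A v →
                         Σ (Fin m → Car K) λ c → θ v ≡ Σ[ (λ a → j (c a) L.* row A a) ]
  φSub⇒row-combination A _ (c , refl) = (λ a → K.Σ[ (λ r → ι (c (combine a r)) K.* ω K.^ toℕ r) ]) , θ-lincomb-ψrows A c

  row-combination⇒φSub : ∀ {m} (A : LK.Matrix m s) (c : Fin m → Car K) →
                         ∃[ v ] (φSub A v × θ v ≡ Σ[ (λ a → j (c a) L.* row A a) ])
  row-combination⇒φSub {m} A c = LA.lincomb c′ (ψrows A) , (c′ , refl) , trans (θ-lincomb-ψrows A c′)
    (L.Σ-cong (λ a → cong (λ x → j x L.* row A a) (trans (K.Σ-cong (λ r → cong (λ (a′ , r′) → ι (lookup (coords (c a′)) r′) K.* ω K.^ toℕ r)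
      (remQuot-combine a r))) (coords-ok (c a)))))
    where
    c′ : Fin (m ℕ.* k) → Car F
    c′ i = let a , r = remQuot {m} k i in lookup (coords (c a)) r

  -- Independence is used twice: that of the powers of α over F_{q^k} kills the coefficient of each
  -- block, then that of the powers of ω over F_q kills the coordinates in the block.
  θ-inj : Inj θ
  θ-inj = ev-injective β λ v θv≡0 → lookup-ext λ c →
    trans (cong (lookup v) (sym (combine-remQuot {s} k c))) (trans (comp v θv≡0 _ _) (sym (lookup-replicate c _)))
    where
    block : LA.Vector n → Fin s → Car K
    block v b = K.Σ[ (λ r → ι (lookup v (combine b r)) K.* ω K.^ toℕ r) ]
    blocks : LA.Vector n → Vec (Car K) s
    blocks v = tabulate (block v)
    comp : ∀ v → θ v ≡ L.0# → ∀ b r → lookup v (combine {s} {k} b r) ≡ F.0#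
    comp v θv≡0 b r = begin
      lookup v (combine b r)                         ≡⟨ lookup∘tabulate (λ r → lookup v (combine b r)) r ⟨
      lookup (tabulate (λ r → lookup v (combine b r))) r ≡⟨ cong (λ w → lookup w r) (proj₂ p-min (tabulate (λ r → lookup v (combine b r))) (trans
                                                            (K.Σ-cong (λ r → cong (λ x → ι x K.* ω K.^ toℕ r) (lookup∘tabulate (λ r → lookup v (combine b r)) r))) block≡0)) ⟩
      lookup (replicate k F.0#) r                    ≡⟨ lookup-replicate r _ ⟩
      F.0#                                           ∎
      where
      block≡0 : K.Σ[ (λ r → ι (lookup v (combine b r)) K.* ω K.^ toℕ r) ] ≡ K.0#
      block≡0 = begin
        K.Σ[ (λ r → ι (lookup v (combine b r)) K.* ω K.^ toℕ r) ] ≡⟨ lookup∘tabulate (block v) b ⟨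
        lookup (blocks v) b            ≡⟨ cong (λ w → lookup w b) (proj₂ mα-min (blocks v)
                                            (trans (L.Σ-cong (λ b → cong (λ x → j x L.* EKL.powers α b) (lookup∘tabulate (block v) b)))
                                              (trans (sym (Σ-blocks s (lookup v) (EKL.powers α))) θv≡0))) ⟩
        lookup (replicate s K.0#) b    ≡⟨ lookup-replicate b _ ⟩
        K.0#                           ∎

  abstract
    θ-surj : ∀ x → ∃[ v ] θ v ≡ x
    θ-surj = inj⇒surj (SubspaceTheory.Vector↔ F n) L.enumeration
      (ℕ.≤-reflexive (trans L-size (cong (ℕ._^ n) (sym F-size)))) θ θ-inj

-- The multiplicative group of a finite field

least : ∀ {P : ℕ → Set} → Decidable P → ∀ m → P m → ∃[ n ] (P n × (∀ {i} → i < n → ¬ P i))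
least {P} P? = <-rec (λ m → P m → ∃[ n ] (P n × (∀ {i} → i < n → ¬ P i))) step
  where
  step : ∀ m → (∀ {i} → i < m → P i → _) → P m → ∃[ n ] (P n × (∀ {i} → i < n → ¬ P i))
  step m rec Pm with ℕ.anyUpTo? P? m
  ... | yes (i , i<m , Pi) = rec i<m Pi
  ... | no  none           = m , Pm , λ i<m Pi → none (_ , i<m , Pi)

-- Writing the base as 1 + a and carrying (1 + a)^m = 1 + r a postpones truncated subtraction to the
-- end. The next quotient comes from (1 + a)(1 + r a) = 1 + (1 + r + a r) a.
∸1∣^∸1 : ∀ a m → a ∣ suc a ℕ.^ m ∸ 1
∸1∣^∸1 a m = let r , eq = go m in divides r (cong (_∸ 1) eq)
  where
  go : ∀ m → ∃[ r ] suc a ℕ.^ m ≡ suc (r ℕ.* a)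
  go zero    = 0 , refl
  go (suc m) = let r , eq = go m in suc (r ℕ.+ a ℕ.* r) , trans (cong (suc a ℕ.*_) eq) (cong suc (begin
    r ℕ.* a ℕ.+ a ℕ.* suc (r ℕ.* a)                  ≡⟨ cong (r ℕ.* a ℕ.+_) (ℕ.*-suc a (r ℕ.* a)) ⟩
    r ℕ.* a ℕ.+ (a ℕ.+ a ℕ.* (r ℕ.* a))              ≡⟨ ℕ.+-assoc (r ℕ.* a) a _ ⟨
    r ℕ.* a ℕ.+ a ℕ.+ a ℕ.* (r ℕ.* a)                ≡⟨ cong₂ ℕ._+_ (ℕ.+-comm (r ℕ.* a) a) (sym (ℕ.*-assoc a r a)) ⟩
    a ℕ.+ r ℕ.* a ℕ.+ a ℕ.* r ℕ.* a                  ≡⟨ ℕ.+-assoc a _ _ ⟩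
    a ℕ.+ (r ℕ.* a ℕ.+ a ℕ.* r ℕ.* a)                ≡⟨ cong (a ℕ.+_) (ℕ.*-distribʳ-+ a r (a ℕ.* r)) ⟨
    a ℕ.+ (r ℕ.+ a ℕ.* r) ℕ.* a                      ∎))
    where open ≡-Reasoning

module PrimitiveElement (L : FiniteField) {N : ℕ} (L-size : size L ≡ suc N) (2≤N : 2 ≤ N)
                        {α : Car L} (α-prim : LinAlg.Primitive L α) where
  open FieldTheory L
  open ≡-Reasoning

  -- The powers of 0 are 1 and 0, so a primitive 0 would leave at most two elements. In F_2 it does
  -- count as primitive, because 0^0 = 1; `2≤N` excludes that field.
  α≢0 : α ≢ 0#
  α≢0 refl = contradiction (ℕ.≤-trans (subst (3 ≤_) (sym L-size) (s≤s 2≤N))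
                              (inj⇒size≤ enumeration (↔-id (Fin 2)) (λ x → indicator (x ≟ 0#)) (λ x y → indicator-inj (x ≟ 0#) (y ≟ 0#)))) (λ { (s≤s (s≤s ())) })
    where
    0^ : ∀ i → 0# ^ i ≢ 0# → 0# ^ i ≡ 1#
    0^ zero    _ = refl
    0^ (suc i) h = contradiction (zeroˡ _) h
    ≢0⇒≡1 : ∀ x → x ≢ 0# → x ≡ 1#
    ≢0⇒≡1 x x≢0 = let i , eq = α-prim x x≢0 in trans eq (0^ i (x≢0 ∘ trans eq))
    indicator : ∀ {x} → Dec (x ≡ 0#) → Fin 2
    indicator (yes _) = Fin.zero
    indicator (no _)  = Fin.suc Fin.zero
    indicator-inj : ∀ {x y} (d : Dec (x ≡ 0#)) (e : Dec (y ≡ 0#)) → indicator d ≡ indicator e → x ≡ y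
    indicator-inj (yes p) (yes r) eq = trans p (sym r)
    indicator-inj (no p)  (no r)  eq = trans (≢0⇒≡1 _ p) (sym (≢0⇒≡1 _ r))
    indicator-inj (yes _) (no _)  ()
    indicator-inj (no _)  (yes _) ()

  ^-cancel : ∀ {i k} → i ≤ k → α ^ i ≡ α ^ k → α ^ (k ∸ i) ≡ 1#
  ^-cancel {i} {k} i≤k eq = *-cancelˡ (α ^ i) (^-nonzero i α≢0) (begin
    α ^ i * α ^ (k ∸ i)   ≡⟨ ^-+ α i (k ∸ i) ⟨
    α ^ (i ℕ.+ (k ∸ i))   ≡⟨ cong (α ^_) (ℕ.m+[n∸m]≡n i≤k) ⟩
    α ^ k                 ≡⟨ eq ⟨
    α ^ i                 ≡⟨ *-identityʳ _ ⟨
    α ^ i * 1#            ∎)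

  private
    period : ∃[ m ] α ^ suc m ≡ 1#
    period with pigeonhole (ℕ.n<1+n (size L)) (Inverse.from enumeration ∘ (α ^_) ∘ toℕ)
    ... | i , k , i<k , eq = ℕ.pred (toℕ k ∸ toℕ i) , (begin
      α ^ suc (ℕ.pred (toℕ k ∸ toℕ i))  ≡⟨ cong (α ^_) (ℕ.suc-pred _ {{ℕ.>-nonZero (ℕ.m<n⇒0<n∸m i<k)}}) ⟩
      α ^ (toℕ k ∸ toℕ i)               ≡⟨ ^-cancel (ℕ.<⇒≤ i<k) (from-inj enumeration _ _ eq) ⟩
      1#                                ∎)

    abstract
      leastPeriod : ∃[ m ] (α ^ suc m ≡ 1# × (∀ {i} → i < m → ¬ α ^ suc i ≡ 1#))
      leastPeriod = least (λ m → α ^ suc m ≟ 1#) (proj₁ period) (proj₂ period)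

    order : ℕ
    order = suc (proj₁ leastPeriod)

    α^order : α ^ order ≡ 1#
    α^order = proj₁ (proj₂ leastPeriod)

    minimal : ∀ {i} → i < order → α ^ i ≡ 1# → i ≡ 0
    minimal {zero}  _         _  = refl
    minimal {suc i} (s≤s i<m) eq = contradiction eq (proj₂ (proj₂ leastPeriod) i<m)

    α^% : ∀ i → α ^ i ≡ α ^ (i % order)
    α^% i = begin
      α ^ i                                        ≡⟨ cong (α ^_) (trans (m≡m%n+[m/n]*n i order) (cong (i % order ℕ.+_) (ℕ.*-comm (i / order) order))) ⟩
      α ^ (i % order ℕ.+ order ℕ.* (i / order))    ≡⟨ ^-+ α (i % order) _ ⟩
      α ^ (i % order) * α ^ (order ℕ.* (i / order)) ≡⟨ cong (α ^ (i % order) *_) (trans (^-* α order (i / order)) (trans (cong (_^ (i / order)) α^order) (1^ (i / order)))) ⟩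
      α ^ (i % order) * 1#                         ≡⟨ *-identityʳ _ ⟩
      α ^ (i % order)                              ∎

    below-inj-≤ : ∀ {i k} → i ≤ k → k < order → α ^ i ≡ α ^ k → i ≡ k
    below-inj-≤ {i} {k} i≤k k< eq =
      ℕ.≤-antisym i≤k (ℕ.m∸n≡0⇒m≤n (minimal (ℕ.≤-<-trans (ℕ.m∸n≤m k i) k<) (^-cancel i≤k eq)))

    below-inj : ∀ {i k} → i < order → k < order → α ^ i ≡ α ^ k → i ≡ k
    below-inj {i} {k} i< k< eq with ℕ.≤-total i k
    ... | inj₁ i≤k = below-inj-≤ i≤k k< eq
    ... | inj₂ k≤i = sym (below-inj-≤ k≤i i< (sym eq))

    -- Zero and the powers of α below the order make up the field: distinct by minimality,
    -- exhaustive by primitivity.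
    order≡N : order ≡ N
    order≡N = ℕ.suc-injective (trans (ℕ.≤-antisym
        (inj⇒size≤ (↔-id (Fin (suc order))) enumeration f f-inj) (inj⇒size≤ enumeration (↔-id (Fin (suc order))) g g-inj)) L-size)
      where
      f : Fin (suc order) → Carrier
      f Fin.zero    = 0#
      f (Fin.suc i) = α ^ toℕ i
      f-inj : Inj f
      f-inj Fin.zero    Fin.zero    eq = refl
      f-inj Fin.zero    (Fin.suc k) eq = contradiction (sym eq) (^-nonzero (toℕ k) α≢0)
      f-inj (Fin.suc i) Fin.zero    eq = contradiction eq (^-nonzero (toℕ i) α≢0)
      f-inj (Fin.suc i) (Fin.suc k) eq = cong Fin.suc (toℕ-injective (below-inj (toℕ<n i) (toℕ<n k) eq))
      g-with : ∀ x → Dec (x ≡ 0#) → Fin (suc order)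
      g-with x (yes _)  = Fin.zero
      g-with x (no x≢0) = Fin.suc (fromℕ< (m%n<n (proj₁ (α-prim x x≢0)) order))
      f∘g : ∀ x d → f (g-with x d) ≡ x
      f∘g x (yes x≡0) = sym x≡0
      f∘g x (no x≢0)  = trans (cong (α ^_) (toℕ-fromℕ< (m%n<n (proj₁ (α-prim x x≢0)) order))) (trans (sym (α^% (proj₁ (α-prim x x≢0)))) (sym (proj₂ (α-prim x x≢0))))
      g : Carrier → Fin (suc order)
      g x = g-with x (x ≟ 0#)
      g-inj : Inj g
      g-inj x y eq = trans (sym (f∘g x (x ≟ 0#))) (trans (cong f eq) (f∘g y (y ≟ 0#)))

  ^≡1⇒∣ : ∀ i → α ^ i ≡ 1# → N ∣ i
  ^≡1⇒∣ i eq = subst (_∣ i) order≡N (∣.m%n≡0⇒n∣m i order (minimal (m%n<n i order) (trans (sym (α^% i)) eq)))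

  ∣⇒^≡1 : ∀ {i} → N ∣ i → α ^ i ≡ 1#
  ∣⇒^≡1 (divides c refl) = trans (cong (α ^_) (trans (cong (c ℕ.*_) (sym order≡N)) (ℕ.*-comm c order)))
    (trans (^-* α order c) (trans (cong (_^ c) α^order) (1^ c)))

  -- With x = α^e the claim is one about divisibility by `N`, and gcd(e a, e b) = e gcd(a, b) takes
  -- the place of Bezout coefficients, one of which could be negative.
  ^≡1∧^≡1⇒^gcd≡1 : ∀ {x} a b → x ≢ 0# → x ^ a ≡ 1# → x ^ b ≡ 1# → x ^ gcd a b ≡ 1#
  ^≡1∧^≡1⇒^gcd≡1 a b x≢0 xᵃ xᵇ with α-prim _ x≢0
  ... | e , refl = trans (sym (^-* α e (gcd a b))) (∣⇒^≡1 (subst (N ∣_) (sym (c*gcd[m,n]≡gcd[cm,cn] e a b))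
    (gcd-greatest (^≡1⇒∣ (e ℕ.* a) (trans (^-* α e a) xᵃ)) (^≡1⇒∣ (e ℕ.* b) (trans (^-* α e b) xᵇ)))))

  module RootsOfUnity {u c : ℕ} .{{_ : NonZero u}} .{{_ : NonZero c}} (uc≡N : u ℕ.* c ≡ N) where

    -- As α has order u c, this power has order `u` and generates the `u`-th roots of unity.
    ζ : Carrier
    ζ = α ^ c

    ζ^u : ζ ^ u ≡ 1#
    ζ^u = trans (sym (^-* α c u)) (∣⇒^≡1 (divides 1 (trans (ℕ.*-comm c u) (trans uc≡N (sym (ℕ.*-identityˡ N))))))

    ζ^≡1⇒∣ : ∀ i → ζ ^ i ≡ 1# → u ∣ i
    ζ^≡1⇒∣ i eq = ∣.*-cancelˡ-∣ c (subst (_∣ c ℕ.* i) (trans (sym uc≡N) (ℕ.*-comm u c)) (^≡1⇒∣ (c ℕ.* i) (trans (^-* α c i) eq)))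

    -- For x = α^e the equation says u c ∣ e u, and cancelling `u` leaves c ∣ e.
    root⇒ζ^ : ∀ {x} → x ^ u ≡ 1# → ∃[ i ] x ≡ ζ ^ i
    root⇒ζ^ {x} xᵘ with α-prim x (^≡1⇒nonzero u xᵘ)
    ... | e , refl with ∣.*-cancelˡ-∣ u (subst₂ _∣_ (sym uc≡N) (ℕ.*-comm e u) (^≡1⇒∣ (e ℕ.* u) (trans (^-* α e u) xᵘ)))
    ... | divides i refl = i , trans (cong (α ^_) (ℕ.*-comm i c)) (^-* α c i)

    ζ^% : ∀ i → ζ ^ i ≡ ζ ^ (i % u)
    ζ^% i = begin
      ζ ^ i                              ≡⟨ cong (ζ ^_) (trans (m≡m%n+[m/n]*n i u) (cong (i % u ℕ.+_) (ℕ.*-comm (i / u) u))) ⟩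
      ζ ^ (i % u ℕ.+ u ℕ.* (i / u))      ≡⟨ ^-+ ζ (i % u) _ ⟩
      ζ ^ (i % u) * ζ ^ (u ℕ.* (i / u))  ≡⟨ cong (ζ ^ (i % u) *_) (trans (^-* ζ u (i / u)) (trans (cong (_^ (i / u)) ζ^u) (1^ (i / u)))) ⟩
      ζ ^ (i % u) * 1#                   ≡⟨ *-identityʳ _ ⟩
      ζ ^ (i % u)                        ∎

    -- `f` lists a finite set of units closed under products, hence a subgroup. It will be the
    -- scalars of `T` and the units of each subfield.
    module _ (f : Fin u → Carrier) (f≢0 : ∀ i → f i ≢ 0#) (f-inj : Inj f)
             (f-closed : ∀ i l → ∃[ m ] f m ≡ f i * f l) where
      private
        open CommutativeMonoidSum *-commutativeMonoid using () renaming (sum to product; sum-permute to product-permute; sum-cong-≗ to product-cong)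

        product-scale : ∀ {d} x (g : Fin d → Carrier) → product (λ i → x * g i) ≡ x ^ d * product g
        product-scale {zero}  x g = sym (*-identityˡ _)
        product-scale {suc d} x g = trans (cong (x * g Fin.zero *_) (product-scale x (g ∘ Fin.suc))) (interchange _ _ _ _)

        product≢0 : ∀ {d} (g : Fin d → Carrier) → (∀ i → g i ≢ 0#) → product g ≢ 0#
        product≢0 {zero}  g g≢0 = 1≢0
        product≢0 {suc d} g g≢0 = *-nonzero (g≢0 Fin.zero) (product≢0 (g ∘ Fin.suc) (g≢0 ∘ Fin.suc))

      -- Lagrange: multiplication by f i permutes the subgroup, so it fixes the product of its elements.
      subgroup⇒root : ∀ i → f i ^ u ≡ 1#
      subgroup⇒root i = *-cancelʳ (product f) (product≢0 f f≢0) (begin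
        f i ^ u * product f              ≡⟨ product-scale (f i) f ⟨
        product (λ l → f i * f l)        ≡⟨ product-cong (λ l → proj₂ (f-closed i l)) ⟨
        product (f ∘ h)                  ≡⟨ product-permute f π ⟨
        product f                        ≡⟨ *-identityˡ _ ⟨
        1# * product f                   ∎)
        where
        h : Fin u → Fin u
        h l = proj₁ (f-closed i l)
        h-inj : Inj h
        h-inj l m eq = f-inj l m (*-cancelˡ (f i) (f≢0 i)
          (trans (sym (proj₂ (f-closed i l))) (trans (cong f eq) (proj₂ (f-closed i m)))))
        h⁻¹ : ∀ m → ∃[ l ] h l ≡ m
        h⁻¹ = inj⇒surj-Fin ℕ.≤-refl h h-inj
        π : Permutation u u
        π = permutation h (proj₁ ∘ h⁻¹) (proj₂ ∘ h⁻¹) (λ l → h-inj _ l (proj₂ (h⁻¹ (h l))))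

      -- The members of the subgroup are powers of ζ with `u` different exponents below `u`, so
      -- every exponent occurs.
      root⇒subgroup : ∀ {x} → x ^ u ≡ 1# → ∃[ i ] f i ≡ x
      root⇒subgroup {x} xᵘ = let e , x≡ = root⇒ζ^ xᵘ
                                 l , eq = inj⇒surj-Fin ℕ.≤-refl exponent exponent-inj (fromℕ< (m%n<n e u))
                             in l , (begin
        f l                                       ≡⟨ f≡ζ^ l ⟩
        ζ ^ toℕ (exponent l)                      ≡⟨ cong (λ i → ζ ^ toℕ i) eq ⟩
        ζ ^ toℕ (fromℕ< (m%n<n e u))              ≡⟨ cong (ζ ^_) (toℕ-fromℕ< (m%n<n e u)) ⟩
        ζ ^ (e % u)                               ≡⟨ ζ^% e ⟨
        ζ ^ e                                     ≡⟨ x≡ ⟨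
        x                                         ∎)
        where
        exponent : Fin u → Fin u
        exponent l = fromℕ< (m%n<n (proj₁ (root⇒ζ^ (subgroup⇒root l))) u)
        f≡ζ^ : ∀ l → f l ≡ ζ ^ toℕ (exponent l)
        f≡ζ^ l = trans (proj₂ (root⇒ζ^ (subgroup⇒root l)))
          (trans (ζ^% _) (cong (ζ ^_) (sym (toℕ-fromℕ< (m%n<n (proj₁ (root⇒ζ^ (subgroup⇒root l))) u)))))
        exponent-inj : Inj exponent
        exponent-inj l m eq = f-inj l m (trans (f≡ζ^ l) (trans (cong (λ i → ζ ^ toℕ i) eq) (sym (f≡ζ^ m))))

  module Subfield {F : FiniteField} {κ : Car F → Carrier} (hom : IsFieldHom F L κ)
                  {m : ℕ} (F-size : size F ≡ suc m) (m∣N : m ∣ N) where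
    private
      module F = FieldTheory F
      open HomTheory hom

      e : Fin (suc m) ↔ F.Carrier
      e = subst (λ d → Fin d ↔ F.Carrier) F-size F.enumeration
      open Inverse e using (to; from; strictlyInverseˡ; strictlyInverseʳ)

      -- `punchIn` at the index of zero skips it, leaving a list of the `m` nonzero elements.
      unit : Fin m → F.Carrier
      unit i = to (punchIn (from F.0#) i)

      unit≢0 : ∀ i → unit i ≢ F.0#
      unit≢0 i eq = punchInᵢ≢i (from F.0#) i (trans (sym (strictlyInverseʳ _)) (cong from eq))

      unit-surj : ∀ {x} → x ≢ F.0# → ∃[ i ] unit i ≡ x
      unit-surj {x} x≢0 = punchOut 0≢x , trans (cong to (punchIn-punchOut 0≢x)) (strictlyInverseˡ x)
        where
        0≢x : from F.0# ≢ from x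
        0≢x eq = x≢0 (sym (from-inj e _ _ eq))

      N≢0 : NonZero N
      N≢0 = ℕ.>-nonZero (ℕ.≤-trans (s≤s z≤n) 2≤N)
      c : ℕ
      c = ∣._∣_.quotient m∣N
      mc≡N : m ℕ.* c ≡ N
      mc≡N = trans (ℕ.*-comm m c) (sym (∣._∣_.equality m∣N))
      instance
        m≢0 : NonZero m
        m≢0 = ℕ.m*n≢0⇒m≢0 m {{subst NonZero (sym mc≡N) N≢0}}
        c≢0 : NonZero c
        c≢0 = ℕ.m*n≢0⇒n≢0 m {{subst NonZero (sym mc≡N) N≢0}}
      module R = RootsOfUnity {m} {c} mc≡N

      closed : ∀ i l → ∃[ j ] κ (unit j) ≡ κ (unit i) * κ (unit l)
      closed i l = let j , eq = unit-surj (F.*-nonzero (unit≢0 i) (unit≢0 l))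
                   in j , trans (cong κ eq) (*-hom _ _)

      κunit-inj : Inj (κ ∘ unit)
      κunit-inj i l eq = punchIn-injective _ _ _ (to-inj e _ _ (hom-inj _ _ eq))

    subfield-unit⇒root : ∀ {x} → x ≢ F.0# → κ x ^ m ≡ 1#
    subfield-unit⇒root x≢0 with unit-surj x≢0
    ... | i , refl = R.subgroup⇒root (κ ∘ unit) (nonzero-hom ∘ unit≢0) κunit-inj closed i

    -- The `m` units of the subfield already exhaust the `m`-th roots of unity.
    root⇒∈subfield : ∀ {y} → y ^ m ≡ 1# → ∃[ x ] κ x ≡ y
    root⇒∈subfield yᵐ = let i , eq = R.root⇒subgroup (κ ∘ unit) (nonzero-hom ∘ unit≢0) κunit-inj closed yᵐ
                        in unit i , eq

-- Distances and the type of the flag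

sumℕ : ∀ {r} → (Fin r → ℕ) → ℕ
sumℕ {zero}  f = 0
sumℕ {suc r} f = f Fin.zero ℕ.+ sumℕ (f ∘ Fin.suc)

sumℕ-mono-≤ : ∀ {r} {f g : Fin r → ℕ} → (∀ i → f i ≤ g i) → sumℕ f ≤ sumℕ g
sumℕ-mono-≤ {zero}  f≤g = z≤n
sumℕ-mono-≤ {suc r} f≤g = ℕ.+-mono-≤ (f≤g Fin.zero) (sumℕ-mono-≤ (f≤g ∘ Fin.suc))

sumℕ-cong : ∀ {r} {f g : Fin r → ℕ} → (∀ i → f i ≡ g i) → sumℕ f ≡ sumℕ g
sumℕ-cong eq = ℕ.≤-antisym (sumℕ-mono-≤ (ℕ.≤-reflexive ∘ eq)) (sumℕ-mono-≤ (ℕ.≤-reflexive ∘ sym ∘ eq))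

sumℕ-mono-< : ∀ {r} {f g : Fin r → ℕ} → (∀ i → f i ≤ g i) → ∀ i → f i < g i → sumℕ f < sumℕ g
sumℕ-mono-< f≤g Fin.zero    f<g = ℕ.+-mono-<-≤ f<g (sumℕ-mono-≤ (f≤g ∘ Fin.suc))
sumℕ-mono-< f≤g (Fin.suc i) f<g = ℕ.+-mono-≤-< (f≤g Fin.zero) (sumℕ-mono-< (f≤g ∘ Fin.suc) i f<g)

-- This is min(t, N - t) when t ≤ N, half the largest distance between `t`-dimensional subspaces;
-- `maxFlagDist` adds these up.
maxDim : ℕ → ℕ → ℕ
maxDim N t = if does (2 ℕ.* t ℕ.≤? N) then t else N ∸ t

maxDim-≤ : ∀ {N t} → 2 ℕ.* t ≤ N → maxDim N t ≡ t
maxDim-≤ {N} {t} le = cong (if_then t else N ∸ t) (dec-true (2 ℕ.* t ℕ.≤? N) le)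

maxDim-≰ : ∀ {N t} → ¬ 2 ℕ.* t ≤ N → maxDim N t ≡ N ∸ t
maxDim-≰ {N} {t} nle = cong (if_then t else N ∸ t) (dec-false (2 ℕ.* t ℕ.≤? N) nle)

2*≡+ : ∀ t → 2 ℕ.* t ≡ t ℕ.+ t
2*≡+ t = cong (t ℕ.+_) (ℕ.+-identityʳ t)

-- In the boundary case 2t = N the other branch is taken, but there t = N - t.
maxDim-≥ : ∀ {N t} → N ≤ 2 ℕ.* t → maxDim N t ≡ N ∸ t
maxDim-≥ {N} {t} ge with 2 ℕ.* t ℕ.≤? N
... | no nle = maxDim-≰ {N} {t} nle
... | yes le = trans (maxDim-≤ {N} {t} le) (sym (trans (cong (_∸ t) (trans (ℕ.≤-antisym ge le) (2*≡+ t))) (ℕ.m+n∸n≡m t t)))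

maxFlagDist≡sumℕ : ∀ N ty → maxFlagDist N ty ≡ sumℕ (λ i → 2 ℕ.* maxDim N (List.lookup ty i))
maxFlagDist≡sumℕ N []       = refl
maxFlagDist≡sumℕ N (t ∷ ty) = trans (ℕ.*-distribˡ-+ 2 (maxDim N t) _) (cong (2 ℕ.* maxDim N t ℕ.+_) (maxFlagDist≡sumℕ N ty))

-- `a` and `b` stand for the dimensions of the sum and the intersection of two `t`-dimensional
-- subspaces.
module _ {N t a b : ℕ} (formula : a ℕ.+ b ≡ t ℕ.+ t) where

  dist-trivial-∩ : 2 ℕ.* t ≤ N → b ≡ 0 → a ∸ b ≡ 2 ℕ.* maxDim N t
  dist-trivial-∩ 2t≤N refl = begin
    a                 ≡⟨ ℕ.+-identityʳ a ⟨
    a ℕ.+ 0           ≡⟨ formula ⟩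
    t ℕ.+ t           ≡⟨ 2*≡+ t ⟨
    2 ℕ.* t           ≡⟨ cong (2 ℕ.*_) (maxDim-≤ {N} {t} 2t≤N) ⟨
    2 ℕ.* maxDim N t  ∎
    where open ≡-Reasoning

  private
    codim : t ≤ N → t ℕ.+ (N ∸ t) ≡ N
    codim = ℕ.m+[n∸m]≡n

  -- With the codimension r = N - t the formula gives b + r = t, so N = 2r + b and the distance is
  -- 2r.
  dist-full-⊞ : t ≤ N → N ≤ 2 ℕ.* t → a ≡ N → a ∸ b ≡ 2 ℕ.* maxDim N t
  dist-full-⊞ t≤N N≤2t refl = trans (cong (_∸ b) a≡) (trans (ℕ.m+n∸n≡m (2 ℕ.* (a ∸ t)) b) (cong (2 ℕ.*_) (sym (maxDim-≥ {N} {t} N≤2t))))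
    where
    open ≡-Reasoning
    r = a ∸ t
    b+r≡t : b ℕ.+ r ≡ t
    b+r≡t = ℕ.+-cancelˡ-≡ t _ _ (begin
      t ℕ.+ (b ℕ.+ r)   ≡⟨ cong (t ℕ.+_) (ℕ.+-comm b r) ⟩
      t ℕ.+ (r ℕ.+ b)   ≡⟨ ℕ.+-assoc t r b ⟨
      t ℕ.+ r ℕ.+ b     ≡⟨ cong (ℕ._+ b) (codim t≤N) ⟩
      a ℕ.+ b           ≡⟨ formula ⟩
      t ℕ.+ t           ∎)
    a≡ : a ≡ 2 ℕ.* r ℕ.+ b
    a≡ = begin
      a                   ≡⟨ codim t≤N ⟨
      t ℕ.+ r             ≡⟨ cong (ℕ._+ r) b+r≡t ⟨
      b ℕ.+ r ℕ.+ r       ≡⟨ ℕ.+-assoc b r r ⟩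
      b ℕ.+ (r ℕ.+ r)     ≡⟨ ℕ.+-comm b _ ⟩
      r ℕ.+ r ℕ.+ b       ≡⟨ cong (ℕ._+ b) (2*≡+ r) ⟨
      2 ℕ.* r ℕ.+ b       ∎

  -- The distance a - b is at most a + b = 2t, and it is 2a - 2t ≤ 2(N - t); the second bound is
  -- derived as a + a ≤ a + b + 2(N - t) to avoid subtraction.
  dist≤max : t ≤ N → a ≤ N → a ∸ b ≤ 2 ℕ.* maxDim N t
  dist≤max t≤N a≤N with 2 ℕ.* t ℕ.≤? N
  ... | yes 2t≤N = begin
    a ∸ b             ≤⟨ ℕ.m∸n≤m a b ⟩
    a                 ≤⟨ ℕ.m≤m+n a b ⟩
    a ℕ.+ b           ≡⟨ trans formula (sym (2*≡+ t)) ⟩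
    2 ℕ.* t           ≡⟨ cong (2 ℕ.*_) (maxDim-≤ {N} {t} 2t≤N) ⟨
    2 ℕ.* maxDim N t  ∎
    where open ℕ.≤-Reasoning
  ... | no 2t≰N = subst (λ x → a ∸ b ≤ 2 ℕ.* x) (sym (maxDim-≰ {N} {t} 2t≰N)) (ℕ.m≤n+o⇒m∸n≤o a b (ℕ.+-cancelˡ-≤ a _ _ (begin
    a ℕ.+ a                           ≤⟨ ℕ.+-mono-≤ a≤N a≤N ⟩
    N ℕ.+ N                           ≡⟨ 2*≡+ N ⟨
    2 ℕ.* N                           ≡⟨ cong (2 ℕ.*_) (codim t≤N) ⟨
    2 ℕ.* (t ℕ.+ (N ∸ t))             ≡⟨ ℕ.*-distribˡ-+ 2 t (N ∸ t) ⟩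
    2 ℕ.* t ℕ.+ 2 ℕ.* (N ∸ t)         ≡⟨ cong (ℕ._+ 2 ℕ.* (N ∸ t)) (trans (2*≡+ t) (sym formula)) ⟩
    a ℕ.+ b ℕ.+ 2 ℕ.* (N ∸ t)         ≡⟨ ℕ.+-assoc a b _ ⟩
    a ℕ.+ (b ℕ.+ 2 ℕ.* (N ∸ t))       ∎)))
    where open ℕ.≤-Reasoning

module FlagDistance (F : FiniteField) where
  open LinAlg F

  -- The sum inside DistF is local to a where-clause and has no name; unification with the type of
  -- DistF⇒distSum solves for it.
  mutual
    distSum : ∀ {N ty} (𝓕 𝓖 : Flag N ty) (d : ℕ) {r : ℕ} → (Fin r → ℕ) → ℕ
    distSum 𝓕 𝓖 d = _

    DistF⇒distSum : ∀ {N ty} (𝓕 𝓖 : Flag N ty) d (dist : DistF 𝓕 𝓖 d) → d ≡ distSum 𝓕 𝓖 d (proj₁ dist)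
    DistF⇒distSum {ty = ty} 𝓕 𝓖 d dist with length ty | proj₁ dist | proj₂ (proj₂ dist)
    ... | _ | _ | eq = eq

  distSum≡sumℕ : ∀ {N ty} (𝓕 𝓖 : Flag N ty) d {r} (f : Fin r → ℕ) → distSum 𝓕 𝓖 d f ≡ sumℕ f
  distSum≡sumℕ 𝓕 𝓖 d {zero}  f = refl
  distSum≡sumℕ 𝓕 𝓖 d {suc r} f = cong (f Fin.zero ℕ.+_) (distSum≡sumℕ 𝓕 𝓖 d (f ∘ Fin.suc))

  DistF⇒sumℕ : ∀ {N ty} {𝓕 𝓖 : Flag N ty} {d} (dist : DistF 𝓕 𝓖 d) → d ≡ sumℕ (proj₁ dist)
  DistF⇒sumℕ {𝓕 = 𝓕} {𝓖} {d} dist = trans (DistF⇒distSum 𝓕 𝓖 d dist) (distSum≡sumℕ 𝓕 𝓖 d (proj₁ dist))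

  sumℕ-DistF : ∀ {N ty} (𝓕 𝓖 : Flag N ty) ds → (∀ i → DistS (𝓕 ⟨ i ⟩) (𝓖 ⟨ i ⟩) (ds i)) → DistF 𝓕 𝓖 (sumℕ ds)
  sumℕ-DistF 𝓕 𝓖 ds dist = ds , dist , sym (distSum≡sumℕ 𝓕 𝓖 (sumℕ ds) ds)

lookup-mono-< : ∀ {xs : List ℕ} → AllPairs _<_ xs → ∀ i j → toℕ i < toℕ j → List.lookup xs i < List.lookup xs j
lookup-mono-< (x< ∷ _) Fin.zero    (Fin.suc j) _         = All.lookup x< (∈-lookup j)
lookup-mono-< (_ ∷ xs) (Fin.suc i) (Fin.suc j) (s≤s i<j) = lookup-mono-< xs i j i<j

-- Flags are nested by index while the argument compares dimensions; an increasing type translates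
-- between the two.
lookup-cancel-≤ : ∀ {xs : List ℕ} → AllPairs _<_ xs → ∀ i j → List.lookup xs i ≤ List.lookup xs j → toℕ i ≤ toℕ j
lookup-cancel-≤ sorted i j le with toℕ i ℕ.≤? toℕ j
... | yes p = p
... | no ¬p = contradiction le (ℕ.<⇒≱ (lookup-mono-< sorted j i (ℕ.≰⇒> ¬p)))

∈⇒index : ∀ {t} {xs : List ℕ} → t ∈ xs → ∃[ i ] List.lookup xs i ≡ t
∈⇒index t∈ = Any.index t∈ , sym (lookup-index t∈)

module FlagType {k s : ℕ} (1≤k : 1 ≤ k) (2≤s : 2 ≤ s) where

  n : ℕ
  n = s ℕ.* k

  ty-high : List ℕ
  ty-high = filter (λ d → k ℕ.<? d) (List.map (λ j → (n ∸ k) ℕ.+ j) (upTo k))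

  2k≤n : 2 ℕ.* k ≤ n
  2k≤n = ℕ.*-monoˡ-≤ k 2≤s

  k≤n : k ≤ n
  k≤n = ℕ.≤-trans (ℕ.m≤m+n k _) 2k≤n

  k≤n∸k : k ≤ n ∸ k
  k≤n∸k = ℕ.m+n≤o⇒m≤o∸n k (subst (_≤ n) (2*≡+ k) 2k≤n)

  n∸k+k≡n : n ∸ k ℕ.+ k ≡ n
  n∸k+k≡n = ℕ.m∸n+n≡m k≤n

  n≤2* : ∀ {t} → n ∸ k ≤ t → n ≤ 2 ℕ.* t
  n≤2* {t} le = subst₂ _≤_ n∸k+k≡n (sym (2*≡+ t)) (ℕ.+-mono-≤ le (ℕ.≤-trans k≤n∸k le))

  low-bounds : All (λ t → 1 ≤ t × t ≤ k) (applyUpTo suc k)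
  low-bounds = All.applyUpTo⁺₁ suc k (λ i<k → s≤s z≤n , i<k)

  high-bounds : All (λ t → k < t × n ∸ k ≤ t × t < n) ty-high
  high-bounds = All.zipWith (λ (p , q) → p , q) (All.all-filter (λ d → k ℕ.<? d) (List.map (λ j → (n ∸ k) ℕ.+ j) (upTo k)) ,
    All.filter⁺ (λ d → k ℕ.<? d) (All.map⁺ (All.applyUpTo⁺₁ (λ j → j) k (λ {j} j<k →
      ℕ.m≤m+n (n ∸ k) j , subst (n ∸ k ℕ.+ j <_) n∸k+k≡n (ℕ.+-monoʳ-< (n ∸ k) j<k)))))

  -- Decides for each component whether it is treated through its intersection or through its sum.
  flagType-bounds : All (λ t → (1 ≤ t × t ≤ k) ⊎ (n ∸ k ≤ t × t < n)) (flagType k s)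
  flagType-bounds = All.++⁺ (All.map inj₁ low-bounds) (All.map (inj₂ ∘ proj₂) high-bounds)

  flagType-sorted : AllPairs _<_ (flagType k s)
  flagType-sorted = AllPairs.++⁺ (AllPairs.applyUpTo⁺₁ suc k (λ i<j _ → s≤s i<j))
    (AllPairs.filter⁺ (λ d → k ℕ.<? d) (AllPairs.map⁺ (AllPairs.applyUpTo⁺₁ (λ j → j) k (λ i<j _ → ℕ.+-monoʳ-< (n ∸ k) i<j))))
    (All.map (λ (_ , t≤k) → All.map (λ (k<t′ , _) → ℕ.≤-<-trans t≤k k<t′) high-bounds) low-bounds)

  1∈flagType : 1 ∈ flagType k s
  1∈flagType = ∈-++⁺ˡ (∈-applyUpTo⁺ suc 1≤k)

  k∈flagType : k ∈ flagType k s
  k∈flagType = ∈-++⁺ˡ (subst (_∈ applyUpTo suc k) (ℕ.suc-pred k {{ℕ.>-nonZero 1≤k}})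
    (∈-applyUpTo⁺ suc (ℕ.≤-reflexive (ℕ.suc-pred k {{ℕ.>-nonZero 1≤k}}))))

  -- When n - k = k the filter removes it from the upper half, and it is found as the last entry of
  -- the lower half.
  n∸k∈flagType : n ∸ k ∈ flagType k s
  n∸k∈flagType with ℕ.m≤n⇒m<n∨m≡n k≤n∸k
  ... | inj₁ k<n∸k = ∈-++⁺ʳ (applyUpTo suc k) (∈-filter⁺ (λ d → k ℕ.<? d)
          (subst (_∈ List.map (λ j → (n ∸ k) ℕ.+ j) (upTo k)) (ℕ.+-identityʳ (n ∸ k)) (∈-map⁺ (λ j → (n ∸ k) ℕ.+ j) (∈-upTo⁺ 1≤k))) k<n∸k)
  ... | inj₂ k≡n∸k = subst (_∈ flagType k s) k≡n∸k k∈flagType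

-- Multiplication in the extension field on subspaces

module Multiplication {q k s : ℕ} (σ : Setting q k s) where
  open Setting σ
  open FieldReduction σ
  private
    module F = FieldTheory F
    module K = FieldTheory K
    module L = FieldTheory L
    module jH = HomTheory j-hom
    module κH = HomTheory κ-hom
  open LinAlg F hiding (Σ[_]; _^_)
  open SubspaceTheory F
  open Vector
  open ≡-Reasoning

  θ⁻¹ : Car L → Vector n
  θ⁻¹ x = proj₁ (θ-surj x)

  θ∘θ⁻¹ : ∀ x → θ (θ⁻¹ x) ≡ x
  θ∘θ⁻¹ x = proj₂ (θ-surj x)

  θ-zeroV : θ zeroV ≡ L.0#
  θ-zeroV = ev-zeroV β

  θ-+ : ∀ v w → θ (v +ᵥ w) ≡ θ v L.+ θ w
  θ-+ = ev-+ β

  θ-• : ∀ a v → θ (a • v) ≡ κ a L.* θ v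
  θ-• = ev-• β

  θ≡0⇒≡0 : ∀ {v} → θ v ≡ L.0# → v ≡ zeroV
  θ≡0⇒≡0 eq = θ-inj _ _ (trans eq (sym θ-zeroV))

  -- The scalar can be read off from the image of the vector that represents 1.
  Acts-scalar-unique : ∀ {A x y} → Acts β A x → Acts β A y → x ≡ y
  Acts-scalar-unique {A} {x} {y} actx acty = begin
    x                       ≡⟨ value x actx ⟨
    θ (θ⁻¹ L.1# *ᵥ A)       ≡⟨ value y acty ⟩
    y                       ∎
    where
    value : ∀ z → Acts β A z → θ (θ⁻¹ L.1# *ᵥ A) ≡ z
    value z act = trans (Acts-*ᵥ β {A} act (θ⁻¹ L.1#)) (trans (cong (z L.*_) (θ∘θ⁻¹ L.1#)) (L.*-identityʳ z))

  infixl 7 _⋆_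
  -- Multiplication of a subspace by a field element, pulled back along `θ`; orbits are studied in
  -- these terms, without matrices.
  _⋆_ : Sub n → Car L → Sub n
  (W ⋆ x) v = ∃[ w ] (W w × θ v ≡ x L.* θ w)

  ·≐⋆ : ∀ {A x} W → Acts β A x → (W · A) ≐ (W ⋆ x)
  ·≐⋆ {A} W act = (λ { _ (w , Ww , refl) → w , Ww , Acts-*ᵥ β {A} act w })
                , (λ v (w , Ww , eq) → w , Ww , θ-inj _ _ (trans eq (sym (Acts-*ᵥ β {A} act w))))

  ⋆-mono : ∀ {U V x} → U ⊆ V → (U ⋆ x) ⊆ (V ⋆ x)
  ⋆-mono U⊆V v (w , Uw , eq) = w , U⊆V w Uw , eq

  ⋆-isSubspace : ∀ {W} x → IsSubspace W → IsSubspace (W ⋆ x)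
  ⋆-isSubspace x (W0 , W+ , W•) =
      (zeroV , W0 , trans θ-zeroV (trans (sym (L.zeroʳ x)) (cong (x L.*_) (sym θ-zeroV))))
    , (λ v v′ (w , Ww , eq) (w′ , Ww′ , eq′) → w +ᵥ w′ , W+ _ _ Ww Ww′ , (begin
        θ (v +ᵥ v′)                  ≡⟨ θ-+ v v′ ⟩
        θ v L.+ θ v′                 ≡⟨ cong₂ L._+_ eq eq′ ⟩
        x L.* θ w L.+ x L.* θ w′     ≡⟨ L.distribˡ x _ _ ⟨
        x L.* (θ w L.+ θ w′)         ≡⟨ cong (x L.*_) (θ-+ w w′) ⟨
        x L.* θ (w +ᵥ w′)            ∎))
    , (λ a v (w , Ww , eq) → a • w , W• a _ Ww , (begin
        θ (a • v)                    ≡⟨ θ-• a v ⟩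
        κ a L.* θ v                  ≡⟨ cong (κ a L.*_) eq ⟩
        κ a L.* (x L.* θ w)          ≡⟨ L.x∙yz≈y∙xz _ _ _ ⟩
        x L.* (κ a L.* θ w)          ≡⟨ cong (x L.*_) (θ-• a w) ⟨
        x L.* θ (a • w)              ∎))

  ⋆-Dim : ∀ {W d x} → x ≢ L.0# → Dim W d → Dim (W ⋆ x) d
  ⋆-Dim {W} {d} {x} x≢0 (b , Wb , ind , span) = xb , (λ i → b i , Wb i , θ∘θ⁻¹ _)
    , (λ c eq → ind c (θ≡0⇒≡0 (L.x*y≡0⇒y≡0 x≢0 (trans (sym (scale c)) (trans (cong θ eq) θ-zeroV)))))
    , (λ { v (w , Ww , eq) → let c , w≡ = span w Ww in
           c , θ-inj _ _ (trans eq (trans (cong (λ w → x L.* θ w) w≡) (sym (scale c)))) })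
    where
    xb : Fin d → Vector n
    xb i = θ⁻¹ (x L.* θ (b i))
    scale : ∀ c → θ (lincomb c xb) ≡ x L.* θ (lincomb c b)
    scale c = begin
      θ (lincomb c xb)                                ≡⟨ ev-lincomb β c xb ⟩
      L.Σ[ (λ i → κ (c i) L.* θ (xb i)) ]             ≡⟨ L.Σ-cong (λ i → trans (cong (κ (c i) L.*_) (θ∘θ⁻¹ _)) (L.x∙yz≈y∙xz (κ (c i)) x _)) ⟩
      L.Σ[ (λ i → x L.* (κ (c i) L.* θ (b i))) ]      ≡⟨ L.*-Σ x (λ i → κ (c i) L.* θ (b i)) ⟨
      x L.* L.Σ[ (λ i → κ (c i) L.* θ (b i)) ]        ≡⟨ cong (x L.*_) (ev-lincomb β c b) ⟨
      x L.* θ (lincomb c b)                           ∎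

  module _ {E : FiniteField} (e : Car E → Car L) where

    -- For nonzero `x` this is equality modulo the units of the subfield `E`.
    Proportional : Car L → Car L → Set
    Proportional x y = ∃[ c ] x ≡ e c L.* y

    Proportional-sym : IsFieldHom E L e → ∀ {x y} → x ≢ L.0# → Proportional x y → Proportional y x
    Proportional-sym hom {x} {y} x≢0 (c , x≡) =
      let c⁻¹ , cc⁻¹ = FiniteField.inverse E c c≢0 in c⁻¹ , (begin
        y                            ≡⟨ L.*-identityˡ y ⟨
        L.1# L.* y                   ≡⟨ cong (L._* y) eH.1-hom ⟨
        e (FiniteField.1# E) L.* y   ≡⟨ cong (λ z → e z L.* y) cc⁻¹ ⟨
        e (FiniteField._*_ E c c⁻¹) L.* y   ≡⟨ cong (L._* y) (eH.*-hom c c⁻¹) ⟩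
        e c L.* e c⁻¹ L.* y          ≡⟨ L.xy∙z≈xz∙y (e c) (e c⁻¹) y ⟩
        e c L.* y L.* e c⁻¹          ≡⟨ cong (L._* e c⁻¹) x≡ ⟨
        x L.* e c⁻¹                  ≡⟨ L.*-comm _ _ ⟩
        e c⁻¹ L.* x                  ∎)
      where
      module eH = HomTheory hom
      c≢0 : c ≢ FiniteField.0# E
      c≢0 refl = x≢0 (trans x≡ (trans (cong (L._* y) eH.0-hom) (L.zeroˡ y)))

  F-proportional⇒⋆⊆ : ∀ {W x y} → IsSubspace W → Proportional {F} κ x y → (W ⋆ x) ⊆ (W ⋆ y)
  F-proportional⇒⋆⊆ {x = x} {y} (_ , _ , W•) (c , x≡) v (w , Ww , eq) = c • w , W• c w Ww , (begin
    θ v                    ≡⟨ eq ⟩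
    x L.* θ w              ≡⟨ cong (L._* θ w) x≡ ⟩
    κ c L.* y L.* θ w      ≡⟨ cong (L._* θ w) (L.*-comm (κ c) y) ⟩
    y L.* κ c L.* θ w      ≡⟨ L.*-assoc y _ _ ⟩
    y L.* (κ c L.* θ w)    ≡⟨ cong (y L.*_) (θ-• c w) ⟨
    y L.* θ (c • w)        ∎)

  -- If u spans the line, then x u = c y u for some c in F_q, and the nonzero u cancels.
  line-⋆⊆⇒F-proportional : ∀ {W x y} → Dim W 1 → (W ⋆ x) ⊆ (W ⋆ y) → Proportional {F} κ x y
  line-⋆⊆⇒F-proportional {W} {x} {y} (b , Wb , ind , span) x⊆y
    with x⊆y (θ⁻¹ (x L.* θ u)) (u , Wb Fin.zero , θ∘θ⁻¹ _)
    where
    u = b Fin.zero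
  ... | w , Ww , eq with span w Ww
  ... | c , w≡ = c Fin.zero , L.*-cancelʳ (θ u) θu≢0 (begin
    x L.* θ u                      ≡⟨ θ∘θ⁻¹ _ ⟨
    θ (θ⁻¹ (x L.* θ u))            ≡⟨ eq ⟩
    y L.* θ w                      ≡⟨ cong (y L.*_) (trans (cong θ (trans w≡ (+ᵥ-identityʳ _))) (θ-• (c Fin.zero) u)) ⟩
    y L.* (κ (c Fin.zero) L.* θ u) ≡⟨ L.*-assoc y _ _ ⟨
    y L.* κ (c Fin.zero) L.* θ u   ≡⟨ cong (L._* θ u) (L.*-comm y _) ⟩
    κ (c Fin.zero) L.* y L.* θ u   ∎)
    where
    u = b Fin.zero
    θu≢0 : θ u ≢ L.0#
    θu≢0 θu≡0 = F.1≢0 (ind (λ _ → F.1#) (θ-inj _ _ (begin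
      θ (lincomb (λ _ → F.1#) b)    ≡⟨ cong θ (+ᵥ-identityʳ (F.1# • u)) ⟩
      θ (F.1# • u)                  ≡⟨ θ-• F.1# u ⟩
      κ F.1# L.* θ u                ≡⟨ cong (κ F.1# L.*_) θu≡0 ⟩
      κ F.1# L.* L.0#               ≡⟨ L.zeroʳ _ ⟩
      L.0#                          ≡⟨ θ-zeroV ⟨
      θ zeroV                       ∎)) Fin.zero)

  -- Lines over F_{q^k}

  IsKLine : Sub n → Set
  IsKLine W = ∃[ a ] ((∀ v → W v → ∃[ c ] θ v ≡ j c L.* a) × (∀ v c → θ v ≡ j c L.* a → W v))

  InS⇒IsKLine : ∀ {W} → InS W → IsKLine W
  InS⇒IsKLine {W} (A , _ , W⊆ , ⊆W) = row A Fin.zero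
    , (λ v Wv → let c , eq = φSub⇒row-combination A v (W⊆ v Wv) in c Fin.zero , trans eq (L.+-identityʳ _))
    , (λ v c eq → let v′ , v′∈ , eq′ = row-combination⇒φSub A (λ _ → c) in
        ⊆W v (subst (φSub A) (θ-inj v′ v (trans eq′ (trans (L.+-identityʳ _) (sym eq)))) v′∈))

  K-proportional⇒⋆⊆ : ∀ {W x y} → IsKLine W → Proportional {K} j x y → (W ⋆ x) ⊆ (W ⋆ y)
  K-proportional⇒⋆⊆ {W} {x} {y} (a , W⇒ , ⇒W) (c , x≡) v (w , Ww , eq) =
    let c′ , w≡ = W⇒ w Ww in θ⁻¹ (j (c K.* c′) L.* a) , ⇒W _ (c K.* c′) (θ∘θ⁻¹ _) , (begin
      θ v                                ≡⟨ eq ⟩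
      x L.* θ w                          ≡⟨ cong₂ L._*_ (trans x≡ (L.*-comm _ _)) w≡ ⟩
      y L.* j c L.* (j c′ L.* a)         ≡⟨ L.*-assoc y _ _ ⟩
      y L.* (j c L.* (j c′ L.* a))       ≡⟨ cong (y L.*_) (L.*-assoc _ _ _) ⟨
      y L.* (j c L.* j c′ L.* a)         ≡⟨ cong (λ z → y L.* (z L.* a)) (jH.*-hom c c′) ⟨
      y L.* (j (c K.* c′) L.* a)         ≡⟨ cong (y L.*_) (θ∘θ⁻¹ _) ⟨
      y L.* θ (θ⁻¹ (j (c K.* c′) L.* a)) ∎)

  -- A common vector is x c₁ a = y c₂ a, so c₂ y = c₁ x. As the vector is nonzero, so is c₂ y, and
  -- symmetry of proportionality solves for `x`.
  KLine-⋆-meet⇒K-proportional : ∀ {W x y v} → IsKLine W → v ≢ zeroV →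
                                (W ⋆ x) v → (W ⋆ y) v → Proportional {K} j x y
  KLine-⋆-meet⇒K-proportional {W} {x} {y} {v} (a , W⇒ , _) v≢0 (w₁ , Ww₁ , eq₁) (w₂ , Ww₂ , eq₂)
    with W⇒ w₁ Ww₁ | W⇒ w₂ Ww₂
  ... | c₁ , w₁≡ | c₂ , w₂≡ = Proportional-sym {K} j j-hom y′≢0
          (c₁ , L.*-cancelʳ a a≢0 (begin
             j c₂ L.* y L.* a     ≡⟨ L.xy∙z≈xz∙y _ _ _ ⟩
             j c₂ L.* a L.* y     ≡⟨ L.*-comm _ _ ⟩
             y L.* (j c₂ L.* a)   ≡⟨ trans eq₂ (cong (y L.*_) w₂≡) ⟨
             θ v                  ≡⟨ trans eq₁ (cong (x L.*_) w₁≡) ⟩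
             x L.* (j c₁ L.* a)   ≡⟨ L.*-comm _ _ ⟩
             j c₁ L.* a L.* x     ≡⟨ L.xy∙z≈xz∙y _ _ _ ⟩
             j c₁ L.* x L.* a     ∎)) |> λ (d , eq) → d K.* c₂ , (begin
               x                          ≡⟨ eq ⟩
               j d L.* (j c₂ L.* y)       ≡⟨ L.*-assoc _ _ _ ⟨
               j d L.* j c₂ L.* y         ≡⟨ cong (L._* y) (jH.*-hom d c₂) ⟨
               j (d K.* c₂) L.* y         ∎)
    where
    θv≢0 : θ v ≢ L.0#
    θv≢0 = v≢0 ∘ θ≡0⇒≡0
    a≢0 : a ≢ L.0#
    a≢0 refl = θv≢0 (trans eq₁ (trans (cong (x L.*_) (trans w₁≡ (L.zeroʳ _))) (L.zeroʳ x)))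
    y′≢0 : j c₂ L.* y ≢ L.0#
    y′≢0 eq = θv≢0 (begin
      θ v                 ≡⟨ trans eq₂ (cong (y L.*_) w₂≡) ⟩
      y L.* (j c₂ L.* a)  ≡⟨ L.x∙yz≈y∙xz _ _ _ ⟩
      j c₂ L.* (y L.* a)  ≡⟨ L.*-assoc _ _ _ ⟨
      j c₂ L.* y L.* a    ≡⟨ cong (L._* a) eq ⟩
      L.0# L.* a          ≡⟨ L.zeroˡ a ⟩
      L.0#                ∎)

  -- Hyperplanes over F_{q^k}, as (n-k)-dimensional subspaces closed under F_{q^k}

  IsKClosed : Sub n → Set
  IsKClosed W = ∀ c v → W v → W (θ⁻¹ (j c L.* θ v))

  InH⇒IsKClosed : ∀ {W} → InH W → IsKClosed W
  InH⇒IsKClosed {W} (A , _ , W⊆ , ⊆W) c v Wv =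
    let c′ , eq = φSub⇒row-combination A v (W⊆ v Wv)
        v′ , v′∈ , eq′ = row-combination⇒φSub A (λ a → c K.* c′ a)
    in ⊆W _ (subst (φSub A) (θ-inj _ _ (begin
      θ v′                                                ≡⟨ eq′ ⟩
      L.Σ[ (λ a → j (c K.* c′ a) L.* row A a) ]           ≡⟨ L.Σ-cong (λ a → trans (cong (L._* row A a) (jH.*-hom c (c′ a))) (L.*-assoc _ _ _)) ⟩
      L.Σ[ (λ a → j c L.* (j (c′ a) L.* row A a)) ]       ≡⟨ L.*-Σ (j c) (λ a → j (c′ a) L.* row A a) ⟨
      j c L.* L.Σ[ (λ a → j (c′ a) L.* row A a) ]         ≡⟨ cong (j c L.*_) eq ⟨
      j c L.* θ v                                         ≡⟨ θ∘θ⁻¹ _ ⟨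
      θ (θ⁻¹ (j c L.* θ v))                               ∎)) v′∈)

  ⋆-isKClosed : ∀ {W} x → IsKClosed W → IsKClosed (W ⋆ x)
  ⋆-isKClosed x Wj c v (w , Ww , eq) = θ⁻¹ (j c L.* θ w) , Wj c w Ww , (begin
    θ (θ⁻¹ (j c L.* θ v))        ≡⟨ θ∘θ⁻¹ _ ⟩
    j c L.* θ v                  ≡⟨ cong (j c L.*_) eq ⟩
    j c L.* (x L.* θ w)          ≡⟨ L.x∙yz≈y∙xz _ _ _ ⟩
    x L.* (j c L.* θ w)          ≡⟨ cong (x L.*_) (θ∘θ⁻¹ _) ⟨
    x L.* θ (θ⁻¹ (j c L.* θ w))  ∎)

  module Hyperplane (k≤n : k ≤ n) {W : Sub n} (sW : IsSubspace W) (dW : Dim W (n ∸ k)) (Wj : IsKClosed W) where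
    private
      module B = Basis sW dW

    -- Counting: (w , c) ↦ θ w + j c θ v₀ is an injection W × K → L between sets of q^(n-k) q^k = q^n elements.
    decompose : ∀ {v₀} → ¬ W v₀ → ∀ y → ∃[ w ] ∃[ c ] (W w × y ≡ θ w L.+ j c L.* θ v₀)
    decompose {v₀} v₀∉ y =
      let (e , c) , eq = inj⇒surj (×↔ (Vector↔ (n ∸ k)) K.enumeration) L.enumeration size≤ f f-inj y
      in B.vec e , c , B.vec-∈ e , sym eq
      where
      size≤ : size L ≤ size F ℕ.^ (n ∸ k) ℕ.* size K
      size≤ = ℕ.≤-reflexive (begin
        size L                               ≡⟨ L-size ⟩
        q ℕ.^ n                              ≡⟨ cong (q ℕ.^_) (ℕ.m∸n+n≡m k≤n) ⟨
        q ℕ.^ (n ∸ k ℕ.+ k)                  ≡⟨ ℕ.^-distribˡ-+-* q (n ∸ k) k ⟩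
        q ℕ.^ (n ∸ k) ℕ.* q ℕ.^ k            ≡⟨ cong₂ (λ a b → a ℕ.^ (n ∸ k) ℕ.* b) F-size K-size ⟨
        size F ℕ.^ (n ∸ k) ℕ.* size K        ∎)
      f : Vector (n ∸ k) × Car K → Car L
      f (e , c) = θ (B.vec e) L.+ j c L.* θ v₀
      f-inj : Inj f
      f-inj (e , c) (e′ , c′) eq with (c K.+ K.- c′) K.≟ K.0#
      ... | yes c-c′≡0 with refl ← K.x∙y⁻¹≈ε⇒x≈y c c′ c-c′≡0 =
              cong (_, c) (B.vec-inj e e′ (θ-inj _ _ (L.+-cancelʳ (j c L.* θ v₀) _ _ eq)))
      -- Two representations with c ≠ c′ make (c - c′) v₀ an element of `W`; multiplying by the
      -- inverse of c - c′ would bring v₀ into `W`.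
      ... | no c≢c′ with d , cd ← K.inverse _ c≢c′ =
              contradiction (subst W (θ-inj _ _ (trans (θ∘θ⁻¹ _) v₀≡)) (Wj d w w∈)) v₀∉
        where
        w : Vector n
        w = B.vec e′ +ᵥ (-ᵥ B.vec e)
        w∈ : W w
        w∈ = proj₁ (proj₂ sW) _ _ (B.vec-∈ e′) (-ᵥ-∈ sW (B.vec-∈ e))
        w≡ : (j (c K.+ K.- c′)) L.* θ v₀ ≡ θ w
        w≡ = L.+-cancelʳ (θ (B.vec e) L.+ j c′ L.* θ v₀) _ _ (begin
          j (c K.+ K.- c′) L.* θ v₀ L.+ (θ (B.vec e) L.+ j c′ L.* θ v₀)   ≡⟨ cong (j (c K.+ K.- c′) L.* θ v₀ L.+_) (L.+-comm _ _) ⟩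
          j (c K.+ K.- c′) L.* θ v₀ L.+ (j c′ L.* θ v₀ L.+ θ (B.vec e))   ≡⟨ L.+-assoc _ _ _ ⟨
          j (c K.+ K.- c′) L.* θ v₀ L.+ j c′ L.* θ v₀ L.+ θ (B.vec e)     ≡⟨ cong (L._+ θ (B.vec e)) (L.distribʳ _ _ _) ⟨
          (j (c K.+ K.- c′) L.+ j c′) L.* θ v₀ L.+ θ (B.vec e)            ≡⟨ cong (λ z → z L.* θ v₀ L.+ θ (B.vec e)) (trans (sym (jH.+-hom _ _)) (cong j c-c′+c′)) ⟩
          j c L.* θ v₀ L.+ θ (B.vec e)                                    ≡⟨ L.+-comm _ _ ⟩
          θ (B.vec e) L.+ j c L.* θ v₀                                    ≡⟨ eq ⟩
          θ (B.vec e′) L.+ j c′ L.* θ v₀                                  ≡⟨ cong (λ v → θ v L.+ j c′ L.* θ v₀) e′≡ ⟩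
          θ (w +ᵥ B.vec e) L.+ j c′ L.* θ v₀                              ≡⟨ cong (L._+ j c′ L.* θ v₀) (θ-+ w (B.vec e)) ⟩
          θ w L.+ θ (B.vec e) L.+ j c′ L.* θ v₀                           ≡⟨ L.+-assoc _ _ _ ⟩
          θ w L.+ (θ (B.vec e) L.+ j c′ L.* θ v₀)                         ∎)
          where
          c-c′+c′ : c K.+ K.- c′ K.+ c′ ≡ c
          c-c′+c′ = trans (K.+-assoc _ _ _) (trans (cong (c K.+_) (K.-‿inverseˡ c′)) (K.+-identityʳ c))
          e′≡ : B.vec e′ ≡ w +ᵥ B.vec e
          e′≡ = sym (trans (+ᵥ-assoc _ _ _) (trans (cong (B.vec e′ +ᵥ_) (-ᵥ-inverseˡ _)) (+ᵥ-identityʳ _)))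
        v₀≡ : j d L.* θ w ≡ θ v₀
        v₀≡ = begin
          j d L.* θ w                                ≡⟨ cong (j d L.*_) w≡ ⟨
          j d L.* (j (c K.+ K.- c′) L.* θ v₀)        ≡⟨ L.*-assoc _ _ _ ⟨
          j d L.* j (c K.+ K.- c′) L.* θ v₀          ≡⟨ cong (L._* θ v₀) (jH.*-hom _ _) ⟨
          j (d K.* (c K.+ K.- c′)) L.* θ v₀          ≡⟨ cong (λ z → j z L.* θ v₀) (trans (K.*-comm _ _) cd) ⟩
          j K.1# L.* θ v₀                            ≡⟨ cong (L._* θ v₀) jH.1-hom ⟩
          L.1# L.* θ v₀                              ≡⟨ L.*-identityˡ _ ⟩
          θ v₀                                       ∎

    private
      θW : Car L → Set
      θW y = ∃[ w ] (W w × θ w ≡ y)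

      θW-+ : ∀ {y z} → θW y → θW z → θW (y L.+ z)
      θW-+ (w , Ww , refl) (w′ , Ww′ , refl) = w +ᵥ w′ , proj₁ (proj₂ sW) _ _ Ww Ww′ , θ-+ w w′

      θW-j : ∀ c {y} → θW y → θW (j c L.* y)
      θW-j c (w , Ww , refl) = _ , Wj c w Ww , θ∘θ⁻¹ _

    -- If z W ⊆ W and z v₀ = w₀ + λ v₀ with v₀ ∉ W, then (z - λ) L = (z - λ)(W + K v₀) ⊆ W, so z = λ ∈ K.
    stabilizer⊆K : n ∸ k < n → ∀ z → (∀ w → W w → ∃[ w′ ] (W w′ × θ w′ ≡ z L.* θ w)) → ∃[ c ] z ≡ j c
    stabilizer⊆K n∸k<n z zW with B.proper n∸k<n
    ... | v₀ , v₀∉ with decompose v₀∉ (z L.* θ v₀)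
    ... | w₀ , ℓ , Ww₀ , zv₀≡ with (z L.+ L.- j ℓ) L.≟ L.0#
    ... | yes eq = ℓ , L.x∙y⁻¹≈ε⇒x≈y _ _ eq
    ... | no δ≢0 with δ⁻¹ , δδ⁻¹ ← L.inverse _ δ≢0 = contradiction v₀∈ v₀∉
      where
      δ : Car L
      δ = z L.+ L.- j ℓ
      δ* : ∀ y → δ L.* y ≡ z L.* y L.+ j (K.- ℓ) L.* y
      δ* y = trans (L.distribʳ y z _) (cong (λ x → z L.* y L.+ x L.* y) (sym (jH.neg-hom ℓ)))
      δv₀ : δ L.* θ v₀ ≡ θ w₀
      δv₀ = L.+-cancelʳ (j ℓ L.* θ v₀) _ _ (begin
        δ L.* θ v₀ L.+ j ℓ L.* θ v₀        ≡⟨ L.distribʳ _ _ _ ⟨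
        (δ L.+ j ℓ) L.* θ v₀               ≡⟨ cong (L._* θ v₀) (trans (L.+-assoc _ _ _) (trans (cong (z L.+_) (L.-‿inverseˡ _)) (L.+-identityʳ z))) ⟩
        z L.* θ v₀                         ≡⟨ zv₀≡ ⟩
        θ w₀ L.+ j ℓ L.* θ v₀              ∎)
      δL⊆W : ∀ y → θW (δ L.* y)
      δL⊆W y with decompose v₀∉ y
      ... | w , c , Ww , refl = subst θW (begin
        z L.* θ w L.+ j (K.- ℓ) L.* θ w L.+ j c L.* θ w₀     ≡⟨ cong₂ L._+_ (sym (δ* (θ w))) (cong (j c L.*_) (sym δv₀)) ⟩
        δ L.* θ w L.+ j c L.* (δ L.* θ v₀)                   ≡⟨ cong (δ L.* θ w L.+_) (L.x∙yz≈y∙xz _ _ _) ⟩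
        δ L.* θ w L.+ δ L.* (j c L.* θ v₀)                   ≡⟨ L.distribˡ _ _ _ ⟨
        δ L.* (θ w L.+ j c L.* θ v₀)                         ∎)
        (θW-+ (θW-+ (zW w Ww) (θW-j (K.- ℓ) (w , Ww , refl))) (θW-j c (w₀ , Ww₀ , refl)))
      v₀∈ : W v₀
      v₀∈ with δL⊆W (δ⁻¹ L.* θ v₀)
      ... | w , Ww , eq = subst W (θ-inj _ _ (trans eq (trans (sym (L.*-assoc _ _ _)) (trans (cong (L._* θ v₀) δδ⁻¹) (L.*-identityˡ _))))) Ww

    -- The inclusion x W ⊆ y W says that y⁻¹ x maps `W` into itself.
    ⋆⊆⇒K-proportional : n ∸ k < n → ∀ {x y} → y ≢ L.0# → (W ⋆ x) ⊆ (W ⋆ y) → Proportional {K} j x y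
    ⋆⊆⇒K-proportional n∸k<n {x} {y} y≢0 x⊆y =
      let c , eq = stabilizer⊆K n∸k<n (y⁻¹ L.* x) stable in c , (begin
        x                      ≡⟨ cancel x ⟨
        y L.* (y⁻¹ L.* x)      ≡⟨ cong (y L.*_) eq ⟩
        y L.* j c              ≡⟨ L.*-comm _ _ ⟩
        j c L.* y              ∎)
      where
      y⁻¹ = proj₁ (L.inverse y y≢0)
      cancel : ∀ z → y L.* (y⁻¹ L.* z) ≡ z
      cancel z = trans (sym (L.*-assoc _ _ _)) (trans (cong (L._* z) (proj₂ (L.inverse y y≢0))) (L.*-identityˡ z))
      stable : ∀ w → W w → ∃[ w′ ] (W w′ × θ w′ ≡ y⁻¹ L.* x L.* θ w)
      stable w Ww = let w′ , Ww′ , eq = x⊆y (θ⁻¹ (x L.* θ w)) (w , Ww , θ∘θ⁻¹ _) in w′ , Ww′ , L.*-cancelˡ y y≢0 (begin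
        y L.* θ w′                     ≡⟨ eq ⟨
        θ (θ⁻¹ (x L.* θ w))            ≡⟨ θ∘θ⁻¹ _ ⟩
        x L.* θ w                      ≡⟨ cong (L._* θ w) (cancel x) ⟨
        y L.* (y⁻¹ L.* x) L.* θ w      ≡⟨ L.*-assoc _ _ _ ⟩
        y L.* (y⁻¹ L.* x L.* θ w)      ∎)

  -- Without proportionality x W is not contained in y W. Any u in x W outside y W gives F_{q^n} = y
  -- W + F_{q^k} u, and F_{q^k} u stays inside x W.
  hyperplane-⋆-⊞-full : k ≤ n → n ∸ k < n → ∀ {W} → IsSubspace W → Dim W (n ∸ k) → IsKClosed W →
                        ∀ {x y} → x ≢ L.0# → y ≢ L.0# → ¬ Proportional {K} j x y →
                        ∀ v → ((W ⋆ x) ⊞ (W ⋆ y)) v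
  hyperplane-⋆-⊞-full k≤n n∸k<n {W} sW dW Wj {x} {y} x≢0 y≢0 x≁y v
    with finite-∃? (Vector↔ n) (λ u → X.∈? u ×-dec ¬? (Y.∈? u))
    where
    module X = Basis (⋆-isSubspace x sW) (⋆-Dim x≢0 dW)
    module Y = Basis (⋆-isSubspace y sW) (⋆-Dim y≢0 dW)
  ... | no none = contradiction (Hyperplane.⋆⊆⇒K-proportional k≤n sW dW Wj n∸k<n y≢0
                    (λ u Xu → decidable-stable (Basis.∈? (⋆-isSubspace y sW) (⋆-Dim y≢0 dW) u) (λ u∉ → none (u , Xu , u∉)))) x≁y
  ... | yes (u , Xu , u∉Y) with Hyperplane.decompose k≤n (⋆-isSubspace y sW) (⋆-Dim y≢0 dW) (⋆-isKClosed y Wj) {u} u∉Y (θ v)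
  ... | w , c , Yw , eq = θ⁻¹ (j c L.* θ u) , w , ⋆-isKClosed x Wj c u Xu , Yw , θ-inj _ _ (begin
    θ v                                 ≡⟨ eq ⟩
    θ w L.+ j c L.* θ u                 ≡⟨ L.+-comm _ _ ⟩
    j c L.* θ u L.+ θ w                 ≡⟨ cong (L._+ θ w) (θ∘θ⁻¹ _) ⟨
    θ (θ⁻¹ (j c L.* θ u)) L.+ θ w       ≡⟨ θ-+ (θ⁻¹ (j c L.* θ u)) w ⟨
    θ (θ⁻¹ (j c L.* θ u) +ᵥ w)          ∎)

-- The orbit

divByGcd-*-gcd : ∀ t u .{{_ : NonZero t}} → divByGcd t u ℕ.* gcd t u ≡ t
divByGcd-*-gcd (suc t) u = m/n*n≡m {{ℕ.≢-nonZero (gcd[m,n]≢0 (suc t) u (inj₁ λ ()))}} (gcd[m,n]∣m (suc t) u)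

-- `t` divides d t and d u, hence d gcd(t, u); cancel the gcd.
∣*⇒divByGcd∣ : ∀ t u .{{_ : NonZero t}} d → t ∣ d ℕ.* u → divByGcd t u ∣ d
∣*⇒divByGcd∣ t@(suc _) u d t∣du = ∣.*-cancelʳ-∣ (gcd t u) {{ℕ.≢-nonZero (gcd[m,n]≢0 t u (inj₁ λ ()))}}
  (subst₂ _∣_ (sym (divByGcd-*-gcd t u)) (sym (c*gcd[m,n]≡gcd[cm,cn] d t u)) (gcd-greatest (∣.n∣m*n d) t∣du))

module Orbit {q k s : ℕ} (2≤s : 2 ≤ s) (σ : Setting q k s) where
  open Setting σ
  open FieldReduction σ
  open Multiplication σ
  private
    module F = FieldTheory F
    module K = FieldTheory K
    module L = FieldTheory L
    module κH = HomTheory κ-hom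
    module jH = HomTheory j-hom
  open LinAlg F hiding (Σ[_]; _^_)
  open SubspaceTheory F
  open FlagDistance F

  N : ℕ
  N = q ℕ.^ n ∸ 1

  2≤q : 2 ≤ q
  2≤q = subst (2 ≤_) F-size F.2≤size

  1≤k : 1 ≤ k
  1≤k with k ℕ.≟ 0
  ... | no  k≢0  = ℕ.n≢0⇒n>0 k≢0
  -- For k = 0 the field `K` would have q^0 = 1 element.
  ... | yes refl = contradiction (subst (2 ≤_) K-size K.2≤size) (λ { (s≤s ()) })

  open FlagType {k} {s} 1≤k 2≤s using (2k≤n; k≤n; n≤2*; flagType-bounds; flagType-sorted; 1∈flagType; k∈flagType; n∸k∈flagType; k≤n∸k)

  n∸k<n : n ∸ k < n
  n∸k<n = ℕ.∸-monoʳ-< 1≤k k≤n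

  instance
    q≢0 : NonZero q
    q≢0 = ℕ.>-nonZero (ℕ.≤-trans (s≤s z≤n) 2≤q)

  suc[^∸1] : ∀ m → q ℕ.^ m ≡ suc (q ℕ.^ m ∸ 1)
  suc[^∸1] m = sym (ℕ.suc-pred (q ℕ.^ m) {{ℕ.m^n≢0 q m}})

  suc[q∸1] : q ≡ suc (q ∸ 1)
  suc[q∸1] = sym (ℕ.suc-pred q)

  -- Since n ≥ 2k ≥ 2 and q ≥ 2, the field F_{q^n} has at least four elements.
  2≤N : 2 ≤ N
  2≤N = ℕ.∸-monoˡ-≤ 1 (ℕ.≤-trans (ℕ.n≤1+n 3) (ℕ.≤-trans (ℕ.^-monoˡ-≤ 2 2≤q)
    (ℕ.^-monoʳ-≤ q (ℕ.≤-trans (ℕ.*-monoʳ-≤ 2 1≤k) 2k≤n))))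

  q∸1∣^∸1 : ∀ m → q ∸ 1 ∣ q ℕ.^ m ∸ 1
  q∸1∣^∸1 m = subst (λ p → q ∸ 1 ∣ p ℕ.^ m ∸ 1) (sym suc[q∸1]) (∸1∣^∸1 (q ∸ 1) m)

  q^k∸1∣N : q ℕ.^ k ∸ 1 ∣ N
  q^k∸1∣N = subst (λ e → q ℕ.^ k ∸ 1 ∣ e ∸ 1)
    (trans (cong (ℕ._^ s) (sym (suc[^∸1] k))) (trans (ℕ.^-*-assoc q k s) (cong (q ℕ.^_) (ℕ.*-comm k s))))
    (∸1∣^∸1 (q ℕ.^ k ∸ 1) s)

  open PrimitiveElement L (trans L-size (suc[^∸1] n)) 2≤N α-prim
  module SubF = Subfield κ-hom (trans F-size suc[q∸1]) (q∸1∣^∸1 n)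
  module SubK = Subfield j-hom (trans K-size (suc[^∸1] k)) q^k∸1∣N

  ^-of-∣ : ∀ {x a b} → a ∣ b → x L.^ a ≡ L.1# → x L.^ b ≡ L.1#
  ^-of-∣ {x} {a} (divides c refl) eq = trans (cong (x L.^_) (ℕ.*-comm c a)) (trans (L.^-* x a c) (trans (cong (L._^ c) eq) (L.1^ c)))

  -- The power q - 1 is trivial on F_q^×, so it depends only on the class modulo F_q^×.
  F-proportional⇒^≡ : ∀ {x y} → x ≢ L.0# → Proportional {F} κ x y → x L.^ (q ∸ 1) ≡ y L.^ (q ∸ 1)
  F-proportional⇒^≡ {x} {y} x≢0 (c , refl) = trans (L.*-^ (κ c) y (q ∸ 1))
    (trans (cong (L._* _) (SubF.subfield-unit⇒root c≢0)) (L.*-identityˡ _))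
    where
    c≢0 : c ≢ F.0#
    c≢0 refl = x≢0 (trans (cong (L._* y) κH.0-hom) (L.zeroˡ y))

  module _ (t : ℕ) .{{_ : NonZero t}} (t∣N : t ∣ N)
           (T : Matrix n n → Set) (subgroup : IsSubgroupOfOrderIn ψM-s T t)
           (𝓕 : Flag n (flagType k s)) (isFlag : IsFlag 𝓕)
           (inS : ∀ i → List.lookup (flagType k s) i ≡ k → InS (𝓕 ⟨ i ⟩))
           (inH : ∀ i → List.lookup (flagType k s) i ≡ n ∸ k → InH (𝓕 ⟨ i ⟩)) where

    open IsSubgroupOfOrderIn subgroup

    private
      c = ∣._∣_.quotient t∣N
      tc≡N : t ℕ.* c ≡ N
      tc≡N = trans (ℕ.*-comm t c) (sym (∣._∣_.equality t∣N))
      instance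
        cofactor≢0 : NonZero c
        cofactor≢0 = ℕ.m*n≢0⇒n≢0 t {{subst NonZero (sym tc≡N) (ℕ.>-nonZero (ℕ.≤-trans (s≤s z≤n) 2≤N))}}
      open RootsOfUnity {t} {c} tc≡N

      elt : Fin t → Matrix n n
      elt = proj₁ order
      exponent : Fin t → ℕ
      exponent l = proj₁ (⊆⟨g⟩ (elt l) (proj₁ (proj₂ order) l))
      scalar : Fin t → Car L
      scalar l = α L.^ exponent l
      scalar≢0 : ∀ l → scalar l ≢ L.0#
      scalar≢0 l = L.^-nonzero (exponent l) α≢0
      elt-acts : ∀ l → Acts β (elt l) (scalar l)
      elt-acts l = subst (λ A → Acts β A (scalar l)) (sym (proj₂ (⊆⟨g⟩ (elt l) (proj₁ (proj₂ order) l))))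
                     (Acts-^ₘ β {ψM-s} ψM-s-acts (exponent l))
      scalar-inj : Inj scalar
      scalar-inj l m eq = proj₁ (proj₂ (proj₂ order)) l m
        (Acts-unique β θ-inj (elt-acts l) (subst (Acts β (elt m)) (sym eq) (elt-acts m)))
      scalar-closed : ∀ l m → ∃[ p ] scalar p ≡ scalar l L.* scalar m
      scalar-closed l m =
        let p , eq = proj₂ (proj₂ (proj₂ order)) _ (closed _ _ (proj₁ (proj₂ order) l) (proj₁ (proj₂ order) m))
        in p , Acts-scalar-unique {elt p} (elt-acts p)
                 (subst (λ A → Acts β A (scalar l L.* scalar m)) eq (Acts-*ₘ β {elt l} {elt m} (elt-acts l) (elt-acts m)))

    T⇒root : ∀ A → T A → ∃[ x ] (x L.^ t ≡ L.1# × Acts β A x)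
    T⇒root A TA = let l , A≡ = proj₂ (proj₂ (proj₂ order)) A TA in
      scalar l , subgroup⇒root scalar scalar≢0 scalar-inj scalar-closed l ,
      subst (λ A → Acts β A (scalar l)) (sym A≡) (elt-acts l)

    root⇒T : ∀ {x} → x L.^ t ≡ L.1# → ∃[ A ] (T A × Acts β A x)
    root⇒T xᵗ = let l , eq = root⇒subgroup scalar scalar≢0 scalar-inj scalar-closed xᵗ in
      elt l , proj₁ (proj₂ order) l , subst (Acts β (elt l)) eq (elt-acts l)

    ≐-trans : ∀ {U V W : Sub n} → U ≐ V → V ≐ W → U ≐ W
    ≐-trans (p , p′) (r , r′) = (λ v → r v ∘ p v) , (λ v → p′ v ∘ r′ v)

    ≐-sym : ∀ {U V : Sub n} → U ≐ V → V ≐ U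
    ≐-sym (p , p′) = p′ , p

    𝓞 : Flag n (flagType k s) → Set
    𝓞 = Orb T 𝓕

    infix 21 𝓕⋆_
    𝓕⋆_ : Car L → Flag n (flagType k s)
    𝓕⋆ x = mkFlag (λ i → 𝓕 ⟨ i ⟩ ⋆ x)

    orbit⇒root : ∀ {𝓖} → 𝓞 𝓖 → ∃[ x ] (x L.^ t ≡ L.1# × 𝓖 ≈F 𝓕⋆ x)
    orbit⇒root (A , TA , 𝓖≈) = let x , xᵗ , act = T⇒root A TA in
      x , xᵗ , λ i → ≐-trans (𝓖≈ i) (·≐⋆ {A} (𝓕 ⟨ i ⟩) act)

    root⇒orbit : ∀ {x} → x L.^ t ≡ L.1# → 𝓞 (𝓕⋆ x)
    root⇒orbit xᵗ = let A , TA , act = root⇒T xᵗ in A , TA , λ i → ≐-sym (·≐⋆ {A} (𝓕 ⟨ i ⟩) act)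

    root≢0 : ∀ {x} → x L.^ t ≡ L.1# → x ≢ L.0#
    root≢0 = L.^≡1⇒nonzero t

    dim : Fin (length (flagType k s)) → ℕ
    dim = List.lookup (flagType k s)

    𝓕-isSubspace : ∀ i → IsSubspace (𝓕 ⟨ i ⟩)
    𝓕-isSubspace i = proj₁ (proj₁ isFlag i)

    𝓕-Dim : ∀ i → Dim (𝓕 ⟨ i ⟩) (dim i)
    𝓕-Dim i = proj₂ (proj₁ isFlag i)

    𝓕-mono : ∀ i l → dim i ≤ dim l → (𝓕 ⟨ i ⟩) ⊆ (𝓕 ⟨ l ⟩)
    𝓕-mono i l le = proj₂ isFlag i l (lookup-cancel-≤ flagType-sorted i l le)

    i₁ iₖ iₕ : Fin (length (flagType k s))
    i₁ = proj₁ (∈⇒index 1∈flagType)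
    iₖ = proj₁ (∈⇒index k∈flagType)
    iₕ = proj₁ (∈⇒index n∸k∈flagType)

    dim-i₁ : dim i₁ ≡ 1
    dim-i₁ = proj₂ (∈⇒index 1∈flagType)
    dim-iₖ : dim iₖ ≡ k
    dim-iₖ = proj₂ (∈⇒index k∈flagType)
    dim-iₕ : dim iₕ ≡ n ∸ k
    dim-iₕ = proj₂ (∈⇒index n∸k∈flagType)

    ≈⇒F-proportional : ∀ {x y} → 𝓕⋆ x ≈F 𝓕⋆ y → Proportional {F} κ x y
    ≈⇒F-proportional x≈y = line-⋆⊆⇒F-proportional (subst (Dim (𝓕 ⟨ i₁ ⟩)) dim-i₁ (𝓕-Dim i₁)) (proj₁ (x≈y i₁))

    F-proportional⇒≈ : ∀ {x y} → x ≢ L.0# → Proportional {F} κ x y → 𝓕⋆ x ≈F 𝓕⋆ y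
    F-proportional⇒≈ x≢0 x~y i = F-proportional⇒⋆⊆ (𝓕-isSubspace i) x~y
                               , F-proportional⇒⋆⊆ (𝓕-isSubspace i) (Proportional-sym {F} κ κ-hom x≢0 x~y)

    m = divByGcd t (q ∸ 1)

    t∣m[q∸1] : t ∣ m ℕ.* (q ∸ 1)
    t∣m[q∸1] = subst (_∣ m ℕ.* (q ∸ 1)) (divByGcd-*-gcd t (q ∸ 1)) (∣.*-monoʳ-∣ m (gcd[m,n]∣n t (q ∸ 1)))

    instance
      m≢0 : NonZero m
      m≢0 = ℕ.m*n≢0⇒m≢0 m {{subst NonZero (sym (divByGcd-*-gcd t (q ∸ 1))) (ℕ.≢-nonZero (ℕ.≢-nonZero⁻¹ t))}}

    ζ≢0 : ∀ i → ζ L.^ i ≢ L.0#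
    ζ≢0 i = L.^-nonzero i (root≢0 ζ^u)

    ζ^-root : ∀ i → (ζ L.^ i) L.^ t ≡ L.1#
    ζ^-root i = trans (sym (L.^-* ζ i t)) (^-of-∣ (divides i refl) ζ^u)

    -- Equal flags have proportional scalars; raising these to the power q - 1 gives t ∣ (l - i)(q -
    -- 1). So `m` divides l - i, which is below `m`.
    ζ^-inj-≤ : ∀ {i l} → i ≤ l → l < m → 𝓕⋆ (ζ L.^ i) ≈F 𝓕⋆ (ζ L.^ l) → i ≡ l
    ζ^-inj-≤ {i} {l} i≤l l<m eq = ℕ.≤-antisym i≤l (ℕ.m∸n≡0⇒m≤n (zero-below (∣*⇒divByGcd∣ t (q ∸ 1) (l ∸ i) (ζ^≡1⇒∣ _ ζ^≡1))))
      where
      open ≡-Reasoning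
      zero-below : m ∣ l ∸ i → l ∸ i ≡ 0
      zero-below m∣ with l ∸ i in eq′
      ... | zero  = refl
      ... | suc d = contradiction (∣.∣⇒≤ m∣) (ℕ.<⇒≱ (ℕ.≤-<-trans (subst (_≤ l) eq′ (ℕ.m∸n≤m l i)) l<m))
      ζ^≡1 : ζ L.^ ((l ∸ i) ℕ.* (q ∸ 1)) ≡ L.1#
      ζ^≡1 = L.*-cancelˡ ((ζ L.^ i) L.^ (q ∸ 1)) (L.^-nonzero (q ∸ 1) (ζ≢0 i)) (begin
        (ζ L.^ i) L.^ (q ∸ 1) L.* ζ L.^ ((l ∸ i) ℕ.* (q ∸ 1))      ≡⟨ cong ((ζ L.^ i) L.^ (q ∸ 1) L.*_) (L.^-* ζ (l ∸ i) (q ∸ 1)) ⟩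
        (ζ L.^ i) L.^ (q ∸ 1) L.* (ζ L.^ (l ∸ i)) L.^ (q ∸ 1)      ≡⟨ L.*-^ (ζ L.^ i) _ (q ∸ 1) ⟨
        (ζ L.^ i L.* ζ L.^ (l ∸ i)) L.^ (q ∸ 1)                    ≡⟨ cong (L._^ (q ∸ 1)) (trans (sym (L.^-+ ζ i (l ∸ i))) (cong (ζ L.^_) (ℕ.m+[n∸m]≡n i≤l))) ⟩
        (ζ L.^ l) L.^ (q ∸ 1)                                      ≡⟨ F-proportional⇒^≡ (ζ≢0 i) (≈⇒F-proportional eq) ⟨
        (ζ L.^ i) L.^ (q ∸ 1)                                      ≡⟨ L.*-identityʳ _ ⟨
        (ζ L.^ i) L.^ (q ∸ 1) L.* L.1#                             ∎)

    reduce : ℕ → Fin m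
    reduce e = fromℕ< (m%n<n e m)

    -- As t ∣ m (q - 1), the power ζ^m lies in F_q, so exponents matter only modulo `m`.
    𝓕⋆ζ^-reduce : ∀ e → 𝓕⋆ (ζ L.^ e) ≈F 𝓕⋆ (ζ L.^ toℕ (reduce e))
    𝓕⋆ζ^-reduce e = F-proportional⇒≈ (ζ≢0 e) (proj₁ F∋ , (begin
      ζ L.^ e                                        ≡⟨ cong (ζ L.^_) (trans (m≡m%n+[m/n]*n e m) (ℕ.+-comm (e % m) _)) ⟩
      ζ L.^ (e / m ℕ.* m ℕ.+ e % m)                  ≡⟨ L.^-+ ζ (e / m ℕ.* m) (e % m) ⟩
      ζ L.^ (e / m ℕ.* m) L.* ζ L.^ (e % m)          ≡⟨ cong₂ L._*_ (proj₂ F∋) (cong (ζ L.^_) (toℕ-fromℕ< (m%n<n e m))) ⟨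
      κ (proj₁ F∋) L.* ζ L.^ toℕ (reduce e)          ∎))
      where
      open ≡-Reasoning
      F∋ : ∃[ c ] κ c ≡ ζ L.^ (e / m ℕ.* m)
      F∋ = SubF.root⇒∈subfield (trans (sym (L.^-* ζ (e / m ℕ.* m) (q ∸ 1)))
             (^-of-∣ (subst (t ∣_) (sym (ℕ.*-assoc (e / m) m (q ∸ 1))) (∣.∣n⇒∣m*n (e / m) t∣m[q∸1])) ζ^u))

    orbit-card : Card 𝓞 m
    orbit-card = (λ i → 𝓕⋆ (ζ L.^ toℕ i)) , (λ i → root⇒orbit (ζ^-root (toℕ i))) , distinct , complete
      where
      distinct : ∀ i l → 𝓕⋆ (ζ L.^ toℕ i) ≈F 𝓕⋆ (ζ L.^ toℕ l) → i ≡ l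
      distinct i l eq = [ (λ i≤l → toℕ-injective (ζ^-inj-≤ i≤l (toℕ<n l) eq))
                        , (λ l≤i → sym (toℕ-injective (ζ^-inj-≤ l≤i (toℕ<n i) (≐-sym ∘ eq)))) ]′ (ℕ.≤-total (toℕ i) (toℕ l))
      complete : ∀ 𝓖 → 𝓞 𝓖 → ∃[ i ] 𝓖 ≈F 𝓕⋆ (ζ L.^ toℕ i)
      complete 𝓖 𝓖∈ = let x , xᵗ , 𝓖≈ = orbit⇒root {𝓖} 𝓖∈ ; e , x≡ = root⇒ζ^ xᵗ in
        reduce e , λ l → ≐-trans (subst (λ x → 𝓖 ⟨ l ⟩ ≐ (𝓕⋆ x) ⟨ l ⟩) x≡ (𝓖≈ l)) (𝓕⋆ζ^-reduce e l)

    -- Distances between flags of the orbit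

    dims : ∀ i → (1 ≤ dim i × dim i ≤ k) ⊎ (n ∸ k ≤ dim i × dim i < n)
    dims i = All.lookup flagType-bounds (∈-lookup i)

    dim≤n : ∀ i → dim i ≤ n
    dim≤n i = [ (λ (_ , le) → ℕ.≤-trans le k≤n) , (λ (_ , lt) → ℕ.<⇒≤ lt) ]′ (dims i)

    dist-bound : Fin (length (flagType k s)) → ℕ
    dist-bound i = 2 ℕ.* maxDim n (dim i)

    module Component {𝓖 : Flag n (flagType k s)} {x : Car L} (x≢0 : x ≢ L.0#) (𝓖≈ : 𝓖 ≈F 𝓕⋆ x) (i : Fin (length (flagType k s))) where
      isSubspace : IsSubspace (𝓖 ⟨ i ⟩)
      isSubspace = IsSubspace-resp-≐ (≐-sym (𝓖≈ i)) (⋆-isSubspace x (𝓕-isSubspace i))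
      hasDim : Dim (𝓖 ⟨ i ⟩) (dim i)
      hasDim = Dim-resp-≐ (≐-sym (𝓖≈ i)) (⋆-Dim x≢0 (𝓕-Dim i))

    module Pair {𝓖 𝓗 : Flag n (flagType k s)} {x y : Car L} (xᵗ : x L.^ t ≡ L.1#) (yᵗ : y L.^ t ≡ L.1#)
                (𝓖≈ : 𝓖 ≈F 𝓕⋆ x) (𝓗≈ : 𝓗 ≈F 𝓕⋆ y) where
      private
        module G = Component {𝓖} (root≢0 xᵗ) 𝓖≈
        module H = Component {𝓗} (root≢0 yᵗ) 𝓗≈

      F-proportional⇒≈′ : Proportional {F} κ x y → 𝓖 ≈F 𝓗
      F-proportional⇒≈′ x~y i = ≐-trans (𝓖≈ i) (≐-trans (F-proportional⇒≈ (root≢0 xᵗ) x~y i) (≐-sym (𝓗≈ i)))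

      formula : ∀ i {a b} → Dim (𝓖 ⟨ i ⟩ ⊞ 𝓗 ⟨ i ⟩) a → Dim (𝓖 ⟨ i ⟩ ∩ 𝓗 ⟨ i ⟩) b → a ℕ.+ b ≡ dim i ℕ.+ dim i
      formula i = dim-⊞+dim-∩ (G.isSubspace i) (G.hasDim i) (H.isSubspace i) (H.hasDim i)

      DistS-exists′ : ∀ i → ∃[ d ] DistS (𝓖 ⟨ i ⟩) (𝓗 ⟨ i ⟩) d
      DistS-exists′ i = DistS-exists (G.isSubspace i) (G.hasDim i) (H.isSubspace i) (H.hasDim i)

      DistF-exists : ∃[ ds ] ((∀ i → DistS (𝓖 ⟨ i ⟩) (𝓗 ⟨ i ⟩) (ds i)) × DistF 𝓖 𝓗 (sumℕ ds))
      DistF-exists = proj₁ ∘ DistS-exists′ , proj₂ ∘ DistS-exists′ , sumℕ-DistF 𝓖 𝓗 _ (proj₂ ∘ DistS-exists′)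

      DistS≤ : ∀ i {d} → DistS (𝓖 ⟨ i ⟩) (𝓗 ⟨ i ⟩) d → d ≤ dist-bound i
      DistS≤ i (a , b , dS , dI , refl) = dist≤max {n} {dim i} {a} {b} (formula i dS dI) (dim≤n i) (LinIndep⇒≤ (proj₁ (proj₂ (proj₂ dS))))

      -- An inclusion of the two components gives an intersection of dimension at least k; the
      -- dimension formula then keeps the sum at dimension at most k.
      K-proportional⇒DistS≡0 : Proportional {K} j x y → ∀ {d} → DistS (𝓖 ⟨ iₖ ⟩) (𝓗 ⟨ iₖ ⟩) d → d ≡ 0
      K-proportional⇒DistS≡0 x~y (a , b , dS , dI , refl) = ℕ.m≤n⇒m∸n≡0 (ℕ.≤-trans a≤dim dim≤b)
        where
        𝓖⊆𝓗 : (𝓖 ⟨ iₖ ⟩) ⊆ (𝓗 ⟨ iₖ ⟩)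
        𝓖⊆𝓗 v = proj₂ (𝓗≈ iₖ) v ∘ K-proportional⇒⋆⊆ (InS⇒IsKLine (inS iₖ dim-iₖ)) x~y v ∘ proj₁ (𝓖≈ iₖ) v
        dim≤b : dim iₖ ≤ b
        dim≤b = Dim-mono (G.isSubspace iₖ) (G.hasDim iₖ) (∩-isSubspace (G.isSubspace iₖ) (H.isSubspace iₖ)) dI
                  (λ v Gv → Gv , 𝓖⊆𝓗 v Gv)
        a≤dim : a ≤ dim iₖ
        a≤dim = ℕ.+-cancelʳ-≤ b a (dim iₖ) (ℕ.≤-trans (ℕ.≤-reflexive (formula iₖ dS dI)) (ℕ.+-monoʳ-≤ (dim iₖ) dim≤b))

      module _ (x≁y : ¬ Proportional {K} j x y) (i : Fin (length (flagType k s))) where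

        trivial-∩ : dim i ≤ k → ∀ v → (𝓖 ⟨ i ⟩ ∩ 𝓗 ⟨ i ⟩) v → v ≡ zeroV
        trivial-∩ dim≤k v (Gv , Hv) = decidable-stable (finite-≟ (Vector↔ n) v zeroV) λ v≢0 → x≁y
          (KLine-⋆-meet⇒K-proportional (InS⇒IsKLine (inS iₖ dim-iₖ)) v≢0
            (⋆-mono ⊆𝓕ₖ v (proj₁ (𝓖≈ i) v Gv)) (⋆-mono ⊆𝓕ₖ v (proj₁ (𝓗≈ i) v Hv)))
          where
          ⊆𝓕ₖ : (𝓕 ⟨ i ⟩) ⊆ (𝓕 ⟨ iₖ ⟩)
          ⊆𝓕ₖ = 𝓕-mono i iₖ (subst (dim i ≤_) (sym dim-iₖ) dim≤k)

        full-⊞ : n ∸ k ≤ dim i → ∀ v → (𝓖 ⟨ i ⟩ ⊞ 𝓗 ⟨ i ⟩) v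
        full-⊞ n∸k≤dim v =
          let u , w , xu , yw , eq = hyperplane-⋆-⊞-full k≤n n∸k<n (𝓕-isSubspace iₕ) (subst (Dim (𝓕 ⟨ iₕ ⟩)) dim-iₕ (𝓕-Dim iₕ))
                                       (InH⇒IsKClosed (inH iₕ dim-iₕ)) (root≢0 xᵗ) (root≢0 yᵗ) x≁y v
          in u , w , proj₂ (𝓖≈ i) u (⋆-mono 𝓕ₕ⊆ u xu) , proj₂ (𝓗≈ i) w (⋆-mono 𝓕ₕ⊆ w yw) , eq
          where
          𝓕ₕ⊆ : (𝓕 ⟨ iₕ ⟩) ⊆ (𝓕 ⟨ i ⟩)
          𝓕ₕ⊆ = 𝓕-mono iₕ i (subst (_≤ dim i) (sym dim-iₕ) n∸k≤dim)

        ¬K-proportional⇒DistS≡ : ∀ {d} → DistS (𝓖 ⟨ i ⟩) (𝓗 ⟨ i ⟩) d → d ≡ dist-bound i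
        ¬K-proportional⇒DistS≡ (a , b , dS , dI , d≡) = trans d≡ ([
            (λ (_ , dim≤k) → dist-trivial-∩ {n} {dim i} {a} {b} (formula i dS dI) (ℕ.≤-trans (ℕ.*-monoʳ-≤ 2 dim≤k) 2k≤n)
              (Basis.trivial⇒≡0 (∩-isSubspace (G.isSubspace i) (H.isSubspace i)) dI (trivial-∩ dim≤k)))
          , (λ (n∸k≤dim , _) → dist-full-⊞ {n} {dim i} {a} {b} (formula i dS dI) (dim≤n i) (n≤2* n∸k≤dim)
              (Basis.full⇒≡ (⊞-isSubspace (G.isSubspace i) (H.isSubspace i)) dS (full-⊞ n∸k≤dim)))
          ]′ (dims i))

    dmax : ℕ
    dmax = maxFlagDist n (flagType k s)

    dmax≡ : dmax ≡ sumℕ dist-bound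
    dmax≡ = maxFlagDist≡sumℕ n (flagType k s)

    0<dist-bound-iₖ : 0 < dist-bound iₖ
    0<dist-bound-iₖ = subst (λ d → 0 < 2 ℕ.* d) (sym (trans (cong (maxDim n) dim-iₖ) (maxDim-≤ {n} {k} 2k≤n)))
                        (ℕ.≤-trans 1≤k (ℕ.m≤m+n k _))

    -- Prevents an orbit with a single flag, whose minimum distance is 0, from counting as optimum.
    0<dmax : 0 < dmax
    0<dmax = subst (0 <_) (sym dmax≡) (ℕ.≤-<-trans z≤n (sumℕ-mono-< {f = λ _ → 0} (λ _ → z≤n) iₖ 0<dist-bound-iₖ))

    𝓕⋆≈ : ∀ {x} → 𝓕⋆ x ≈F 𝓕⋆ x
    𝓕⋆≈ _ = (λ _ p → p) , (λ _ p → p)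

    1ᵗ : L.1# L.^ t ≡ L.1#
    1ᵗ = L.1^ t

    1≈⇒^≡1 : ∀ {x} → 𝓕⋆ L.1# ≈F 𝓕⋆ x → x L.^ (q ∸ 1) ≡ L.1#
    1≈⇒^≡1 eq = trans (sym (F-proportional⇒^≡ L.1≢0 (≈⇒F-proportional eq))) (L.1^ (q ∸ 1))

    -- The gcd criterion for optimum distance

    module _ (gcds≡ : gcd t (q ℕ.^ k ∸ 1) ≡ gcd t (q ∸ 1)) where

      -- The factor x / y is a `t`-th root of unity and a unit of F_{q^k}, so its order divides the
      -- gcd of t and q^k - 1. By hypothesis this gcd divides q - 1, which puts the factor into F_q.
      K-proportional⇒F-proportional : ∀ {x y} → x L.^ t ≡ L.1# → y L.^ t ≡ L.1# → Proportional {K} j x y → Proportional {F} κ x y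
      K-proportional⇒F-proportional {x} {y} xᵗ yᵗ (c , x≡) =
        proj₁ jc∈F , trans x≡ (cong (L._* y) (sym (proj₂ jc∈F)))
        where
        open ≡-Reasoning
        c≢0 : c ≢ K.0#
        c≢0 c≡0 = root≢0 xᵗ (trans x≡ (trans (cong (L._* y) (trans (cong j c≡0) jH.0-hom)) (L.zeroˡ y)))
        jc≢0 : j c ≢ L.0#
        jc≢0 = jH.nonzero-hom c≢0
        jcᵗ : j c L.^ t ≡ L.1#
        jcᵗ = begin
          j c L.^ t                 ≡⟨ L.*-identityʳ _ ⟨
          j c L.^ t L.* L.1#        ≡⟨ cong (j c L.^ t L.*_) yᵗ ⟨
          j c L.^ t L.* y L.^ t     ≡⟨ L.*-^ (j c) y t ⟨
          (j c L.* y) L.^ t         ≡⟨ trans (cong (L._^ t) (sym x≡)) xᵗ ⟩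
          L.1#                      ∎
        jcᴳ : j c L.^ gcd t (q ℕ.^ k ∸ 1) ≡ L.1#
        jcᴳ = ^≡1∧^≡1⇒^gcd≡1 {j c} t (q ℕ.^ k ∸ 1) jc≢0 jcᵗ (SubK.subfield-unit⇒root {c} c≢0)
        jcᵍ : j c L.^ gcd t (q ∸ 1) ≡ L.1#
        jcᵍ = trans (cong (j c L.^_) (sym gcds≡)) jcᴳ
        jc∈F : ∃[ d ] κ d ≡ j c
        jc∈F = SubF.root⇒∈subfield {j c} (^-of-∣ {j c} {gcd t (q ∸ 1)} {q ∸ 1} (gcd[m,n]∣n t (q ∸ 1)) jcᵍ)

      distinct⇒DistS≡ : ∀ {𝓖 𝓗} → 𝓞 𝓖 → 𝓞 𝓗 → ¬ (𝓖 ≈F 𝓗) → ∀ i {d} → DistS (𝓖 ⟨ i ⟩) (𝓗 ⟨ i ⟩) d → d ≡ dist-bound i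
      distinct⇒DistS≡ {𝓖} {𝓗} 𝓖∈ 𝓗∈ 𝓖≉𝓗 = P.¬K-proportional⇒DistS≡
          (𝓖≉𝓗 ∘ P.F-proportional⇒≈′ ∘ K-proportional⇒F-proportional xᵗ yᵗ)
        where
        xᵗ = proj₁ (proj₂ (orbit⇒root {𝓖} 𝓖∈))
        yᵗ = proj₁ (proj₂ (orbit⇒root {𝓗} 𝓗∈))
        module P = Pair {𝓖} {𝓗} xᵗ yᵗ (proj₂ (proj₂ (orbit⇒root {𝓖} 𝓖∈))) (proj₂ (proj₂ (orbit⇒root {𝓗} 𝓗∈)))

      gcds⇒optimum : gcd t (q ∸ 1) ≢ t → OptimumDistance F 𝓞
      gcds⇒optimum g≢t = inj₂ ((𝓕⋆ L.1# , 𝓕⋆ ζ , 1∈ , ζ∈ , 1≉ζ , subst (DistF (𝓕⋆ L.1#) (𝓕⋆ ζ)) ds≡dmax dist)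
        , λ 𝓖 𝓗 e 𝓖∈ 𝓗∈ 𝓖≉𝓗 dist → ℕ.≤-reflexive (sym (trans (DistF⇒sumℕ {𝓕 = 𝓖} {𝓗} dist)
            (trans (sumℕ-cong (λ i → distinct⇒DistS≡ {𝓖} {𝓗} 𝓖∈ 𝓗∈ 𝓖≉𝓗 i (proj₁ (proj₂ dist) i))) (sym dmax≡)))))
        where
        1∈ : 𝓞 (𝓕⋆ L.1#)
        1∈ = root⇒orbit 1ᵗ
        ζ∈ : 𝓞 (𝓕⋆ ζ)
        ζ∈ = root⇒orbit ζ^u
        -- ζ has order `t`; if it fixed the flag, `t` would divide q - 1 and equal the gcd.
        1≉ζ : ¬ (𝓕⋆ L.1# ≈F 𝓕⋆ ζ)
        1≉ζ eq = g≢t (∣.∣-antisym (gcd[m,n]∣m t (q ∸ 1)) (gcd-greatest ∣.∣-refl (ζ^≡1⇒∣ (q ∸ 1) (1≈⇒^≡1 eq))))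
        distF = Pair.DistF-exists {𝓕⋆ L.1#} {𝓕⋆ ζ} 1ᵗ ζ^u (𝓕⋆≈ {L.1#}) (𝓕⋆≈ {ζ})
        dist : DistF (𝓕⋆ L.1#) (𝓕⋆ ζ) (sumℕ (proj₁ distF))
        dist = proj₂ (proj₂ distF)
        ds≡dmax : sumℕ (proj₁ distF) ≡ dmax
        ds≡dmax = trans (sumℕ-cong (λ i → distinct⇒DistS≡ {𝓕⋆ L.1#} {𝓕⋆ ζ} 1∈ ζ∈ 1≉ζ i (proj₁ (proj₂ distF) i))) (sym dmax≡)

    optimum⇒gcds : OptimumDistance F 𝓞 → gcd t (q ℕ.^ k ∸ 1) ≡ gcd t (q ∸ 1) × gcd t (q ∸ 1) ≢ t
    optimum⇒gcds (inj₁ (_ , dmax≡0)) = contradiction dmax≡0 (ℕ.>⇒≢ 0<dmax)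
    optimum⇒gcds (inj₂ ((𝓖 , 𝓗 , 𝓖∈ , 𝓗∈ , 𝓖≉𝓗 , _) , minimal)) = ∣.∣-antisym G∣gcd gcd∣G , g≢t
      where
      -- If `t` divided q - 1, all `t`-th roots of unity would lie in F_q and fix the flag, leaving
      -- no two distinct flags in the orbit.
      g≢t : gcd t (q ∸ 1) ≢ t
      g≢t g≡t = let x , xᵗ , 𝓖≈ = orbit⇒root {𝓖} 𝓖∈ ; y , yᵗ , 𝓗≈ = orbit⇒root {𝓗} 𝓗∈ in
        𝓖≉𝓗 λ i → ≐-trans (𝓖≈ i) (≐-trans (≈1 xᵗ i) (≐-sym (≐-trans (𝓗≈ i) (≈1 yᵗ i))))
        where
        ≈1 : ∀ {x} → x L.^ t ≡ L.1# → 𝓕⋆ x ≈F 𝓕⋆ L.1#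
        ≈1 {x} xᵗ = F-proportional⇒≈ (root≢0 xᵗ) (proj₁ x∈F , trans (sym (proj₂ x∈F)) (sym (L.*-identityʳ _)))
          where
          xᵍ : x L.^ gcd t (q ∸ 1) ≡ L.1#
          xᵍ = trans (cong (x L.^_) g≡t) xᵗ
          x∈F : ∃[ d ] κ d ≡ x
          x∈F = SubF.root⇒∈subfield {x} (^-of-∣ {x} {gcd t (q ∸ 1)} {q ∸ 1} (gcd[m,n]∣n t (q ∸ 1)) xᵍ)

      G = gcd t (q ℕ.^ k ∸ 1)
      gcd∣G : gcd t (q ∸ 1) ∣ G
      gcd∣G = gcd-greatest (gcd[m,n]∣m t (q ∸ 1)) (∣.∣-trans (gcd[m,n]∣n t (q ∸ 1)) (q∸1∣^∸1 k))
      G∣t : G ∣ t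
      G∣t = gcd[m,n]∣m t (q ℕ.^ k ∸ 1)
      G∣N : G ∣ N
      G∣N = ∣.∣-trans G∣t t∣N
      Gc≡N : G ℕ.* ∣._∣_.quotient G∣N ≡ N
      Gc≡N = trans (ℕ.*-comm G _) (sym (∣._∣_.equality G∣N))
      N≢0 : NonZero (G ℕ.* ∣._∣_.quotient G∣N)
      N≢0 = subst NonZero (sym Gc≡N) (ℕ.>-nonZero (ℕ.≤-trans (s≤s z≤n) 2≤N))
      module Gᵗʰ = RootsOfUnity {G} {∣._∣_.quotient G∣N} {{ℕ.m*n≢0⇒m≢0 G {{N≢0}}}} {{ℕ.m*n≢0⇒n≢0 G {{N≢0}}}} Gc≡N
      -- A generator of the `t`-th roots of unity contained in F_{q^k}: if this one lies in F_q, its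
      -- order `G` divides q - 1.
      z : Car L
      z = Gᵗʰ.ζ
      zᵗ : z L.^ t ≡ L.1#
      zᵗ = ^-of-∣ {z} {G} {t} G∣t Gᵗʰ.ζ^u
      1~z : Proportional {K} j L.1# z
      1~z = let d , eq = SubK.root⇒∈subfield {z} (^-of-∣ {z} {G} {q ℕ.^ k ∸ 1} (gcd[m,n]∣n t (q ℕ.^ k ∸ 1)) Gᵗʰ.ζ^u) in
        Proportional-sym {K} j j-hom (root≢0 zᵗ) (d , trans (sym eq) (sym (L.*-identityʳ _)))
      module P = Pair {𝓕⋆ L.1#} {𝓕⋆ z} 1ᵗ zᵗ (𝓕⋆≈ {L.1#}) (𝓕⋆≈ {z})
      -- Otherwise 𝓕 and 𝓕 z would be distinct flags sharing their k-dimensional subspace.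
      z∈F : z L.^ (q ∸ 1) ≡ L.1#
      z∈F = decidable-stable (z L.^ (q ∸ 1) L.≟ L.1#) λ z∉F →
        let ds , distS , dist = P.DistF-exists in
        contradiction (minimal (𝓕⋆ L.1#) (𝓕⋆ z) (sumℕ ds) (root⇒orbit 1ᵗ) (root⇒orbit zᵗ) (z∉F ∘ 1≈⇒^≡1) dist)
          (ℕ.<⇒≱ (subst (sumℕ ds <_) (sym dmax≡) (sumℕ-mono-< (λ i → P.DistS≤ i (distS i)) iₖ
            (subst (_< dist-bound iₖ) (sym (P.K-proportional⇒DistS≡0 1~z (distS iₖ))) 0<dist-bound-iₖ))))
      G∣gcd : G ∣ gcd t (q ∸ 1)
      G∣gcd = gcd-greatest G∣t (Gᵗʰ.ζ^≡1⇒∣ (q ∸ 1) z∈F)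

    optimum⇔gcds : OptimumDistance F 𝓞 ⇔ (gcd t (q ℕ.^ k ∸ 1) ≡ gcd t (q ∸ 1) × gcd t (q ∸ 1) ≢ t)
    optimum⇔gcds = mk⇔ optimum⇒gcds (λ (gcds≡ , g≢t) → gcds⇒optimum gcds≡ g≢t)

open import Data.Nat using (_*_; _^_)
open import Data.List using (lookup)
open LinAlg using (Matrix; IsSubgroupOfOrderIn; Flag; IsFlag; _⟨_⟩; Card; Orb)
open Constructions using (ψM-s; InS; InH)

theorem5p1 : (q k s : ℕ) → 2 ≤ s → (σ : Setting q k s) →
    (t : ℕ) .{{_ : NonZero t}} → t ∣ q ^ (s * k) ∸ 1 →
    (T : Matrix (Setting.F σ) (s * k) (s * k) → Set) →
    IsSubgroupOfOrderIn (Setting.F σ) (ψM-s σ) T t →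
    (𝓕 : Flag (Setting.F σ) (s * k) (flagType k s)) → IsFlag (Setting.F σ) 𝓕 →
    (∀ i → lookup (flagType k s) i ≡ k → InS σ (𝓕 ⟨ i ⟩)) →
    (∀ i → lookup (flagType k s) i ≡ s * k ∸ k → InH σ (𝓕 ⟨ i ⟩)) →
    Card (Setting.F σ) (Orb (Setting.F σ) T 𝓕) (divByGcd t (q ∸ 1))
    × (OptimumDistance (Setting.F σ) (Orb (Setting.F σ) T 𝓕)
       ⇔ (gcd t (q ^ k ∸ 1) ≡ gcd t (q ∸ 1) × gcd t (q ∸ 1) ≢ t))
theorem5p1 q k s 2≤s σ t t∣N T subgroup 𝓕 isFlag inS inH =
    orbit-card t t∣N T subgroup 𝓕 isFlag inS inH
  , optimum⇔gcds t t∣N T subgroup 𝓕 isFlag inS inH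
  where open Orbit 2≤s σ
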